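{- Let $n$ be an integer with $6<n\le 33895685$. Then there is no binary sequence of period $n$ all of whose nontrivial autocorrelation values equal $2$, i.e. there is no sequence $\mathbf a=(a_0,a_1,\ldots)$ with $a_j\in\{ -1,1\}$, $a_{j+n}=a_j$ for all $j\ge 0$, and $C_{\mathbf a}(t)=2$ for all $1\le t\le n-1$.
   Context: For a sequence $\mathbf a=(a_0,a_1,\ldots)$ with $a_j\in\{ -1,1\}$ and $a_{j+n}=a_j$ for all $j\ge0$ (a binary sequence of period $n$), the autocorrelation values are $C_{\mathbf a}(t)=\sum_{i=0}^{n-1}a_ia_{i+t}$ for $0\le t\le n-1$; the values with $1\le t\le n-1$ are called nontrivial. -}

module Defs where

open import Data.Nat using (ℕ; zero; suc; _+_)
open import Data.Integer using (ℤ; +_; -_; 0ℤ) renaming (_+_ to _+ℤ_; _*_ to _*ℤ_)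
open import Data.Sum using (_⊎_)
open import Data.Product using (_×_)
open import Relation.Binary.PropositionalEquality using (_≡_)

sumTo : ℕ → (ℕ → ℤ) → ℤ
sumTo zero    f = 0ℤ
sumTo (suc n) f = sumTo n f +ℤ f n

IsBinarySeqOfPeriod : ℕ → (ℕ → ℤ) → Set
IsBinarySeqOfPeriod n a =
  (∀ j → a j ≡ + 1 ⊎ a j ≡ - (+ 1)) × (∀ j → a (j + n) ≡ a j)

autocorr : ℕ → (ℕ → ℤ) → ℕ → ℤ
autocorr n a t = sumTo n (λ i → a i *ℤ a (i + t))

{-# OPTIONS --safe #-}

-- Let A be the group ring element of such a sequence.  Counting shows n = 2m with m odd, and
-- writing ℤ/n = ℤ/2 × ℤ/m, A splits into X₀, X₁ ∈ ℤ[ℤ/m].  The half difference D and half sum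
-- S of X₀ and X₁ have complementary supports and satisfy D D* = N, S S* = N + G, where
-- m = 2N + 1 and G is the sum of all group elements.  Augmentation gives N = u² and Pell's
-- equation s² = 3u² + 1, so u ∈ {4, 15, 56, 209, 780} in the given range.
--
-- Modulo a prime p ∤ w the ring ℤ[ℤ/w] is a product of fields, each stable under the Frobenius
-- lift g ↦ g^p.  Hence if p^2a divides X X* and p^j ≡ -1 mod w, then p^a divides X; and if
-- M² = X X* and t is a power modulo w of each prime divisor of M, then t is a multiplier of X.
--
-- For u = 4, 15, 780 an image of D is divisible by a number exceeding its coefficients, hence
-- zero.  For u = 209 there is a multiplier t of D in ℤ/9707, 9707 = 17 · 571, and D is ±209 at
-- a single point of ℤ/17; summing the t-orbits of length 285 in the fibre over this point gives
-- ±209 modulo 285 as a coefficient, too large.  For u = 56 the same analysis in ℤ/697,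
-- 697 = 17 · 41, bounds the central coefficients of D and S below by 4 and 6 in absolute value.
-- If the centres agree this contradicts |D| + |S| ≤ 9; otherwise D modulo 2, being the
-- complement of S, is invariant under a translation, which makes D even and its central
-- coefficient again too large.
module Submission where

open import Defs
open import Data.Nat using (ℕ; _<_; _≤_)
open import Data.Integer using (+_)
open import Data.Product using (_×_; ∃-syntax)
open import Relation.Nullary using (¬_)
open import Relation.Binary.PropositionalEquality using (_≡_)

open import Algebra.Bundles using (CommutativeRing; Semiring)
open import Algebra.Morphism.Structures using (module SemiringMorphisms)
import Algebra.Properties.CommutativeSemiring.Binomial as BinomialTheorem
import Algebra.Properties.Monoid.Sum as MonoidSum
import Algebra.Properties.Semiring.Exp as SemiringExp
import Algebra.Properties.Semiring.Mult as SemiringMult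
import Algebra.Solver.Ring.NaturalCoefficients.Default as SemiringSolver
open import Data.Fin.Base as Fin using (Fin; toℕ; inject₁; fromℕ)
open import Data.Fin.Properties using (toℕ-fromℕ; toℕ-inject₁; toℕ<n)
open import Data.Nat.Base as ℕ using (zero; suc; _!; s≤s; z≤n)
open import Data.Nat.Combinatorics using (_C_; nCn≡1; nCk≡n!/k![n-k]!; k![n∸k]!∣n!)
import Data.Nat.Divisibility as ℕ
open import Data.Nat.DivMod using (m/n*n≡m)
open import Data.Nat.Primality
  using (Prime; prime; prime?; prime⇒nonZero; prime⇒nonTrivial; euclidsLemma)
import Data.Nat.Properties as ℕ
open import Data.Product using (_,_; ∃; ∃₂; proj₁; proj₂)
open import Data.Sum using (_⊎_; inj₁; inj₂)
open import Function using (_∘_)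
open import Level using (0ℓ; _⊔_)
import Relation.Binary.PropositionalEquality as ≡
open import Relation.Nullary using (contradiction)

-- Frobenius lifts and prime powers

-- The choice of the quotient ℤ/w is the real constraint. Passing from ℤ/m to ℤ/w with m = c w lets
-- the coefficients grow up to c, so c should be small. But the divisibility arguments want -1, or a
-- common power t of the primes dividing u with t - 1 invertible, among the powers modulo w, and
-- this can fail modulo m. Each period is therefore treated in a quotient where these powers exist
-- and where c is still below the size that divisibility or the orbit count forces on some
-- coefficient. For S there is a second obstacle: the term G in S S*. It is cancelled by subtracting
-- from S a multiple of G, whose factor is a root of a quadratic equation with discriminant N = u²;
-- the factor is rational, which explains the scaling of S by 17. All arithmetic of primes takes
-- place in the integral group ring itself: since R/p is von Neumann regular, it has no nilpotents
-- and its ideals are generated by idempotents locally enough to be followed from p up to p^m.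

prime∤! : ∀ {p} → Prime p → ∀ {k} → k ℕ.< p → ¬ (p ℕ.∣ k !)
prime∤! pr@(prime _) {zero}  _   p∣1 = contradiction (ℕ.∣1⇒≡1 p∣1) ℕ.nonTrivial⇒≢1
prime∤! {p} pr {suc k} k<p p∣k! with euclidsLemma (suc k) (k !) pr p∣k!
... | inj₁ p∣1+k = ℕ.>⇒∤ k<p p∣1+k
... | inj₂ p∣k!  = prime∤! pr (ℕ.<-trans (ℕ.n<1+n k) k<p) p∣k!

prime∣nCk : ∀ {p} → Prime p → ∀ {k} → suc k ℕ.< p → p ℕ.∣ (p C suc k)
prime∣nCk {p} pr {k} k<p
  with euclidsLemma (p C suc k) (suc k ! ℕ.* (p ℕ.∸ suc k) !) pr (≡.subst (p ℕ.∣_) p!≡ (n∣n! p pr))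
  where
  n∣n! : ∀ n → Prime n → n ℕ.∣ n !
  n∣n! (suc n) _ = ℕ.m∣m*n (n !)
  instance _ = suc k ℕ.!* (p ℕ.∸ suc k) !≢0
  p!≡ : p ! ≡ (p C suc k) ℕ.* (suc k ! ℕ.* (p ℕ.∸ suc k) !)
  p!≡ = ≡.sym (≡.trans (≡.cong (ℕ._* (suc k ! ℕ.* (p ℕ.∸ suc k) !)) (nCk≡n!/k![n-k]! (ℕ.<⇒≤ k<p)))
                       (m/n*n≡m (k![n∸k]!∣n! (ℕ.<⇒≤ k<p))))
... | inj₁ p∣C = p∣C
... | inj₂ p∣d with euclidsLemma (suc k !) ((p ℕ.∸ suc k) !) pr p∣d
...   | inj₁ p∣k!   = contradiction p∣k! (prime∤! pr k<p)
...   | inj₂ p∣p-k! = contradiction p∣p-k! (prime∤! pr (ℕ.∸-monoʳ-< {p} (s≤s z≤n) (ℕ.<⇒≤ k<p)))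

module FrobeniusLift {c ℓ} (R : CommutativeRing c ℓ) where

  open CommutativeRing R hiding (zero)
  open SemiringExp semiring
  open SemiringMult semiring renaming (_×_ to _·_)
  open SemiringMorphisms (Semiring.rawSemiring semiring) (Semiring.rawSemiring semiring) using (IsSemiringHomomorphism)
  open import Relation.Binary.Reasoning.Setoid setoid

  open SemiringSolver commutativeSemiring using (solve; _:=_; _:+_; _:*_)

  infix 4 _≈_mod_
  record _≈_mod_ (x y μ : Carrier) : Set (c ⊔ ℓ) where
    constructor _,_
    field
      quotient : Carrier
      equality : x ≈ y + μ * quotient

  open _≈_mod_

  ≈⇒≈mod : ∀ {x y μ} → x ≈ y → x ≈ y mod μ
  ≈⇒≈mod {x} {y} {μ} x≈y = 0# , (begin
    x           ≈⟨ x≈y ⟩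
    y           ≈⟨ +-identityʳ y ⟨
    y + 0#      ≈⟨ +-congˡ (zeroʳ μ) ⟨
    y + μ * 0#  ∎)

  ≈mod-trans : ∀ {x y z μ} → x ≈ y mod μ → y ≈ z mod μ → x ≈ z mod μ
  ≈mod-trans {x} {y} {z} {μ} (r , x≈) (s , y≈) = s + r , (begin
    x                    ≈⟨ x≈ ⟩
    y + μ * r            ≈⟨ +-congʳ y≈ ⟩
    z + μ * s + μ * r    ≈⟨ lemma z μ s r ⟩
    z + μ * (s + r)      ∎)
    where
    lemma : ∀ z μ s r → z + μ * s + μ * r ≈ z + μ * (s + r)
    lemma = solve 4 (λ z μ s r → z :+ μ :* s :+ μ :* r := z :+ μ :* (s :+ r)) refl

  ≈mod-sym : ∀ {x y μ} → x ≈ y mod μ → y ≈ x mod μ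
  ≈mod-sym {x} {y} {μ} (r , x≈) = - r , (begin
    y                        ≈⟨ +-identityʳ y ⟨
    y + 0#                   ≈⟨ +-congˡ (zeroʳ μ) ⟨
    y + μ * 0#               ≈⟨ +-congˡ (*-congˡ (-‿inverseʳ r)) ⟨
    y + μ * (r + - r)        ≈⟨ lemma y μ r (- r) ⟩
    y + μ * r + μ * - r      ≈⟨ +-congʳ x≈ ⟨
    x + μ * - r              ∎)
    where
    lemma : ∀ y μ r s → y + μ * (r + s) ≈ y + μ * r + μ * s
    lemma = solve 4 (λ y μ r s → y :+ μ :* (r :+ s) := y :+ μ :* r :+ μ :* s) refl

  +-mod : ∀ {x x′ y y′ μ} → x ≈ x′ mod μ → y ≈ y′ mod μ → x + y ≈ x′ + y′ mod μ
  +-mod {x} {x′} {y} {y′} {μ} (r , x≈) (s , y≈) = r + s , (begin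
    x + y                        ≈⟨ +-cong x≈ y≈ ⟩
    x′ + μ * r + (y′ + μ * s)    ≈⟨ lemma x′ y′ μ r s ⟩
    x′ + y′ + μ * (r + s)        ∎)
    where
    lemma : ∀ x y μ r s → x + μ * r + (y + μ * s) ≈ x + y + μ * (r + s)
    lemma = solve 5 (λ x y μ r s → x :+ μ :* r :+ (y :+ μ :* s) := x :+ y :+ μ :* (r :+ s)) refl

  *-mod : ∀ {x x′ y y′ μ} → x ≈ x′ mod μ → y ≈ y′ mod μ → x * y ≈ x′ * y′ mod μ
  *-mod {x} {x′} {y} {y′} {μ} (r , x≈) (s , y≈) = r * y′ + x′ * s + r * (μ * s) , (begin
    x * y                            ≈⟨ *-cong x≈ y≈ ⟩
    (x′ + μ * r) * (y′ + μ * s)      ≈⟨ lemma x′ y′ μ r s ⟩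
    x′ * y′ + μ * (r * y′ + x′ * s + r * (μ * s)) ∎)
    where
    lemma : ∀ x y μ r s →
            (x + μ * r) * (y + μ * s) ≈ x * y + μ * (r * y + x * s + r * (μ * s))
    lemma = solve 5 (λ x y μ r s →
            (x :+ μ :* r) :* (y :+ μ :* s) := x :* y :+ μ :* (r :* y :+ x :* s :+ r :* (μ :* s))) refl

  ^-mod : ∀ {x y μ} n → x ≈ y mod μ → x ^ n ≈ y ^ n mod μ
  ^-mod zero    _   = ≈⇒≈mod refl
  ^-mod (suc n) x≈y = *-mod x≈y (^-mod n x≈y)

  -- The first-order Taylor expansion. It serves for h divisible by a power of π, where both p h and
  -- h² gain a factor π.
  [y+h]^n : ∀ y h n → (y + h) ^ suc n ≈ y ^ suc n + (suc n · 1#) * (h * y ^ n) mod h * h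
  [y+h]^n y h zero    = 0# , (begin
    (y + h) * 1#                             ≈⟨ distribʳ 1# y h ⟩
    y * 1# + h * 1#                          ≈⟨ +-congˡ (*-identityˡ _) ⟨
    y * 1# + 1# * (h * 1#)                   ≈⟨ +-congˡ (*-congʳ (+-identityʳ 1#)) ⟨
    y * 1# + (1# + 0#) * (h * 1#)            ≈⟨ +-identityʳ _ ⟨
    y * 1# + (1# + 0#) * (h * 1#) + 0#       ≈⟨ +-congˡ (zeroʳ _) ⟨
    y * 1# + (1# + 0#) * (h * 1#) + h * h * 0# ∎)
  [y+h]^n y h (suc n) with [y+h]^n y h n
  ... | r , eq = (suc n · 1#) * y ^ n + y * r + h * r , (begin
    (y + h) * (y + h) ^ suc n
      ≈⟨ *-congˡ eq ⟩
    (y + h) * (y * y ^ n + (suc n · 1#) * (h * y ^ n) + h * h * r)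
      ≈⟨ lemma y h (y ^ n) (suc n · 1#) r ⟩
    y * (y * y ^ n) + (h * (y * y ^ n) + (suc n · 1#) * (h * (y * y ^ n)))
      + h * h * ((suc n · 1#) * y ^ n + y * r + h * r)
      ≈⟨ +-congʳ (+-congˡ (+-congʳ (*-identityˡ _))) ⟨
    y * (y * y ^ n) + (1# * (h * (y * y ^ n)) + (suc n · 1#) * (h * (y * y ^ n)))
      + h * h * ((suc n · 1#) * y ^ n + y * r + h * r)
      ≈⟨ +-congʳ (+-congˡ (distribʳ _ _ _)) ⟨
    y * (y * y ^ n) + (suc (suc n) · 1#) * (h * (y * y ^ n))
      + h * h * ((suc n · 1#) * y ^ n + y * r + h * r) ∎)
    where
    lemma : ∀ y h a ν r →
      (y + h) * (y * a + ν * (h * a) + h * h * r) ≈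
      y * (y * a) + (h * (y * a) + ν * (h * (y * a))) + h * h * (ν * a + y * r + h * r)
    lemma = solve 5 (λ y h a ν r →
      (y :+ h) :* (y :* a :+ ν :* (h :* a) :+ h :* h :* r) :=
      y :* (y :* a) :+ (h :* (y :* a) :+ ν :* (h :* (y :* a))) :+ h :* h :* (ν :* a :+ y :* r :+ h :* r)) refl

  module _ {p : ℕ} (p-prime : Prime p) where

    π : Carrier
    π = p · 1#

    private
      π∣·× : ∀ n x → p ℕ.∣ n → ∃ λ z → n · x ≈ π * z
      π∣·× n x (ℕ.divides q n≡qp) = q · x , (begin
        n · x                 ≡⟨ ≡.cong (_· x) (≡.trans n≡qp (ℕ.*-comm q p)) ⟩
        (p ℕ.* q) · x         ≈⟨ ×-assocˡ x p q ⟨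
        p · (q · x)           ≈⟨ ×-congʳ p (*-identityˡ _) ⟨
        p · (1# * (q · x))    ≈⟨ ×-assoc-* p 1# (q · x) ⟨
        π * (q · x)           ∎)

      π∣sum : ∀ {n} (t : Fin n → Carrier) → (∀ i → ∃ λ z → t i ≈ π * z) →
              ∃ λ z → MonoidSum.sum +-monoid t ≈ π * z
      π∣sum {zero}  t _ = 0# , sym (zeroʳ π)
      π∣sum {suc n} t h with h Fin.zero | π∣sum (t ∘ Fin.suc) (h ∘ Fin.suc)
      ... | z , eq | s , eqs = z + s , trans (+-cong eq eqs) (sym (distribˡ π z s))

    freshman : ∀ x y → (x + y) ^ p ≈ x ^ p + y ^ p mod π
    freshman x y = go p p-prime ≡.refl
      where
      open BinomialTheorem commutativeSemiring
      open MonoidSum +-monoid using (sum; sum-init-last)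
      -- `p` is fixed by the module, so it is matched as a successor through a copy `q` equal to it;
      -- then the outer terms of the binomial sum can be split off.
      go : ∀ q → Prime q → q ≡ p → (x + y) ^ q ≈ x ^ q + y ^ q mod π
      go (suc q) _ ≡.refl = proj₁ divisible , (begin
        (x + y) ^ suc q
          ≈⟨ theorem (suc q) x y ⟩
        term Fin.zero + sum (term ∘ Fin.suc)
          ≈⟨ +-congˡ (sum-init-last (term ∘ Fin.suc)) ⟩
        term Fin.zero + (sum middle + term (Fin.suc (fromℕ q)))
          ≈⟨ +-cong first (+-cong (proj₂ divisible) last) ⟩
        y ^ suc q + (π * proj₁ divisible + x ^ suc q)
          ≈⟨ lemma (x ^ suc q) (y ^ suc q) (π * proj₁ divisible) ⟩
        x ^ suc q + y ^ suc q + π * proj₁ divisible ∎)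
        where
        term : Fin (suc (suc q)) → Carrier
        term = binomialTerm x y (suc q)
        middle : Fin q → Carrier
        middle i = term (Fin.suc (inject₁ i))
        divisible : ∃ λ z → sum middle ≈ π * z
        divisible = π∣sum middle λ i →
          π∣·× (suc q C suc (toℕ (inject₁ i))) (binomial x y (suc q) (Fin.suc (inject₁ i)))
            (prime∣nCk p-prime (s≤s (≡.subst (ℕ._< q) (≡.sym (toℕ-inject₁ i)) (toℕ<n i))))
        first : term Fin.zero ≈ y ^ suc q
        first = trans (+-identityʳ _) (*-identityˡ _)
        last : term (Fin.suc (fromℕ q)) ≈ x ^ suc q
        last rewrite toℕ-fromℕ q | nCn≡1 (suc q) | ℕ.n∸n≡0 q =
          trans (+-identityʳ _) (*-identityʳ _)
        lemma : ∀ a b m → b + (m + a) ≈ a + b + m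
        lemma = solve 3 (λ a b m → b :+ (m :+ a) := a :+ b :+ m) refl

    -- With h = π^(k+1) z the linear term p h y^(p-1) carries π^(k+2), and h² carries π^(2k+2),
    -- which is at least as much.
    ^p-mod : ∀ {x y} k → x ≈ y mod π ^ suc k → x ^ p ≈ y ^ p mod π ^ suc (suc k)
    ^p-mod {x} {y} k (z , x≈) = go p p-prime ≡.refl
      where
      go : ∀ q → Prime q → q ≡ p → x ^ q ≈ y ^ q mod π ^ suc (suc k)
      go (suc q) _ ≡.refl with [y+h]^n y (π ^ suc k * z) q
      ... | r , eq = z * y ^ q + π ^ k * (z * (z * r)) , (begin
        x ^ suc q
          ≈⟨ ^-congˡ (suc q) x≈ ⟩
        (y + π ^ suc k * z) ^ suc q
          ≈⟨ eq ⟩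
        y ^ suc q + π * (π ^ suc k * z * y ^ q) + π ^ suc k * z * (π ^ suc k * z) * r
          ≈⟨ lemma (y ^ suc q) π (π ^ k) z (y ^ q) r ⟩
        y ^ suc q + π * (π * π ^ k) * (z * y ^ q + π ^ k * (z * (z * r))) ∎)
        where
        lemma : ∀ Y π P z a r → Y + π * (π * P * z * a) + π * P * z * (π * P * z) * r ≈
                                Y + π * (π * P) * (z * a + P * (z * (z * r)))
        lemma = solve 6 (λ Y π P z a r → Y :+ π :* (π :* P :* z :* a) :+ π :* P :* z :* (π :* P :* z) :* r :=
                                Y :+ π :* (π :* P) :* (z :* a :+ P :* (z :* (z :* r)))) refl

    -- Residues modulo π thus have well-defined p^k-th powers modulo π^(k+1). This is how an
    -- idempotent modulo π is lifted to higher powers of π.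
    ^p^-mod : ∀ {x y} k → x ≈ y mod π → x ^ (p ℕ.^ k) ≈ y ^ (p ℕ.^ k) mod π ^ suc k
    ^p^-mod {x} {y} zero    (z , x≈) = z , (begin
      x * 1#                 ≈⟨ *-identityʳ x ⟩
      x                      ≈⟨ x≈ ⟩
      y + π * z              ≈⟨ +-cong (*-identityʳ y) (*-congʳ (*-identityʳ π)) ⟨
      y * 1# + π * 1# * z    ∎)
    ^p^-mod {x} {y} (suc k) x≈y with ^p-mod k (^p^-mod k x≈y)
    ... | z , eq = z , (begin
      x ^ (p ℕ.^ suc k)     ≈⟨ assoc x ⟨
      (x ^ (p ℕ.^ k)) ^ p   ≈⟨ eq ⟩
      (y ^ (p ℕ.^ k)) ^ p + π ^ suc (suc k) * z ≈⟨ +-congʳ (assoc y) ⟩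
      y ^ (p ℕ.^ suc k) + π ^ suc (suc k) * z ∎)
      where
      assoc : ∀ x → (x ^ (p ℕ.^ k)) ^ p ≈ x ^ (p ℕ.^ suc k)
      assoc x = trans (^-assocʳ x (p ℕ.^ k) p) (^-congʳ x (ℕ.*-comm (p ℕ.^ k) p))

    module _
      (σ : Carrier → Carrier) (σ-homo : IsSemiringHomomorphism σ)
      where

      open IsSemiringHomomorphism σ-homo using (⟦⟧-cong; +-homo; *-homo; 0#-homo; 1#-homo)

      -- Stated for a single element because the elements with this property form an additive
      -- subgroup, so that in a group ring it suffices to look at monomials.
      IsFrobenius : Carrier → Set _
      IsFrobenius x = σ x ≈ x ^ p mod π

      private
        0^p≈0 : 0# ^ p ≈ 0#
        0^p≈0 = go p (prime⇒nonZero p-prime)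
          where
          go : ∀ q → ℕ.NonZero q → 0# ^ q ≈ 0#
          go (suc q) _ = zeroˡ (0# ^ q)

      frobenius-resp-≈ : ∀ {x y} → x ≈ y → IsFrobenius x → IsFrobenius y
      frobenius-resp-≈ x≈y fx = ≈mod-trans (≈⇒≈mod (⟦⟧-cong (sym x≈y)))
        (≈mod-trans fx (≈⇒≈mod (^-congˡ p x≈y)))

      frobenius-0 : IsFrobenius 0#
      frobenius-0 = ≈⇒≈mod (trans 0#-homo (sym 0^p≈0))

      frobenius-+ : ∀ {x y} → IsFrobenius x → IsFrobenius y → IsFrobenius (x + y)
      frobenius-+ {x} {y} fx fy = ≈mod-trans (≈⇒≈mod (+-homo x y))
        (≈mod-trans (+-mod fx fy) (≈mod-sym (freshman x y)))

      -- `freshman` for the sum x + - x = 0 gives 0 ≡ x^p + (- x)^p, which treats odd p and p = 2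
      -- alike.
      frobenius-neg : ∀ {x} → IsFrobenius x → IsFrobenius (- x)
      frobenius-neg {x} fx = ≈mod-trans (≈⇒≈mod σ[-x]≈) (≈mod-trans
        (+-mod (≈⇒≈mod refl) 0≈) (≈⇒≈mod cancel))
        where
        σ[-x]≈ : σ (- x) ≈ - σ x + 0#
        σ[-x]≈ = begin
          σ (- x)                     ≈⟨ +-identityˡ _ ⟨
          0# + σ (- x)                ≈⟨ +-congʳ (-‿inverseˡ (σ x)) ⟨
          - σ x + σ x + σ (- x)       ≈⟨ +-assoc _ _ _ ⟩
          - σ x + (σ x + σ (- x))     ≈⟨ +-congˡ (+-homo x (- x)) ⟨
          - σ x + σ (x + - x)         ≈⟨ +-congˡ (trans (⟦⟧-cong (-‿inverseʳ x)) 0#-homo) ⟩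
          - σ x + 0#                  ∎
        0≈ : 0# ≈ σ x + (- x) ^ p mod π
        0≈ = ≈mod-trans
          (≈⇒≈mod (trans (sym 0^p≈0) (^-congˡ p (sym (-‿inverseʳ x)))))
          (≈mod-trans (freshman x (- x)) (+-mod (≈mod-sym fx) (≈⇒≈mod refl)))
        cancel : - σ x + (σ x + (- x) ^ p) ≈ (- x) ^ p
        cancel = begin
          - σ x + (σ x + (- x) ^ p)   ≈⟨ +-assoc _ _ _ ⟨
          - σ x + σ x + (- x) ^ p     ≈⟨ +-congʳ (-‿inverseˡ (σ x)) ⟩
          0# + (- x) ^ p              ≈⟨ +-identityˡ _ ⟩
          (- x) ^ p                   ∎

      σ-· : ∀ n → σ (n · 1#) ≈ n · 1#
      σ-· zero    = 0#-homo
      σ-· (suc n) = trans (+-homo _ _) (+-cong 1#-homo (σ-· n))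

      σ-^ : ∀ x n → σ (x ^ n) ≈ σ x ^ n
      σ-^ x zero    = 1#-homo
      σ-^ x (suc n) = trans (*-homo _ _) (*-congˡ (σ-^ x n))

      σ-π^ : ∀ n → σ (π ^ n) ≈ π ^ n
      σ-π^ n = trans (σ-^ π n) (^-congˡ n (σ-· p))

      σ^ : ℕ → Carrier → Carrier
      σ^ zero    x = x
      σ^ (suc i) x = σ (σ^ i x)

      module _ (σ-frobenius : ∀ x → IsFrobenius x) where

        σ^-frobenius : ∀ i x → σ^ i x ≈ x ^ (p ℕ.^ i) mod π
        σ^-frobenius zero    x = ≈⇒≈mod (sym (*-identityʳ x))
        σ^-frobenius (suc i) x =
          ≈mod-trans (σ-frobenius (σ^ i x)) (≈mod-trans (^-mod p (σ^-frobenius i x)) (≈⇒≈mod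
            (trans (^-assocʳ x (p ℕ.^ i) p) (^-congʳ x (ℕ.*-comm (p ℕ.^ i) p)))))

        -- von Neumann regularity of R/π.
        Regular : Set _
        Regular = ∀ x → ∃ λ r → x ≈ x * x * r mod π

        -- If σ^(f+1) is the identity, then x ≡ x^(p^(f+1)), and this exponent is at least 2.
        finiteOrder⇒regular : ∀ f → (∀ x → σ^ (suc f) x ≈ x) → Regular
        finiteOrder⇒regular f σ^≈ x with p ℕ.^ suc f in eq | 1<p^
          where
          1<p^ : 1 ℕ.< p ℕ.^ suc f
          1<p^ = ℕ.<-≤-trans (ℕ.nonTrivial⇒n>1 p {{prime⇒nonTrivial p-prime}})
                             (ℕ.m≤m*n p (p ℕ.^ f) {{ℕ.m^n≢0 p f {{prime⇒nonZero p-prime}}}})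
        ... | suc (suc k) | _ = x ^ k ,
          ≈mod-trans (≈⇒≈mod (sym (σ^≈ x))) (≈mod-trans (σ^-frobenius (suc f) x) (≈⇒≈mod
            (trans (^-congʳ x eq) (sym (*-assoc x x (x ^ k))))))
        ... | suc zero | s≤s ()

        module _ (regular : Regular) where

          private
            absorb : ∀ x r → x ≈ x * x * r mod π → ∀ n → x ≈ x * (x * r) ^ n mod π
            absorb x r reg zero    = ≈⇒≈mod (sym (*-identityʳ x))
            absorb x r reg (suc n) =
              ≈mod-trans (absorb x r reg n)
                (≈mod-trans (*-mod reg (≈⇒≈mod refl)) (≈⇒≈mod (lemma x r ((x * r) ^ n))))
              where
              lemma : ∀ x r a → x * x * r * a ≈ x * (x * r * a)
              lemma = solve 3 (λ x r a → x :* x :* r :* a := x :* (x :* r :* a)) refl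

            factor : ∀ x r n → .{{ℕ.NonZero n}} → ∃ λ s → (x * r) ^ n ≈ x * s
            factor x r (suc n) = r * (x * r) ^ n , *-assoc x r _

          -- R/π is a product of fields permuted trivially by σ, so every ideal of R/π^m is
          -- σ-stable.  With e = (x r)^(p^m) ≡ the idempotent of x, the part x (1 - e) is
          -- divisible by π and handled by induction, while σ e ≡ (x r)^(p^(m+1)) ∈ (x).
          σ-ideal : ∀ m x → ∃₂ λ a b → σ x ≈ x * a + π ^ m * b
          σ-ideal zero    x = 0# , σ x , (begin
            σ x                   ≈⟨ *-identityˡ (σ x) ⟨
            1# * σ x              ≈⟨ +-identityˡ _ ⟨
            0# + 1# * σ x         ≈⟨ +-congʳ (zeroʳ x) ⟨
            x * 0# + 1# * σ x     ∎)
          σ-ideal (suc m) x =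
            σ x * s + (1# + - e) * a , σ x * d + b , (begin
              σ x
                ≈⟨ ⟦⟧-cong x≈ ⟩
              σ (x * e + π * y)
                ≈⟨ trans (+-homo _ _) (+-cong (*-homo _ _) (*-homo _ _)) ⟩
              σ x * σ e + σ π * σ y
                ≈⟨ +-cong (*-congˡ σe≈) (*-cong (σ-· p) σy≈) ⟩
              σ x * (x * s + π ^ suc m * d) + π * (y * a + π ^ m * b)
                ≈⟨ lemma₁ (σ x) x s π (π ^ m) d y a b ⟩
              σ x * (x * s) + π * y * a + π * π ^ m * (σ x * d + b)
                ≈⟨ +-congʳ (+-congˡ (*-congʳ πy≈)) ⟩
              σ x * (x * s) + x * (1# + - e) * a + π * π ^ m * (σ x * d + b)
                ≈⟨ +-congʳ (lemma₂ (σ x) x s (1# + - e) a) ⟩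
              x * (σ x * s + (1# + - e) * a) + π * π ^ m * (σ x * d + b) ∎)
            where
            instance
              _ = ℕ.m^n≢0 p (suc m) {{prime⇒nonZero p-prime}}
            r = proj₁ (regular x)
            e = (x * r) ^ (p ℕ.^ m)
            abs = absorb x r (proj₂ (regular x)) (p ℕ.^ m)
            y = quotient abs
            x≈ : x ≈ x * e + π * y
            x≈ = equality abs
            ih = σ-ideal m y
            a = proj₁ ih
            b = proj₁ (proj₂ ih)
            σy≈ = proj₂ (proj₂ ih)
            power : σ e ≈ (x * r) ^ (p ℕ.^ suc m) mod π ^ suc m
            power with ^p^-mod m (σ-frobenius (x * r))
            ... | z , eq = z , trans (σ-^ (x * r) (p ℕ.^ m))
                    (trans eq (+-congʳ (^-assocʳ (x * r) p (p ℕ.^ m))))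
            fac = factor x r (p ℕ.^ suc m)
            s = proj₁ fac
            d = quotient power
            σe≈ : σ e ≈ x * s + π ^ suc m * d
            σe≈ = trans (equality power) (+-congʳ (proj₂ fac))
            lemma₃ : ∀ A x e f → A + x * (e + f) ≈ (x * e + A) + x * f
            lemma₃ = solve 4 (λ A x e f → A :+ x :* (e :+ f) := (x :* e :+ A) :+ x :* f) refl
            πy≈ : π * y ≈ x * (1# + - e)
            πy≈ = begin
              π * y                              ≈⟨ +-identityʳ _ ⟨
              π * y + 0#                         ≈⟨ +-congˡ (zeroʳ x) ⟨
              π * y + x * 0#                     ≈⟨ +-congˡ (*-congˡ (-‿inverseʳ e)) ⟨
              π * y + x * (e + - e)              ≈⟨ lemma₃ (π * y) x e (- e) ⟩
              (x * e + π * y) + x * - e          ≈⟨ +-congʳ x≈ ⟨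
              x + x * - e                        ≈⟨ +-congʳ (*-identityʳ x) ⟨
              x * 1# + x * - e                   ≈⟨ distribˡ x 1# (- e) ⟨
              x * (1# + - e)                     ∎
            lemma₁ : ∀ X x s π P d y a b →
              X * (x * s + π * P * d) + π * (y * a + P * b) ≈
              X * (x * s) + π * y * a + π * P * (X * d + b)
            lemma₁ = solve 9 (λ X x s π P d y a b →
              X :* (x :* s :+ π :* P :* d) :+ π :* (y :* a :+ P :* b) :=
              X :* (x :* s) :+ π :* y :* a :+ π :* P :* (X :* d :+ b)) refl
            lemma₂ : ∀ X x s f a → X * (x * s) + x * f * a ≈ x * (X * s + f * a)
            lemma₂ = solve 5 (λ X x s f a → X :* (x :* s) :+ x :* f :* a := x :* (X :* s :+ f :* a)) refl

          σ^-ideal : ∀ i m x → ∃₂ λ a b → σ^ i x ≈ x * a + π ^ m * b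
          σ^-ideal zero    m x = 1# , 0# , (begin
            x                     ≈⟨ *-identityʳ x ⟨
            x * 1#                ≈⟨ +-identityʳ _ ⟨
            x * 1# + 0#           ≈⟨ +-congˡ (zeroʳ (π ^ m)) ⟨
            x * 1# + π ^ m * 0#   ∎)
          σ^-ideal (suc i) m x with σ^-ideal i m x | σ-ideal m x
          ... | a , b , eq | a′ , b′ , eq′ = a′ * σ a , b′ * σ a + σ b , (begin
            σ (σ^ i x)
              ≈⟨ ⟦⟧-cong eq ⟩
            σ (x * a + π ^ m * b)
              ≈⟨ trans (+-homo _ _) (+-cong (*-homo _ _) (*-homo _ _)) ⟩
            σ x * σ a + σ (π ^ m) * σ b
              ≈⟨ +-cong (*-congʳ eq′) (*-congʳ (σ-π^ m)) ⟩
            (x * a′ + π ^ m * b′) * σ a + π ^ m * σ b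
              ≈⟨ lemma x a′ (π ^ m) b′ (σ a) (σ b) ⟩
            x * (a′ * σ a) + π ^ m * (b′ * σ a + σ b) ∎)
            where
            lemma : ∀ x a P b c d → (x * a + P * b) * c + P * d ≈ x * (a * c) + P * (b * c + d)
            lemma = solve 6 (λ x a P b c d →
              (x :* a :+ P :* b) :* c :+ P :* d := x :* (a :* c) :+ P :* (b :* c :+ d)) refl

          -- σ^i x lies in the ideal generated by x and π^m, so it inherits from x the divisibility
          -- of the product with y. This plays the part of the stability of the primes above p under
          -- Frobenius.
          σ^-*-∣ : ∀ i m {x y n} → x * y ≈ π ^ m * n → ∃ λ z → σ^ i x * y ≈ π ^ m * z
          σ^-*-∣ i m {x} {y} {n} xy≈ with σ^-ideal i m x
          ... | a , b , eq = n * a + b * y , (begin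
            σ^ i x * y                    ≈⟨ *-congʳ eq ⟩
            (x * a + π ^ m * b) * y       ≈⟨ lemma₁ x a (π ^ m) b y ⟩
            x * y * a + π ^ m * (b * y)   ≈⟨ +-congʳ (*-congʳ xy≈) ⟩
            π ^ m * n * a + π ^ m * (b * y) ≈⟨ lemma₂ (π ^ m) n a (b * y) ⟩
            π ^ m * (n * a + b * y)       ∎)
            where
            lemma₁ : ∀ x a P b y → (x * a + P * b) * y ≈ x * y * a + P * (b * y)
            lemma₁ = solve 5 (λ x a P b y → (x :* a :+ P :* b) :* y := x :* y :* a :+ P :* (b :* y)) refl
            lemma₂ : ∀ P n a c → P * n * a + P * c ≈ P * (n * a + c)
            lemma₂ = solve 4 (λ P n a c → P :* n :* a :+ P :* c := P :* (n :* a :+ c)) refl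

          module _ (π-cancel : ∀ {x y} → π * x ≈ π * y → x ≈ y) where

            -- R/π has no nilpotents: y ≡ y² r modulo π, so π divides y as soon as it divides y².
            -- Cancelling π² leaves the same situation with a smaller exponent.
            sqrt-∣ : ∀ a {y d} → y * y ≈ π ^ a * (π ^ a * d) → ∃ λ z → y ≈ π ^ a * z
            sqrt-∣ zero    {y}     _   = y , sym (*-identityˡ y)
            sqrt-∣ (suc a) {y} {d} y²≈ = proj₁ ih , (begin
              y                             ≈⟨ y≈πy′ ⟩
              π * y′                        ≈⟨ *-congˡ (proj₂ ih) ⟩
              π * (π ^ a * proj₁ ih)        ≈⟨ *-assoc _ _ _ ⟨
              π * π ^ a * proj₁ ih          ∎)
              where
              r = proj₁ (regular y)
              z = quotient (proj₂ (regular y))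
              y′ = π ^ a * (π * π ^ a * d) * r + z
              y≈πy′ : y ≈ π * y′
              y≈πy′ = begin
                y                                             ≈⟨ equality (proj₂ (regular y)) ⟩
                y * y * r + π * z                             ≈⟨ +-congʳ (*-congʳ y²≈) ⟩
                π * π ^ a * (π * π ^ a * d) * r + π * z       ≈⟨ lemma π (π ^ a) (π * π ^ a * d) r z ⟩
                π * y′                                        ∎
                where
                lemma : ∀ π P c r z → π * P * c * r + π * z ≈ π * (P * c * r + z)
                lemma = solve 5 (λ π P c r z →
                  π :* P :* c :* r :+ π :* z := π :* (P :* c :* r :+ z)) refl
              y′²≈ : π * (π * (y′ * y′)) ≈ π * (π * (π ^ a * (π ^ a * d)))
              y′²≈ = begin
                π * (π * (y′ * y′))               ≈⟨ lemma₁ π y′ ⟩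
                π * y′ * (π * y′)                 ≈⟨ *-cong y≈πy′ y≈πy′ ⟨
                y * y                             ≈⟨ y²≈ ⟩
                π * π ^ a * (π * π ^ a * d)       ≈⟨ lemma₂ π (π ^ a) d ⟩
                π * (π * (π ^ a * (π ^ a * d)))   ∎
                where
                lemma₁ : ∀ π y → π * (π * (y * y)) ≈ π * y * (π * y)
                lemma₁ = solve 2 (λ π y → π :* (π :* (y :* y)) := π :* y :* (π :* y)) refl
                lemma₂ : ∀ π P d → π * P * (π * P * d) ≈ π * (π * (P * (P * d)))
                lemma₂ = solve 3 (λ π P d → π :* P :* (π :* P :* d) := π :* (π :* (P :* (P :* d)))) refl
              ih = sqrt-∣ a (π-cancel (π-cancel y′²≈))

            -- Meant for y = X*, when some power of Frobenius is inversion: the hypothesis on X X*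
            -- then turns into one on the square of X*.
            conjugate-∣ : ∀ i a {x y n} → σ^ i x ≈ y → x * y ≈ π ^ (a ℕ.+ a) * n →
                          ∃ λ z → y ≈ π ^ a * z
            conjugate-∣ i a {x} {y} {n} σx≈y xy≈ = sqrt-∣ a {y} {d} (begin
              y * y                         ≈⟨ *-congʳ σx≈y ⟨
              σ^ i x * y                    ≈⟨ proj₂ divisible ⟩
              π ^ (a ℕ.+ a) * d             ≈⟨ *-congʳ (^-homo-* π a a) ⟩
              π ^ a * π ^ a * d             ≈⟨ *-assoc (π ^ a) (π ^ a) d ⟩
              π ^ a * (π ^ a * d)           ∎)
              where
              divisible = σ^-*-∣ i (a ℕ.+ a) {x} {y} {n} xy≈
              d = proj₁ divisible

open import Data.Bool.Base using (Bool; true; _∧_; if_then_else_; T)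
open import Data.Empty using (⊥; ⊥-elim)
open import Data.Integer
  using (ℤ; -[1+_]; -_; _+_; _*_; _-_; 0ℤ; 1ℤ; ∣_∣; _≟_)
import Data.Integer.Base as ℤ
open import Data.Integer.DivMod using (_%ℕ_; _/ℕ_; a≡a%ℕn+[a/ℕn]*n; n%ℕd<d)
open import Data.Integer.Divisibility.Signed
  using (_∣_; divides; _∣?_; ∣⇒∣ᵤ; ∣ᵤ⇒∣; ∣-trans; ∣m⇒∣-m; ∣m∣n⇒∣m+n; ∣m∣n⇒∣m-n; ∣n⇒∣m*n;
         ∣m+n∣n⇒∣m; *-monoˡ-∣; *-monoʳ-∣; *-cancelʳ-∣)
import Data.Integer.Properties as ℤ
open import Data.Integer.Tactic.RingSolver using (solve-∀)
open import Algebra.Properties.AbelianGroup ℤ.+-0-abelianGroup using (∙-cancelʳ)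
open import Data.List.Base using (List; []; _∷_; _++_; concatMap)
open import Data.List.Membership.Propositional using (_∈_)
open import Data.List.Relation.Unary.Any using (here; there; any?)
open import Data.Nat.Base using (NonZero)
import Data.Nat.Coprimality as ℕ
open import Data.Nat.DivMod using (_%_; _/_; m≡m%n+[m/n]*n; m%n<n)
open import Data.Nat.GCD using (module Bézout)
open import Relation.Binary.PropositionalEquality
  using (_≢_; refl; sym; trans; cong; cong₂; subst; subst₂; module ≡-Reasoning)
open import Relation.Nullary using (Dec; yes; no; does)
open import Relation.Nullary.Decidable
  using (dec-true; dec-false; decidable-stable; from-no; from-yes; True; toWitness; ¬?; _×-dec_; _⊎-dec_; _→-dec_)

open ≡-Reasoning

-- Sums over ℤ/w

sumTo-cong : ∀ n {f g} → (∀ i → i ℕ.< n → f i ≡ g i) → sumTo n f ≡ sumTo n g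
sumTo-cong zero    f≡g = refl
sumTo-cong (suc n) f≡g =
  cong₂ _+_ (sumTo-cong n (λ i i<n → f≡g i (ℕ.m<n⇒m<1+n i<n))) (f≡g n ℕ.≤-refl)

sumTo-zero : ∀ n {f} → (∀ i → f i ≡ 0ℤ) → sumTo n f ≡ 0ℤ
sumTo-zero zero    f≡0 = refl
sumTo-zero (suc n) f≡0 = cong₂ _+_ (sumTo-zero n f≡0) (f≡0 n)

sumTo-suc : ∀ n f → sumTo (suc n) f ≡ f 0 + sumTo n (f ∘ suc)
sumTo-suc zero    f = ℤ.+-comm 0ℤ (f 0)
sumTo-suc (suc n) f = trans (cong (_+ f (suc n)) (sumTo-suc n f)) (ℤ.+-assoc (f 0) _ _)

sumTo-+ : ∀ m n f → sumTo (m ℕ.+ n) f ≡ sumTo m f + sumTo n (λ i → f (m ℕ.+ i))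
sumTo-+ m zero    f = trans (cong (λ k → sumTo k f) (ℕ.+-identityʳ m)) (sym (ℤ.+-identityʳ _))
sumTo-+ m (suc n) f = trans (cong (λ k → sumTo k f) (ℕ.+-suc m n))
  (trans (cong (_+ f (m ℕ.+ n)) (sumTo-+ m n f)) (ℤ.+-assoc (sumTo m f) _ _))

opaque
  -- Opaque, so that a sum of literal length such as 9707 is unfolded only in the blocks that ask
  -- for it.
  ∑ : ℕ → (ℤ → ℤ) → ℤ
  ∑ n f = sumTo n (λ i → f (+ i))

opaque
  unfolding ∑

  ∑-cong : ∀ n {f g} → (∀ i → f i ≡ g i) → ∑ n f ≡ ∑ n g
  ∑-cong n f≡g = sumTo-cong n (λ i _ → f≡g (+ i))

  ∑-cong-< : ∀ n {f g} → (∀ i → i ℕ.< n → f (+ i) ≡ g (+ i)) → ∑ n f ≡ ∑ n g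
  ∑-cong-< n f≡g = sumTo-cong n f≡g

  ∑-distrib-+ : ∀ n f g → ∑ n (λ i → f i + g i) ≡ ∑ n f + ∑ n g
  ∑-distrib-+ zero    f g = refl
  ∑-distrib-+ (suc n) f g =
    trans (cong (_+ (f (+ n) + g (+ n))) (∑-distrib-+ n f g)) (interchange (∑ n f) (∑ n g) (f (+ n)) (g (+ n)))
    where
    interchange : ∀ a b c d → a + b + (c + d) ≡ a + c + (b + d)
    interchange = solve-∀

  *-distribˡ-∑ : ∀ n c f → c * ∑ n f ≡ ∑ n (λ i → c * f i)
  *-distribˡ-∑ zero    c f = ℤ.*-zeroʳ c
  *-distribˡ-∑ (suc n) c f =
    trans (ℤ.*-distribˡ-+ c (∑ n f) (f (+ n))) (cong (_+ c * f (+ n)) (*-distribˡ-∑ n c f))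

  *-distribʳ-∑ : ∀ n c f → ∑ n f * c ≡ ∑ n (λ i → f i * c)
  *-distribʳ-∑ n c f = trans (ℤ.*-comm (∑ n f) c)
    (trans (*-distribˡ-∑ n c f) (∑-cong n (λ i → ℤ.*-comm c (f i))))

  ∑-const : ∀ n c → ∑ n (λ _ → c) ≡ + n * c
  ∑-const zero    c = refl
  ∑-const (suc n) c = trans (cong (_+ c) (∑-const n c)) (sym (lemma (+ n) c))
    where
    lemma : ∀ n c → (1ℤ + n) * c ≡ n * c + c
    lemma = solve-∀

  ∑-zero : ∀ n {f} → (∀ i → f i ≡ 0ℤ) → ∑ n f ≡ 0ℤ
  ∑-zero n f≡0 = trans (∑-cong n f≡0) (trans (∑-const n 0ℤ) (ℤ.*-zeroʳ (+ n)))

  ∑-+ : ∀ m n f → ∑ (m ℕ.+ n) f ≡ ∑ m f + ∑ n (λ i → f (+ m + i))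
  ∑-+ m n f = sumTo-+ m n (λ i → f (+ i))

  ∑-comm : ∀ m n (f : ℤ → ℤ → ℤ) → ∑ m (λ i → ∑ n (f i)) ≡ ∑ n (λ j → ∑ m (λ i → f i j))
  ∑-comm zero    n f = sym (∑-zero n (λ _ → refl))
  ∑-comm (suc m) n f =
    trans (cong (_+ ∑ n (f (+ m))) (∑-comm m n f)) (sym (∑-distrib-+ n (λ j → ∑ m (λ i → f i j)) (f (+ m))))

-- Congruences and periodic functions

infix 4 _≡_mod_
record _≡_mod_ (x y : ℤ) (w : ℕ) : Set where
  constructor [_]
  field difference : + w ∣ x - y

open _≡_mod_

-- Functions on ℤ/w are represented by periodic functions on ℤ; equations between their arguments
-- are then ring identities in ℤ, up to multiples of w.
Periodic : ℕ → (ℤ → ℤ) → Set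
Periodic w f = ∀ k → f (k + + w) ≡ f k

≡%ℕ : ∀ x n .{{_ : NonZero n}} → x ≡ + (x %ℕ n) mod n
≡%ℕ x n = [ divides (x /ℕ n) (trans (cong (_- + (x %ℕ n)) (a≡a%ℕn+[a/ℕn]*n x n))
  (lemma (+ (x %ℕ n)) (x /ℕ n * + n))) ]
  where
  lemma : ∀ r y → r + y - r ≡ y
  lemma = solve-∀

module _ {w : ℕ} where

  ≡⇒≡mod : ∀ {x y} → x ≡ y → x ≡ y mod w
  ≡⇒≡mod {x} refl = [ divides 0ℤ (ℤ.+-inverseʳ x) ]

  mod-sym : ∀ {x y} → x ≡ y mod w → y ≡ x mod w
  mod-sym {x} {y} [ d ] = [ subst (+ w ∣_) (lemma x y) (∣m⇒∣-m d) ]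
    where
    lemma : ∀ x y → - (x - y) ≡ y - x
    lemma = solve-∀

  mod-trans : ∀ {x y z} → x ≡ y mod w → y ≡ z mod w → x ≡ z mod w
  mod-trans {x} {y} {z} [ d ] [ e ] = [ subst (+ w ∣_) (lemma x y z) (∣m∣n⇒∣m+n d e) ]
    where
    lemma : ∀ x y z → x - y + (y - z) ≡ x - z
    lemma = solve-∀

  *-congˡ-mod : ∀ {x y} c → x ≡ y mod w → c * x ≡ c * y mod w
  *-congˡ-mod {x} {y} c [ d ] = [ subst (+ w ∣_) (lemma c x y) (∣n⇒∣m*n c d) ]
    where
    lemma : ∀ c x y → c * (x - y) ≡ c * x - c * y
    lemma = solve-∀

  *-congʳ-mod : ∀ {x y} c → x ≡ y mod w → x * c ≡ y * c mod w
  *-congʳ-mod {x} {y} c x≡y =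
    subst₂ (λ a b → a ≡ b mod w) (ℤ.*-comm c x) (ℤ.*-comm c y) (*-congˡ-mod c x≡y)

  periodic⇒cong : ∀ {f} → Periodic w f → ∀ {x y} → x ≡ y mod w → f x ≡ f y
  periodic⇒cong {f} per {x} {y} [ divides q x-y≡ ] =
    trans (cong f (trans (lemma x y) (cong (λ z → y + z) x-y≡))) (go q y)
    where
    lemma : ∀ x y → x ≡ y + (x - y)
    lemma = solve-∀
    go+ : ∀ n y → f (y + + n * + w) ≡ f y
    go+ zero    y = cong f (ℤ.+-identityʳ y)
    go+ (suc n) y = trans (cong f (step y (+ n) (+ w))) (trans (per _) (go+ n y))
      where
      step : ∀ y n w → y + (1ℤ + n) * w ≡ y + n * w + w
      step = solve-∀
    go : ∀ q y → f (y + q * + w) ≡ f y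
    go (+ n)      y = go+ n y
    go -[1+ n ]   y = sym (trans (cong f (back y (+ suc n) (+ w))) (go+ (suc n) _))
      where
      back : ∀ y n w → y ≡ y + - n * w + n * w
      back = solve-∀

  periodic-shift : ∀ {f} c → Periodic w f → Periodic w (λ k → f (k + c))
  periodic-shift {f} c per k = trans (cong f (lemma k (+ w) c)) (per (k + c))
    where
    lemma : ∀ k w c → k + w + c ≡ k + c + w
    lemma = solve-∀

  periodic-scale : ∀ {f} t c → Periodic w f → Periodic w (λ k → f (t * k + c))
  periodic-scale {f} t c per k = periodic⇒cong {f} per
    [ divides t (lemma t k (+ w) c) ]
    where
    lemma : ∀ t k w c → t * (k + w) + c - (t * k + c) ≡ t * w
    lemma = solve-∀

module _ {w : ℕ} .{{_ : NonZero w}} where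

  opaque
    unfolding ∑

    -- Periodicity reduces c to a natural number. A shift by one drops the term at 0 and gains the
    -- term at w, which are equal.
    ∑-shift : ∀ {f} c → Periodic w f → ∑ w (λ k → f (k + c)) ≡ ∑ w f
    ∑-shift {f} c per =
      trans (∑-cong w (λ k → periodic⇒cong {f = f} per (shift≡ k))) (go (c %ℕ w))
      where
      shift≡ : ∀ k → k + c ≡ k + + (c %ℕ w) mod w
      shift≡ k = [ subst (+ w ∣_) (lemma k c (+ (c %ℕ w))) (difference (≡%ℕ c w)) ]
        where
        lemma : ∀ k c r → c - r ≡ k + c - (k + r)
        lemma = solve-∀
      go : ∀ n → ∑ w (λ k → f (k + + n)) ≡ ∑ w f
      go zero    = ∑-cong w (λ k → cong f (ℤ.+-identityʳ k))
      go (suc n) = begin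
        ∑ w (λ k → f (k + (1ℤ + + n)))            ≡⟨ ∑-cong w (λ k → cong f (lemma k (+ n))) ⟩
        ∑ w (λ k → g (1ℤ + k))                    ≡⟨ cancel (g 0ℤ) (∑ w (λ k → g (1ℤ + k))) ⟨
        (g 0ℤ + ∑ w (λ k → g (1ℤ + k))) - g 0ℤ    ≡⟨ cong (_- g 0ℤ) (sumTo-suc w (λ i → g (+ i))) ⟨
        ∑ w g + g (+ w) - g 0ℤ                    ≡⟨ cong (λ x → ∑ w g + x - g 0ℤ) g[w]≡ ⟩
        ∑ w g + g 0ℤ - g 0ℤ                       ≡⟨ cancel′ (∑ w g) (g 0ℤ) ⟩
        ∑ w g                                     ≡⟨ go n ⟩
        ∑ w f                                     ∎
        where
        g : ℤ → ℤ
        g k = f (k + + n)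
        g[w]≡ : g (+ w) ≡ g 0ℤ
        g[w]≡ = trans (cong g (sym (ℤ.+-identityˡ (+ w)))) (periodic-shift {f = f} (+ n) per 0ℤ)
        lemma : ∀ k n → k + (1ℤ + n) ≡ 1ℤ + k + n
        lemma = solve-∀
        cancel : ∀ a b → a + b - a ≡ b
        cancel = solve-∀
        cancel′ : ∀ a b → a + b - b ≡ a
        cancel′ = solve-∀

module _ (w : ℕ) where

  δ : ℤ → ℤ
  δ z = if does (+ w ∣? z) then 1ℤ else 0ℤ

  δ-yes : ∀ {z} → + w ∣ z → δ z ≡ 1ℤ
  δ-yes {z} w∣z = cong (if_then 1ℤ else 0ℤ) (dec-true (+ w ∣? z) w∣z)

  δ-no : ∀ {z} → ¬ (+ w ∣ z) → δ z ≡ 0ℤ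
  δ-no {z} w∤z = cong (if_then 1ℤ else 0ℤ) (dec-false (+ w ∣? z) w∤z)

  δ-cong : ∀ {x y} → (+ w ∣ x → + w ∣ y) → (+ w ∣ y → + w ∣ x) → δ x ≡ δ y
  δ-cong {x} {y} to from with + w ∣? x
  ... | yes w∣x = trans (δ-yes w∣x) (sym (δ-yes (to w∣x)))
  ... | no w∤x  = trans (δ-no w∤x) (sym (δ-no (w∤x ∘ from)))

  δ-mod : ∀ {x y} → x ≡ y mod w → δ x ≡ δ y
  δ-mod {x} {y} x≡y = δ-cong
    (λ w∣x → subst (+ w ∣_) (lemma x y) (∣m∣n⇒∣m+n w∣x (difference (mod-sym x≡y))))
    (λ w∣y → subst (+ w ∣_) (lemma y x) (∣m∣n⇒∣m+n w∣y (difference x≡y)))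
    where
    lemma : ∀ x y → x + (y - x) ≡ y
    lemma = solve-∀

  δ-periodic : Periodic w δ
  δ-periodic k = δ-mod {k + + w} {k} [ divides 1ℤ (lemma k (+ w)) ]
    where
    lemma : ∀ k w → k + w - k ≡ 1ℤ * w
    lemma = solve-∀

  δ-neg : ∀ z → δ (- z) ≡ δ z
  δ-neg z = δ-cong (λ w∣-z → subst (+ w ∣_) (ℤ.neg-involutive z) (∣m⇒∣-m w∣-z)) (∣m⇒∣-m {m = z})

  δ-swap : ∀ x y → δ (x - y) ≡ δ (y - x)
  δ-swap x y = trans (cong δ (lemma x y)) (δ-neg (y - x))
    where
    lemma : ∀ x y → x - y ≡ - (y - x)
    lemma = solve-∀

δ-unit : ∀ {w s t} → s * t ≡ 1ℤ mod w → ∀ g k → δ w (g - s * k) ≡ δ w (t * g - k)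
δ-unit {w} {s} {t} st≡1 g k = δ-cong w
  (λ d → subst (+ w ∣_) (lemma₁ g k s t)
    (∣m∣n⇒∣m+n (∣n⇒∣m*n t d) (∣n⇒∣m*n k (difference st≡1))))
  (λ d → subst (+ w ∣_) (lemma₂ g k s t)
    (∣m∣n⇒∣m+n (∣n⇒∣m*n s d) (∣n⇒∣m*n (- g) (difference st≡1))))
  where
  lemma₁ : ∀ g k s t → t * (g - s * k) + k * (s * t - 1ℤ) ≡ t * g - k
  lemma₁ = solve-∀
  lemma₂ : ∀ g k s t → s * (t * g - k) + - g * (s * t - 1ℤ) ≡ g - s * k
  lemma₂ = solve-∀

module _ {w : ℕ} .{{_ : NonZero w}} where

  opaque
    unfolding ∑

    ∑-δ₀ : ∀ (f : ℤ → ℤ) → ∑ w (λ i → δ w i * f i) ≡ f 0ℤ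
    ∑-δ₀ f = go w refl
      where
      go : ∀ v → v ≡ w → ∑ v (λ i → δ w i * f i) ≡ f 0ℤ
      go zero    v≡w = contradiction (sym v≡w) (ℕ.≢-nonZero⁻¹ w)
      go (suc v) v≡w = begin
        ∑ (suc v) g                                ≡⟨ sumTo-suc v (λ i → g (+ i)) ⟩
        g 0ℤ + sumTo v (λ i → g (+ suc i))         ≡⟨ cong₂ _+_ head tail ⟩
        f 0ℤ + 0ℤ                                  ≡⟨ ℤ.+-identityʳ _ ⟩
        f 0ℤ                                       ∎
        where
        g : ℤ → ℤ
        g i = δ w i * f i
        head : g 0ℤ ≡ f 0ℤ
        head = trans (cong (_* f 0ℤ) (δ-yes w {0ℤ} (divides 0ℤ refl))) (ℤ.*-identityˡ (f 0ℤ))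
        tail : sumTo v (λ i → g (+ suc i)) ≡ 0ℤ
        tail = trans (sumTo-cong v (λ i i<v →
            cong (_* f (+ suc i)) (δ-no w {+ suc i} (λ w∣i → ℕ.>⇒∤ (subst (suc i ℕ.<_) v≡w (ℕ.s<s i<v)) (∣⇒∣ᵤ w∣i)))))
          (∑-zero v (λ _ → refl {x = 0ℤ}))

  ∑-δ : ∀ {f} c → Periodic w f → ∑ w (λ i → δ w (i - c) * f i) ≡ f c
  ∑-δ {f} c per = begin
    ∑ w (λ i → δ w (i - c) * f i)             ≡⟨ ∑-shift {f = g} c g-periodic ⟨
    ∑ w (λ i → g (i + c))                     ≡⟨ ∑-cong w (λ i → cong (λ x → δ w x * f (i + c)) (lemma i c)) ⟩
    ∑ w (λ i → δ w i * f (i + c))             ≡⟨ ∑-δ₀ (λ i → f (i + c)) ⟩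
    f (0ℤ + c)                                ≡⟨ cong f (ℤ.+-identityˡ c) ⟩
    f c                                       ∎
    where
    g : ℤ → ℤ
    g i = δ w (i - c) * f i
    g-periodic : Periodic w g
    g-periodic k = cong₂ _*_ (periodic-shift {f = δ w} (- c) (δ-periodic w) k) (per k)
    lemma : ∀ i c → i + c - c ≡ i
    lemma = solve-∀

  -- Reindexing by a unit, done with δ in place of a bijection: f (s k) is expanded as a δ-sum over
  -- i, the sums are exchanged, and for each i only k ≡ t i survives.
  ∑-scale : ∀ {f} s t → s * t ≡ 1ℤ mod w → Periodic w f → ∑ w (λ k → f (s * k)) ≡ ∑ w f
  ∑-scale {f} s t st≡1 per = begin
    ∑ w (λ k → f (s * k))                              ≡⟨ ∑-cong w (λ k → ∑-δ (s * k) per) ⟨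
    ∑ w (λ k → ∑ w (λ i → δ w (i - s * k) * f i))      ≡⟨ ∑-comm w w (λ k i → δ w (i - s * k) * f i) ⟩
    ∑ w (λ i → ∑ w (λ k → δ w (i - s * k) * f i))      ≡⟨ ∑-cong w (λ i → begin
      ∑ w (λ k → δ w (i - s * k) * f i)                  ≡⟨ ∑-cong w (λ k → cong (_* f i) (trans (δ-unit {w} {s} {t} st≡1 i k) (δ-swap w (t * i) k))) ⟩
      ∑ w (λ k → δ w (k - t * i) * f i)                  ≡⟨ ∑-δ {f = λ _ → f i} (t * i) (λ _ → refl) ⟩
      f i                                                ∎) ⟩
    ∑ w f                                              ∎

  ∑-neg : ∀ {f} → Periodic w f → ∑ w (λ k → f (- k)) ≡ ∑ w f
  ∑-neg {f} per = trans (∑-cong w (λ k → cong f (sym (ℤ.-1*i≡-i k))))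
    (∑-scale {f = f} (- 1ℤ) (- 1ℤ) [ divides 0ℤ refl ] per)

-- The group ring of ℤ/w

module GroupRing (w : ℕ) .{{_ : NonZero w}} where

  record Element : Set where
    no-eta-equality
    field
      at       : ℤ → ℤ
      periodic : Periodic w at

  open Element public

  ∑-reflect : ∀ {f} c → Periodic w f → ∑ w (λ k → f (c - k)) ≡ ∑ w f
  ∑-reflect {f} c per = begin
    ∑ w (λ k → f (c - k))      ≡⟨ ∑-cong w (λ k → cong f (ℤ.+-comm c (- k))) ⟩
    ∑ w (λ k → f (- k + c))    ≡⟨ ∑-neg {f = λ k → f (k + c)} (periodic-shift {f = f} c per) ⟩
    ∑ w (λ k → f (k + c))      ≡⟨ ∑-shift {f = f} c per ⟩
    ∑ w f                      ∎

  infix 4 _≈_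
  record _≈_ (X Y : Element) : Set where
    constructor pointwise
    field at-≈ : ∀ k → at X k ≡ at Y k

  open _≈_ public

  private
    periodic-reflect : ∀ {f} c → Periodic w f → Periodic w (λ k → f (c - k))
    periodic-reflect {f} c per k =
      trans (cong f (lemma₁ c k (+ w))) (trans (periodic-scale {f = f} (- 1ℤ) c per k) (cong f (lemma₂ c k)))
      where
      lemma₁ : ∀ c k w → c - (k + w) ≡ - 1ℤ * (k + w) + c
      lemma₁ = solve-∀
      lemma₂ : ∀ c k → - 1ℤ * k + c ≡ c - k
      lemma₂ = solve-∀

    convolve : (ℤ → ℤ) → (ℤ → ℤ) → ℤ → ℤ
    convolve f g k = ∑ w (λ i → f i * g (k - i))

    convolve-periodic : ∀ f {g} → Periodic w g → Periodic w (convolve f g)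
    convolve-periodic f {g} per k =
      ∑-cong w (λ i → cong (f i *_) (periodic-shift {f = g} (- i) per k))

    convolve-comm : ∀ {f g} → Periodic w f → Periodic w g → ∀ k → convolve f g k ≡ convolve g f k
    convolve-comm {f} {g} f-per g-per k = begin
      ∑ w (λ i → f i * g (k - i))
        ≡⟨ ∑-cong w (λ i → trans (ℤ.*-comm (f i) (g (k - i))) (cong (λ j → g (k - i) * f j) (lemma k i))) ⟩
      ∑ w (λ i → g (k - i) * f (k - (k - i)))
        ≡⟨ ∑-reflect {f = λ j → g j * f (k - j)} k
             (λ j → cong₂ _*_ (g-per j) (periodic-reflect {f = f} k f-per j)) ⟩
      ∑ w (λ j → g j * f (k - j)) ∎
      where
      lemma : ∀ k i → i ≡ k - (k - i)
      lemma = solve-∀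

    convolve-assoc : ∀ f {g h} → Periodic w g → Periodic w h →
                     ∀ k → convolve (convolve f g) h k ≡ convolve f (convolve g h) k
    convolve-assoc f {g} {h} g-per h-per k = begin
      ∑ w (λ l → ∑ w (λ i → f i * g (l - i)) * h (k - l))
        ≡⟨ ∑-cong w (λ l → trans (*-distribʳ-∑ w (h (k - l)) (λ i → f i * g (l - i)))
             (∑-cong w (λ i → ℤ.*-assoc (f i) (g (l - i)) (h (k - l))))) ⟩
      ∑ w (λ l → ∑ w (λ i → f i * (g (l - i) * h (k - l))))
        ≡⟨ ∑-comm w w (λ l i → f i * (g (l - i) * h (k - l))) ⟩
      ∑ w (λ i → ∑ w (λ l → f i * (g (l - i) * h (k - l))))
        ≡⟨ ∑-cong w (λ i → sym (*-distribˡ-∑ w (f i) (λ l → g (l - i) * h (k - l)))) ⟩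
      ∑ w (λ i → f i * ∑ w (λ l → g (l - i) * h (k - l)))
        ≡⟨ ∑-cong w (λ i → cong (f i *_) (begin
          ∑ w (λ l → g (l - i) * h (k - l))
            ≡⟨ ∑-shift {f = λ l → g (l - i) * h (k - l)} i
                 (λ l → cong₂ _*_ (periodic-shift {f = g} (- i) g-per l) (periodic-reflect {f = h} k h-per l)) ⟨
          ∑ w (λ l → g (l + i - i) * h (k - (l + i)))
            ≡⟨ ∑-cong w (λ l → cong₂ (λ a b → g a * h b) (lemma₁ l i) (lemma₂ k l i)) ⟩
          ∑ w (λ l → g l * h (k - i - l)) ∎)) ⟩
      ∑ w (λ i → f i * ∑ w (λ j → g j * h (k - i - j))) ∎
      where
      lemma₁ : ∀ l i → l + i - i ≡ l
      lemma₁ = solve-∀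
      lemma₂ : ∀ k l i → k - (l + i) ≡ k - i - l
      lemma₂ = solve-∀

  infixl 6 _⊕_
  infixl 7 _⊛_
  infix 8 ⊖_

  _⊕_ _⊛_ : Element → Element → Element
  at (X ⊕ Y) k = at X k + at Y k
  periodic (X ⊕ Y) k = cong₂ _+_ (periodic X k) (periodic Y k)
  at (X ⊛ Y) = convolve (at X) (at Y)
  periodic (X ⊛ Y) = convolve-periodic (at X) (periodic Y)

  ⊖_ : Element → Element
  at (⊖ X) k = - at X k
  periodic (⊖ X) k = cong -_ (periodic X k)

  𝟘 𝟙 : Element
  at 𝟘 _ = 0ℤ
  periodic 𝟘 _ = refl
  at 𝟙 = δ w
  periodic 𝟙 = δ-periodic w

  ⊛-cong : ∀ {X X′ Y Y′} → X ≈ X′ → Y ≈ Y′ → X ⊛ Y ≈ X′ ⊛ Y′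
  ⊛-cong (pointwise X≈) (pointwise Y≈) = pointwise λ k →
    ∑-cong w (λ i → cong₂ _*_ (X≈ i) (Y≈ (k - i)))

  ⊛-assoc : ∀ X Y Z → (X ⊛ Y) ⊛ Z ≈ X ⊛ (Y ⊛ Z)
  ⊛-assoc X Y Z = pointwise (convolve-assoc (at X) (periodic Y) (periodic Z))

  ⊛-comm : ∀ X Y → X ⊛ Y ≈ Y ⊛ X
  ⊛-comm X Y = pointwise (convolve-comm (periodic X) (periodic Y))

  ⊛-identityˡ : ∀ X → 𝟙 ⊛ X ≈ X
  ⊛-identityˡ X = pointwise λ k →
    trans (∑-δ₀ (λ i → at X (k - i))) (cong (at X) (ℤ.+-identityʳ k))

  ⊛-distribˡ : ∀ X Y Z → X ⊛ (Y ⊕ Z) ≈ X ⊛ Y ⊕ X ⊛ Z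
  ⊛-distribˡ X Y Z = pointwise λ k → trans
    (∑-cong w (λ i → ℤ.*-distribˡ-+ (at X i) (at Y (k - i)) (at Z (k - i))))
    (∑-distrib-+ w (λ i → at X i * at Y (k - i)) (λ i → at X i * at Z (k - i)))

  ⊕-cong : ∀ {X X′ Y Y′} → X ≈ X′ → Y ≈ Y′ → X ⊕ Y ≈ X′ ⊕ Y′
  ⊕-cong (pointwise X≈) (pointwise Y≈) = pointwise λ k → cong₂ _+_ (X≈ k) (Y≈ k)

  ≈-trans : ∀ {X Y Z} → X ≈ Y → Y ≈ Z → X ≈ Z
  ≈-trans (pointwise X≈Y) (pointwise Y≈Z) = pointwise λ k → trans (X≈Y k) (Y≈Z k)

  groupRing : CommutativeRing 0ℓ 0ℓ
  groupRing = record
    { Carrier = Element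
    ; _≈_ = _≈_
    ; _+_ = _⊕_
    ; _*_ = _⊛_
    ; -_ = ⊖_
    ; 0# = 𝟘
    ; 1# = 𝟙
    ; isCommutativeRing = record
      { isRing = record
        { +-isAbelianGroup = record
          { isGroup = record
            { isMonoid = record
              { isSemigroup = record
                { isMagma = record
                  { isEquivalence = record
                    { refl  = pointwise λ _ → refl
                    ; sym   = λ X≈Y → pointwise λ k → sym (at-≈ X≈Y k)
                    ; trans = ≈-trans
                    }
                  ; ∙-cong = ⊕-cong
                  }
                ; assoc = λ X Y Z → pointwise λ k → ℤ.+-assoc (at X k) (at Y k) (at Z k)
                }
              ; identity = (λ X → pointwise λ k → ℤ.+-identityˡ (at X k))
                         , (λ X → pointwise λ k → ℤ.+-identityʳ (at X k))
              }
            ; inverse = (λ X → pointwise λ k → ℤ.+-inverseˡ (at X k))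
                      , (λ X → pointwise λ k → ℤ.+-inverseʳ (at X k))
            ; ⁻¹-cong = λ X≈Y → pointwise λ k → cong -_ (at-≈ X≈Y k)
            }
          ; comm = λ X Y → pointwise λ k → ℤ.+-comm (at X k) (at Y k)
          }
        ; *-cong = ⊛-cong
        ; *-assoc = ⊛-assoc
        ; *-identity = ⊛-identityˡ , λ X → ≈-trans (⊛-comm X 𝟙) (⊛-identityˡ X)
        ; distrib = ⊛-distribˡ , λ X Y Z → ≈-trans (⊛-comm (Y ⊕ Z) X)
            (≈-trans (⊛-distribˡ X Y Z) (⊕-cong (⊛-comm X Y) (⊛-comm X Z)))
        }
      ; *-comm = ⊛-comm
      }
    }

  open CommutativeRing groupRing using (semiring)
  open import Algebra.Properties.Semiring.Exp semiring using (_^_)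
  open import Algebra.Properties.Semiring.Mult semiring using () renaming (_×_ to _·_)
  open FrobeniusLift groupRing

  -- Translates between ring and coefficients: divisibility by π^m in the group ring is divisibility
  -- of every coefficient by p^m.
  ActsAs : ℤ → Element → Set
  ActsAs c M = ∀ X k → at (M ⊛ X) k ≡ c * at X k

  at-·𝟙 : ∀ n k → at (n · 𝟙) k ≡ + n * δ w k
  at-·𝟙 zero    k = refl
  at-·𝟙 (suc n) k = trans (cong (λ z → δ w k + z) (at-·𝟙 n k)) (lemma (+ n) (δ w k))
    where
    lemma : ∀ n d → d + n * d ≡ (1ℤ + n) * d
    lemma = solve-∀

  at-·𝟙⊛ : ∀ n → ActsAs (+ n) (n · 𝟙)
  at-·𝟙⊛ n X k = begin
    ∑ w (λ i → at (n · 𝟙) i * at X (k - i))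
      ≡⟨ ∑-cong w (λ i → trans (cong (_* at X (k - i)) (at-·𝟙 n i)) (ℤ.*-assoc (+ n) _ _)) ⟩
    ∑ w (λ i → + n * (δ w i * at X (k - i)))
      ≡⟨ *-distribˡ-∑ w (+ n) (λ i → δ w i * at X (k - i)) ⟨
    + n * at (𝟙 ⊛ X) k
      ≡⟨ cong (+ n *_) (at-≈ (⊛-identityˡ X) k) ⟩
    + n * at X k ∎

  ⊛-actsAs : ∀ {c d M N} → ActsAs c M → ActsAs d N → ActsAs (c * d) (M ⊛ N)
  ⊛-actsAs {c} {d} {M} {N} actsM actsN X k = begin
    at (M ⊛ N ⊛ X) k      ≡⟨ at-≈ (⊛-assoc M N X) k ⟩
    at (M ⊛ (N ⊛ X)) k    ≡⟨ actsM (N ⊛ X) k ⟩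
    c * at (N ⊛ X) k      ≡⟨ cong (c *_) (actsN X k) ⟩
    c * (d * at X k)      ≡⟨ ℤ.*-assoc c d (at X k) ⟨
    c * d * at X k        ∎

  module _ {p : ℕ} (p-prime : Prime p) where

    at-π⊛ : ActsAs (+ p) (π p-prime)
    at-π⊛ = at-·𝟙⊛ p

    at-π^⊛ : ∀ m → ActsAs (+ (p ℕ.^ m)) (π p-prime ^ m)
    at-π^⊛ zero    X k = trans (at-≈ (⊛-identityˡ X) k) (sym (ℤ.*-identityˡ (at X k)))
    at-π^⊛ (suc m) X k = trans
      (⊛-actsAs {+ p} {+ (p ℕ.^ m)} {π p-prime} {π p-prime ^ m} at-π⊛ (at-π^⊛ m) X k)
      (cong (_* at X k) (sym (ℤ.pos-* p (p ℕ.^ m))))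

    π-cancel : ∀ {X Y} → π p-prime ⊛ X ≈ π p-prime ⊛ Y → X ≈ Y
    π-cancel {X} {Y} πX≈πY = pointwise λ k → ℤ.*-cancelˡ-≡ (+ p) _ _ {{prime⇒nonZero p-prime}}
      (trans (sym (at-π⊛ X k)) (trans (at-≈ πX≈πY k) (at-π⊛ Y k)))

  open SemiringMorphisms (Semiring.rawSemiring semiring) (Semiring.rawSemiring semiring)
    using (IsSemiringHomomorphism)

  -- For s t ≡ 1, dilate s is the automorphism g ↦ t g of the group ring.
  dilate : ℤ → Element → Element
  at (dilate s X) k = at X (s * k)
  periodic (dilate s X) k =
    periodic⇒cong {f = at X} (periodic X) [ divides s (lemma s k (+ w)) ]
    where
    lemma : ∀ s k w → s * (k + w) - s * k ≡ s * w
    lemma = solve-∀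

  module _ {s t : ℤ} (st≡1 : s * t ≡ 1ℤ mod w) where

    dilate-𝟙 : dilate s 𝟙 ≈ 𝟙
    dilate-𝟙 = pointwise λ k → begin
      δ w (s * k)           ≡⟨ δ-neg w (s * k) ⟨
      δ w (- (s * k))       ≡⟨ cong (δ w) (ℤ.+-identityˡ (- (s * k))) ⟨
      δ w (0ℤ - s * k)      ≡⟨ δ-unit {w} {s} {t} st≡1 0ℤ k ⟩
      δ w (t * 0ℤ - k)      ≡⟨ cong (δ w) (lemma t k) ⟩
      δ w (- k)             ≡⟨ δ-neg w k ⟩
      δ w k                 ∎
      where
      lemma : ∀ t k → t * 0ℤ - k ≡ - k
      lemma = solve-∀

    dilate-⊛ : ∀ X Y → dilate s (X ⊛ Y) ≈ dilate s X ⊛ dilate s Y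
    dilate-⊛ X Y = pointwise λ k → begin
      ∑ w (λ i → at X i * at Y (s * k - i))
        ≡⟨ ∑-scale {f = λ i → at X i * at Y (s * k - i)} s t st≡1
             (λ i → cong₂ _*_ (periodic X i) (periodic-reflect {f = at Y} (s * k) (periodic Y) i)) ⟨
      ∑ w (λ i → at X (s * i) * at Y (s * k - s * i))
        ≡⟨ ∑-cong w (λ i → cong (λ j → at X (s * i) * at Y j) (lemma s k i)) ⟩
      ∑ w (λ i → at X (s * i) * at Y (s * (k - i))) ∎
      where
      lemma : ∀ s k i → s * k - s * i ≡ s * (k - i)
      lemma = solve-∀

    dilate-isSemiringHomomorphism : IsSemiringHomomorphism (dilate s)
    dilate-isSemiringHomomorphism = record
      { isNearSemiringHomomorphism = record
        { +-isMonoidHomomorphism = record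
          { isMagmaHomomorphism = record
            { isRelHomomorphism = record { cong = λ X≈Y → pointwise λ k → at-≈ X≈Y (s * k) }
            ; homo = λ _ _ → pointwise λ _ → refl
            }
          ; ε-homo = pointwise λ _ → refl
          }
        ; *-homo = dilate-⊛
        }
      ; 1#-homo = dilate-𝟙
      }

  monomial : ℤ → ℤ → Element
  at (monomial c g) k = δ w (g - k) * c
  periodic (monomial c g) k = cong (_* c) (periodic-reflect {f = δ w} g (δ-periodic w) k)

  monomial-⊛ : ∀ g X k → at (monomial 1ℤ g ⊛ X) k ≡ at X (k - g)
  monomial-⊛ g X k = trans
    (∑-cong w (λ i → cong (_* at X (k - i)) (trans (ℤ.*-identityʳ _) (δ-swap w g i))))
    (∑-δ {f = λ i → at X (k - i)} g (periodic-reflect {f = at X} k (periodic X)))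

  monomial-^ : ∀ g n → monomial 1ℤ g ^ n ≈ monomial 1ℤ (+ n * g)
  monomial-^ g zero    = pointwise λ k → begin
    δ w k                          ≡⟨ δ-neg w k ⟨
    δ w (- k)                      ≡⟨ cong (δ w) (lemma g k) ⟨
    δ w (0ℤ * g - k)               ≡⟨ ℤ.*-identityʳ _ ⟨
    δ w (0ℤ * g - k) * 1ℤ          ∎
    where
    lemma : ∀ g k → 0ℤ * g - k ≡ - k
    lemma = solve-∀
  monomial-^ g (suc n) = pointwise λ k → begin
    at (monomial 1ℤ g ⊛ monomial 1ℤ g ^ n) k     ≡⟨ monomial-⊛ g (monomial 1ℤ g ^ n) k ⟩
    at (monomial 1ℤ g ^ n) (k - g)               ≡⟨ at-≈ (monomial-^ g n) (k - g) ⟩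
    δ w (+ n * g - (k - g)) * 1ℤ                 ≡⟨ cong (λ x → δ w x * 1ℤ) (lemma (+ n) g k) ⟩
    δ w ((1ℤ + + n) * g - k) * 1ℤ                ∎
    where
    lemma : ∀ n g k → n * g - (k - g) ≡ (1ℤ + n) * g - k
    lemma = solve-∀

  module _ {p : ℕ} (p-prime : Prime p) {s : ℤ} (sp≡1 : s * + p ≡ 1ℤ mod w) where

    private
      σ-homo : IsSemiringHomomorphism (dilate s)
      σ-homo = dilate-isSemiringHomomorphism {s} {+ p} sp≡1

      IsFrob : Element → Set
      IsFrob = IsFrobenius p-prime (dilate s) σ-homo

      resp-≈ : ∀ {X Y} → X ≈ Y → IsFrob X → IsFrob Y
      resp-≈ = frobenius-resp-≈ p-prime (dilate s) σ-homo

      -- On a group element g the map `dilate s` is exactly the p-th power, and n g is a sum of n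
      -- copies of g.
      monomial⁺ : ∀ n g → IsFrob (monomial (+ n) g)
      monomial⁺ zero          g = resp-≈ (pointwise λ k → sym (ℤ.*-zeroʳ (δ w (g - k))))
        (frobenius-0 p-prime (dilate s) σ-homo)
      monomial⁺ (suc zero)    g = ≈⇒≈mod (pointwise λ k →
        trans (cong (_* 1ℤ) (δ-unit {w} {s} {+ p} sp≡1 g k)) (sym (at-≈ (monomial-^ g p) k)))
      monomial⁺ (suc (suc n)) g = resp-≈ (pointwise λ k → lemma (δ w (g - k)) (+ n))
        (frobenius-+ p-prime (dilate s) σ-homo (monomial⁺ 1 g) (monomial⁺ (suc n) g))
        where
        lemma : ∀ d n → d * 1ℤ + d * (1ℤ + n) ≡ d * (+ 2 + n)
        lemma = solve-∀

      monomial-frobenius : ∀ c g → IsFrob (monomial c g)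
      monomial-frobenius (+ n)    g = monomial⁺ n g
      monomial-frobenius -[1+ n ] g = resp-≈
        (pointwise λ k → ℤ.neg-distribʳ-* (δ w (g - k)) (+ suc n))
        (frobenius-neg p-prime (dilate s) σ-homo (monomial⁺ (suc n) g))

      partial : Element → ℕ → Element
      partial X zero    = 𝟘
      partial X (suc n) = partial X n ⊕ monomial (at X (+ n)) (+ n)

      opaque
        unfolding ∑

        at-partial : ∀ X n k → at (partial X n) k ≡ ∑ n (λ i → δ w (i - k) * at X i)
        at-partial X zero    k = refl
        at-partial X (suc n) k = cong (_+ δ w (+ n - k) * at X (+ n)) (at-partial X n k)

      partial-frobenius : ∀ X n → IsFrob (partial X n)
      partial-frobenius X zero    = frobenius-0 p-prime (dilate s) σ-homo
      partial-frobenius X (suc n) = frobenius-+ p-prime (dilate s) σ-homo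
        (partial-frobenius X n) (monomial-frobenius (at X (+ n)) (+ n))

    -- X is the sum of its monomials, `partial X w`.
    dilate-frobenius : ∀ X → IsFrobenius p-prime (dilate s) σ-homo X
    dilate-frobenius X = resp-≈
      (pointwise λ k → trans (at-partial X w k) (∑-δ {f = at X} k (periodic X)))
      (partial-frobenius X w)

open import Data.Integer using (_^_)

-- Self-conjugate primes and multipliers

square≥0 : ∀ x → 0ℤ ℤ.≤ x * x
square≥0 (+ n)    = subst (0ℤ ℤ.≤_) (ℤ.pos-* n n) (ℤ.+≤+ ℕ.z≤n)
square≥0 -[1+ n ] = ℤ.+≤+ ℕ.z≤n

squares≥0 : ∀ n (v : ℕ → ℤ) → 0ℤ ℤ.≤ sumTo n (λ i → v i * v i)
squares≥0 zero    v = ℤ.≤-refl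
squares≥0 (suc n) v = ℤ.+-mono-≤ (squares≥0 n v) (square≥0 (v n))

square≡0 : ∀ x → x * x ≡ 0ℤ → x ≡ 0ℤ
square≡0 x x²≡0 with ℤ.i*j≡0⇒i≡0∨j≡0 x x²≡0
... | inj₁ x≡0 = x≡0
... | inj₂ x≡0 = x≡0

nonneg-sum≡0 : ∀ {a b} → 0ℤ ℤ.≤ a → 0ℤ ℤ.≤ b → a + b ≡ 0ℤ → a ≡ 0ℤ × b ≡ 0ℤ
nonneg-sum≡0 {+ zero} {+ b} _ _ eq = refl , trans (sym (ℤ.+-identityˡ (+ b))) eq

nonneg-sum≡1 : ∀ {a b} → 0ℤ ℤ.≤ a → 0ℤ ℤ.≤ b → a + b ≡ 1ℤ →
               (a ≡ 1ℤ × b ≡ 0ℤ) ⊎ (a ≡ 0ℤ × b ≡ 1ℤ)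
nonneg-sum≡1 {+ zero}        {+ b}     _ _ eq = inj₂ (refl , trans (sym (ℤ.+-identityˡ (+ b))) eq)
nonneg-sum≡1 {+ suc zero}    {+ zero}  _ _ eq = inj₁ (refl , refl)

squares≡0 : ∀ n {v : ℕ → ℤ} → sumTo n (λ i → v i * v i) ≡ 0ℤ →
            ∀ (h : ℕ → ℤ) → sumTo n (λ i → v i * h i) ≡ 0ℤ
squares≡0 zero        _  h = refl
squares≡0 (suc n) {v} eq h with nonneg-sum≡0 (squares≥0 n v) (square≥0 (v n)) eq
... | init≡0 , last≡0 =
  cong₂ _+_ (squares≡0 n {v} init≡0 h) (cong (_* h n) (square≡0 (v n) last≡0))

-- That is, v is ± the point mass at g, expressed through its pairings.
squares≡1 : ∀ n {v : ℕ → ℤ} → sumTo n (λ i → v i * v i) ≡ 1ℤ →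
            ∃₂ λ ε g → ε * ε ≡ 1ℤ × (∀ (h : ℕ → ℤ) → sumTo n (λ i → v i * h i) ≡ ε * h g)
squares≡1 (suc n) {v} eq with nonneg-sum≡1 (squares≥0 n v) (square≥0 (v n)) eq
... | inj₂ (init≡0 , last≡1) = v n , n , last≡1 , λ h →
  trans (cong (_+ v n * h n) (squares≡0 n {v} init≡0 h)) (ℤ.+-identityˡ (v n * h n))
... | inj₁ (init≡1 , last≡0) with squares≡1 n {v} init≡1
...   | ε , g , ε² , mass = ε , g , ε² , λ h → begin
  sumTo n (λ i → v i * h i) + v n * h n  ≡⟨ cong₂ (λ a b → a + b * h n) (mass h) (square≡0 (v n) last≡0) ⟩
  ε * h g + 0ℤ                           ≡⟨ ℤ.+-identityʳ (ε * h g) ⟩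
  ε * h g                                ∎

opaque
  unfolding ∑

  ∑-squares≡1 : ∀ n {v : ℤ → ℤ} → ∑ n (λ i → v i * v i) ≡ 1ℤ →
                ∃₂ λ ε g → ε * ε ≡ 1ℤ × (∀ (h : ℤ → ℤ) → ∑ n (λ i → v i * h i) ≡ ε * h g)
  ∑-squares≡1 n {v} ∑v²≡1 with squares≡1 n {λ i → v (+ i)} ∑v²≡1
  ... | ε , g , ε²≡1 , mass = ε , + g , ε²≡1 , λ h → mass (λ i → h (+ i))

-- X X* = N + κ G in the group ring, where G is the sum of all group elements.
record TwoLevel (w : ℕ) (N κ : ℤ) (f : ℤ → ℤ) : Set where
  constructor twoLevel
  field levels : ∀ k → ∑ w (λ i → f i * f (i + k)) ≡ N * δ w k + κ

open TwoLevel public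

Perfect : ℕ → ℤ → (ℤ → ℤ) → Set
Perfect w N f = TwoLevel w N 0ℤ f

autocorrelation : ∀ {w N f} → Perfect w N f → ∀ k → ∑ w (λ i → f i * f (i + k)) ≡ N * δ w k
autocorrelation {w} {N} perf k = trans (levels perf k) (ℤ.+-identityʳ (N * δ w k))

-- The augmentation applied to X X* = N + κ G; the augmentation of G is w.
twoLevel-sum : ∀ {w} .{{_ : NonZero w}} {N κ f} → Periodic w f → TwoLevel w N κ f →
               ∑ w f * ∑ w f ≡ N + + w * κ
twoLevel-sum {w} {N} {κ} {f} per tl = begin
  ∑ w f * ∑ w f
    ≡⟨ *-distribʳ-∑ w (∑ w f) f ⟩
  ∑ w (λ i → f i * ∑ w f)
    ≡⟨ ∑-cong w (λ i → cong (f i *_) (trans (∑-cong w (λ k → cong f (ℤ.+-comm i k))) (∑-shift {f = f} i per))) ⟨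
  ∑ w (λ i → f i * ∑ w (λ k → f (i + k)))
    ≡⟨ ∑-cong w (λ i → *-distribˡ-∑ w (f i) (λ k → f (i + k))) ⟩
  ∑ w (λ i → ∑ w (λ k → f i * f (i + k)))
    ≡⟨ ∑-comm w w (λ i k → f i * f (i + k)) ⟩
  ∑ w (λ k → ∑ w (λ i → f i * f (i + k)))
    ≡⟨ ∑-cong w (λ k → trans (levels tl k) (cong (_+ κ) (ℤ.*-comm N (δ w k)))) ⟩
  ∑ w (λ k → δ w k * N + κ)
    ≡⟨ ∑-distrib-+ w (λ k → δ w k * N) (λ _ → κ) ⟩
  ∑ w (λ k → δ w k * N) + ∑ w (λ _ → κ)
    ≡⟨ cong₂ _+_ (∑-δ₀ (λ _ → N)) (∑-const w κ) ⟩
  N + + w * κ ∎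

module _ {w : ℕ} .{{_ : NonZero w}} where

  open GroupRing w
  open CommutativeRing groupRing using (semiring)
  private module R = CommutativeRing groupRing
  open import Algebra.Properties.Semiring.Exp semiring using () renaming (_^_ to _^ᴿ_)
  open FrobeniusLift groupRing using (π; finiteOrder⇒regular; σ^; σ^-*-∣; conjugate-∣)

  sequence : ∀ f → Periodic w f → Element
  at (sequence f per) = f
  periodic (sequence f per) = per

  star : Element → Element
  star = dilate (- 1ℤ)

  at-⊛-star : ∀ X Y k → at (X ⊛ star Y) k ≡ ∑ w (λ i → at X i * at Y (i - k))
  at-⊛-star X Y k = ∑-cong w (λ i → cong (λ j → at X i * at Y j) (lemma k i))
    where
    lemma : ∀ k i → - 1ℤ * (k - i) ≡ i - k
    lemma = solve-∀

  -- The coefficient at - k of X^(t) X*, where X^(t) is the image of X under g ↦ t g. In this form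
  -- the inverse of t does not appear.
  correlation : ℤ → (ℤ → ℤ) → ℤ → ℤ
  correlation t f k = ∑ w (λ i → f i * f (t * i + k))

  dilate-⊛-star : ∀ {s t} → t * s ≡ 1ℤ mod w → ∀ X k →
                  at (dilate s X ⊛ star X) (- k) ≡ correlation t (at X) k
  dilate-⊛-star {s} {t} ts≡1 X k = begin
    at (dilate s X ⊛ star X) (- k)
      ≡⟨ at-⊛-star (dilate s X) X (- k) ⟩
    ∑ w (λ i → at X (s * i) * at X (i - - k))
      ≡⟨ ∑-scale {f = λ i → at X (s * i) * at X (i - - k)} t s ts≡1
           (λ i → cong₂ _*_ (periodic (dilate s X) i) (periodic-shift {f = at X} (- - k) (periodic X) i)) ⟨
    ∑ w (λ i → at X (s * (t * i)) * at X (t * i - - k))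
      ≡⟨ ∑-cong w (λ i → cong₂ _*_ (periodic⇒cong {f = at X} (periodic X) (unit i))
           (cong (at X) (lemma₁ (t * i) k))) ⟩
    ∑ w (λ i → at X i * at X (t * i + k)) ∎
    where
    lemma₁ : ∀ a k → a - - k ≡ a + k
    lemma₁ = solve-∀
    unit : ∀ i → s * (t * i) ≡ i mod w
    unit i = [ subst (+ w ∣_) (lemma₂ s t i) (∣n⇒∣m*n i (difference ts≡1)) ]
      where
      lemma₂ : ∀ s t i → i * (t * s - 1ℤ) ≡ s * (t * i) - i
      lemma₂ = solve-∀

  scalar : ℤ → Element
  at (scalar n) k = n * δ w k
  periodic (scalar n) k = cong (n *_) (δ-periodic w k)

  scalar-actsAs : ∀ n → ActsAs n (scalar n)
  scalar-actsAs n X k = begin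
    ∑ w (λ i → n * δ w i * at X (k - i))      ≡⟨ ∑-cong w (λ i → ℤ.*-assoc n (δ w i) (at X (k - i))) ⟩
    ∑ w (λ i → n * (δ w i * at X (k - i)))    ≡⟨ *-distribˡ-∑ w n (λ i → δ w i * at X (k - i)) ⟨
    n * at (𝟙 ⊛ X) k                          ≡⟨ cong (n *_) (at-≈ (⊛-identityˡ X) k) ⟩
    n * at X k                                ∎

  perfect⇒⊛-star : ∀ {N} X → Perfect w N (at X) → X ⊛ star X ≈ scalar N
  perfect⇒⊛-star {N} X perf = pointwise λ k →
    trans (at-⊛-star X X k) (trans (autocorrelation perf (- k)) (cong (N *_) (δ-neg w k)))

  *-cong-mod : ∀ {a b c d} → a ≡ b mod w → c ≡ d mod w → a * c ≡ b * d mod w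
  *-cong-mod {a} {b} {c} {d} a≡b c≡d = mod-trans (*-congʳ-mod c a≡b) (*-congˡ-mod b c≡d)

  module _ {p : ℕ} (p-prime : Prime p) (f : ℕ) (p^f≡1 : (+ p) ^ suc f ≡ 1ℤ mod w) where

    private
      -- The inverse of p modulo w, so that `dilate s` is the Frobenius lift g ↦ p g (in additive
      -- notation).
      s : ℤ
      s = (+ p) ^ f

      sp≡1 : s * + p ≡ 1ℤ mod w
      sp≡1 = subst (λ x → x ≡ 1ℤ mod w) (ℤ.*-comm (+ p) s) p^f≡1

      s^p^≡1 : ∀ i → s ^ i * (+ p) ^ i ≡ 1ℤ mod w
      s^p^≡1 zero    = ≡⇒≡mod refl
      s^p^≡1 (suc i) = subst (λ x → x ≡ 1ℤ mod w) (lemma s (+ p) (s ^ i) ((+ p) ^ i))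
        (*-cong-mod sp≡1 (s^p^≡1 i))
        where
        lemma : ∀ s p a b → s * p * (a * b) ≡ s * a * (p * b)
        lemma = solve-∀

      s^f≡1 : s ^ suc f ≡ 1ℤ mod w
      s^f≡1 = mod-trans (subst (λ x → x ≡ s ^ suc f * (+ p) ^ suc f mod w) (ℤ.*-identityʳ _)
        (*-congˡ-mod (s ^ suc f) (mod-sym p^f≡1))) (s^p^≡1 (suc f))

      σ-homo = dilate-isSemiringHomomorphism {s} {+ p} sp≡1
      frob = dilate-frobenius p-prime {s} sp≡1
      iter = σ^ p-prime (dilate s) σ-homo

      at-iter : ∀ i X k → at (iter i X) k ≡ at X (s ^ i * k)
      at-iter zero    X k = cong (at X) (sym (ℤ.*-identityˡ k))
      at-iter (suc i) X k = trans (at-iter i X (s * k)) (cong (at X) (lemma s (s ^ i) k))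
        where
        lemma : ∀ s a k → a * (s * k) ≡ s * a * k
        lemma = solve-∀

      iter≈dilate : ∀ i X → iter i X ≈ dilate (s ^ i) X
      iter≈dilate i X = pointwise (at-iter i X)

      regular = finiteOrder⇒regular p-prime (dilate s) σ-homo frob f (λ X → pointwise λ k →
        trans (at-iter (suc f) X k) (periodic⇒cong {f = at X} (periodic X)
          (subst (λ x → s ^ suc f * k ≡ x mod w) (ℤ.*-identityˡ k) (*-congʳ-mod k s^f≡1))))

      perfect⇒π^⊛ : ∀ m {n} X → Perfect w (+ (p ℕ.^ m) * n) (at X) →
                    X ⊛ star X ≈ π p-prime ^ᴿ m ⊛ scalar n
      perfect⇒π^⊛ m {n} X perf = pointwise λ k → begin
        at (X ⊛ star X) k                       ≡⟨ at-≈ (perfect⇒⊛-star X perf) k ⟩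
        + (p ℕ.^ m) * n * δ w k                 ≡⟨ ℤ.*-assoc (+ (p ℕ.^ m)) n (δ w k) ⟩
        + (p ℕ.^ m) * (n * δ w k)               ≡⟨ at-π^⊛ p-prime m (scalar n) k ⟨
        at (π p-prime ^ᴿ m ⊛ scalar n) k        ∎

      dilate-∣ : ∀ j m {n} X → Perfect w (+ (p ℕ.^ m) * n) (at X) →
                 ∃ λ Z → iter j X ⊛ star X ≈ π p-prime ^ᴿ m ⊛ Z
      dilate-∣ j m {n} X perf = σ^-*-∣ p-prime (dilate s) σ-homo frob regular j m
        {X} {star X} {scalar n} (perfect⇒π^⊛ m X perf)

    private
      at-iter-⊛-star : ∀ j {t} → (+ p) ^ j ≡ t mod w → ∀ X k →
                       at (iter j X ⊛ star X) (- k) ≡ correlation t (at X) k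
      at-iter-⊛-star j {t} p^j≡t X k = trans
        (at-≈ (R.*-congʳ {star X} (iter≈dilate j X)) (- k)) (dilate-⊛-star {s ^ j} {t} ts^j≡1 X k)
        where
        ts^j≡1 : t * s ^ j ≡ 1ℤ mod w
        ts^j≡1 = mod-trans (*-congʳ-mod (s ^ j) (mod-sym p^j≡t))
          (subst (λ x → x ≡ 1ℤ mod w) (ℤ.*-comm (s ^ j) ((+ p) ^ j)) (s^p^≡1 j))

    -- X^(t) is the image of X under the j-th iterate of Frobenius, hence lies in the ideal of X and
    -- p^m. So X^(t) X* is divisible by p^m because X X* is.
    correlation-∣ : ∀ j {t} → (+ p) ^ j ≡ t mod w → ∀ m {n f} → Periodic w f →
                    Perfect w (+ (p ℕ.^ m) * n) f → ∀ k → + (p ℕ.^ m) ∣ correlation t f k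
    correlation-∣ j {t} p^j≡t m {n} {f} per perf k =
      divides (at Z (- k)) (trans (sym (at-iter-⊛-star j p^j≡t (sequence f per) k))
        (trans (at-≈ (proj₂ Z,eq) (- k)) (trans (at-π^⊛ p-prime m Z (- k)) (ℤ.*-comm (+ (p ℕ.^ m)) (at Z (- k))))))
      where
      Z,eq = dilate-∣ j m {n} (sequence f per) perf
      Z = proj₁ Z,eq

    private
      conjugate : ∀ j → (+ p) ^ j ≡ - 1ℤ mod w → ∀ a {n} X → Perfect w (+ (p ℕ.^ (a ℕ.+ a)) * n) (at X) →
                  ∃ λ Z → star X ≈ π p-prime ^ᴿ a ⊛ Z
      conjugate j p^j≡-1 a {n} X perf =
        conjugate-∣ p-prime (dilate s) σ-homo frob regular (π-cancel p-prime)
          j a (pointwise λ k → trans (at-iter j X k) (periodic⇒cong {f = at X} (periodic X) (*-congʳ-mod k s^j≡-1)))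
          (perfect⇒π^⊛ (a ℕ.+ a) X perf)
        where
        s^j≡-1 : s ^ j ≡ - 1ℤ mod w
        s^j≡-1 = subst (λ x → x ≡ - 1ℤ mod w) (lemma (s ^ j)) (*-congˡ-mod (- 1ℤ) (mod-trans
          (*-congˡ-mod (s ^ j) (mod-sym p^j≡-1)) (s^p^≡1 j)))
          where
          lemma : ∀ a → - 1ℤ * (a * - 1ℤ) ≡ a
          lemma = solve-∀

    conjugate⇒∣ : ∀ j → (+ p) ^ j ≡ - 1ℤ mod w → ∀ a {n f} → Periodic w f →
      Perfect w (+ (p ℕ.^ (a ℕ.+ a)) * n) f → ∀ k → + (p ℕ.^ a) ∣ f k
    conjugate⇒∣ j p^j≡-1 a {n} {f} per perf k = divides (at Y (- k)) (begin
      f k                                ≡⟨ cong f (lemma k) ⟩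
      f (- 1ℤ * - k)                     ≡⟨ at-≈ (proj₂ Y,eq) (- k) ⟩
      at (π p-prime ^ᴿ a ⊛ Y) (- k)      ≡⟨ at-π^⊛ p-prime a Y (- k) ⟩
      + (p ℕ.^ a) * at Y (- k)           ≡⟨ ℤ.*-comm (+ (p ℕ.^ a)) (at Y (- k)) ⟩
      at Y (- k) * + (p ℕ.^ a)           ∎)
      where
      Y,eq = conjugate j p^j≡-1 a {n} (sequence f per) perf
      Y = proj₁ Y,eq
      lemma : ∀ k → k ≡ - 1ℤ * - k
      lemma = solve-∀

  -- Squaring the congruence gives p^(2(j+1)) ≡ 1, the finite order that regularity asks for; 2(j+1)
  -- is the successor of `j ℕ.+ suc j`.
  selfConjugate-∣ : ∀ {p} → Prime p → ∀ j → (+ p) ^ suc j ≡ - 1ℤ mod w → ∀ a {n f} → Periodic w f →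
    Perfect w (+ (p ℕ.^ (a ℕ.+ a)) * n) f → ∀ k → + (p ℕ.^ a) ∣ f k
  selfConjugate-∣ {p} p-prime j p^j≡-1 = conjugate⇒∣ p-prime (j ℕ.+ suc j)
    (subst (λ x → x ≡ 1ℤ mod w) (sym (ℤ.^-distribˡ-+-* (+ p) (suc j) (suc j))) (*-cong-mod p^j≡-1 p^j≡-1))
    (suc j) p^j≡-1

  star-⊛ : ∀ X Y → star (X ⊛ Y) ≈ star X ⊛ star Y
  star-⊛ = dilate-⊛ { - 1ℤ} { - 1ℤ} [ divides 0ℤ refl ]

  star-involutive : ∀ X → star (star X) ≈ X
  star-involutive X = pointwise λ k → cong (at X) (lemma k)
    where
    lemma : ∀ k → - 1ℤ * (- 1ℤ * k) ≡ k
    lemma = solve-∀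

  star-dilate : ∀ s X → star (dilate s X) ≈ dilate s (star X)
  star-dilate s X = pointwise λ k → cong (at X) (lemma s k)
    where
    lemma : ∀ s k → s * (- 1ℤ * k) ≡ - 1ℤ * (s * k)
    lemma = solve-∀

  perfect-sum : ∀ {N f} → Periodic w f → Perfect w N f → ∑ w f * ∑ w f ≡ N
  perfect-sum {N} per perf = trans (twoLevel-sum per perf)
    (trans (cong (λ z → N + z) (ℤ.*-zeroʳ (+ w))) (ℤ.+-identityʳ N))

  divisible⇒multiple : ∀ N {f} → .{{_ : ℤ.NonZero N}} → Periodic w f → (∀ k → N ∣ f k) →
                       ∃ λ v → Periodic w v × (∀ k → f k ≡ N * v k)
  divisible⇒multiple N {f} per N∣f = v , v-periodic , f≡Nv
    where
    v : ℤ → ℤ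
    v k = _∣_.quotient (N∣f k)
    f≡Nv : ∀ k → f k ≡ N * v k
    f≡Nv k = trans (_∣_.equality (N∣f k)) (ℤ.*-comm (v k) N)
    v-periodic : Periodic w v
    v-periodic k = ℤ.*-cancelˡ-≡ N (v (k + + w)) (v k)
      (trans (sym (f≡Nv (k + + w))) (trans (per k) (f≡Nv k)))

  module _ {N : ℤ} .{{_ : ℤ.NonZero N}} {s t : ℤ} (ts≡1 : t * s ≡ 1ℤ mod w) where

    private
      Z : Element → Element
      Z X = dilate s X ⊛ star X

      st≡1 : s * t ≡ 1ℤ mod w
      st≡1 = subst (λ x → x ≡ 1ℤ mod w) (ℤ.*-comm t s) ts≡1

      -- For Z = X^(t) X* the product Z Z* regroups as (X X*)^(t) times X X*, and both factors are
      -- N.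
      Z⊛starZ : ∀ X → Perfect w N (at X) → Z X ⊛ star (Z X) ≈ scalar N ⊛ scalar N
      Z⊛starZ X perf = R.trans (R.*-congˡ {Z X} (R.trans (star-⊛ σX (star X))
        (R.*-cong (star-dilate s X) (star-involutive X))))
        (R.trans (interchange σX (star X) (dilate s (star X)) X) (R.*-cong
          (R.trans (R.sym (dilate-⊛ {s} {t} st≡1 X (star X)))
            (pointwise λ k → trans (at-≈ XX*≈N (s * k)) (cong (N *_) (at-≈ (dilate-𝟙 {s} {t} st≡1) k))))
          XX*≈N))
        where
        σX = dilate s X
        XX*≈N = perfect⇒⊛-star X perf
        open import Algebra.Solver.Ring.NaturalCoefficients.Default R.commutativeSemiring
          using (solve; _:*_; _:=_)
        interchange : ∀ a b c d → (a ⊛ b) ⊛ (c ⊛ d) ≈ (a ⊛ c) ⊛ (d ⊛ b)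
        interchange = solve 4 (λ a b c d → (a :* b) :* (c :* d) := (a :* c) :* (d :* b)) R.refl

      Z⊛X : ∀ X → Perfect w N (at X) → ∀ k → at (Z X ⊛ X) k ≡ N * at X (s * k)
      Z⊛X X perf k = trans (at-≈ (R.trans (rearrange (dilate s X) (star X) X)
          (R.*-congʳ {dilate s X} (perfect⇒⊛-star X perf))) k)
        (scalar-actsAs N (dilate s X) k)
        where
        open import Algebra.Solver.Ring.NaturalCoefficients.Default R.commutativeSemiring
          using (solve; _:*_; _:=_)
        rearrange : ∀ a b c → (a ⊛ b) ⊛ c ≈ (c ⊛ b) ⊛ a
        rearrange = solve 3 (λ a b c → (a :* b) :* c := (c :* b) :* a) R.refl

      dilate≈±shift : ∀ X → Perfect w N (at X) → (∀ k → N ∣ correlation t (at X) k) →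
                      ∃₂ λ ε g → ∀ k → at X (s * k) ≡ ε * at X (k - g)
      dilate≈±shift X perf N∣corr = ε , g , λ k → ℤ.*-cancelˡ-≡ N _ _ (begin
        N * at X (s * k)                            ≡⟨ Z⊛X X perf k ⟨
        ∑ w (λ i → at (Z X) i * at X (k - i))       ≡⟨ Nv* (λ i → at X (k - i)) ⟩
        N * ∑ w (λ i → v i * at X (k - i))          ≡⟨ cong (N *_) (mass (λ i → at X (k - i))) ⟩
        N * (ε * at X (k - g))                    ∎)
        where
        N∣Z : ∀ k → N ∣ at (Z X) k
        N∣Z k = subst (λ x → N ∣ at (Z X) x) (ℤ.neg-involutive k)
          (subst (N ∣_) (sym (dilate-⊛-star {s} {t} ts≡1 X (- k))) (N∣corr (- k)))
        multiple = divisible⇒multiple N (periodic (Z X)) N∣Z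
        v = proj₁ multiple
        Nv* : ∀ (h : ℤ → ℤ) → ∑ w (λ i → at (Z X) i * h i) ≡ N * ∑ w (λ i → v i * h i)
        Nv* h = trans (∑-cong w (λ i → trans (cong (_* h i) (proj₂ (proj₂ multiple) i)) (ℤ.*-assoc N (v i) (h i))))
          (sym (*-distribˡ-∑ w N (λ i → v i * h i)))
        -- The coefficient of Z Z* = N² at the identity. An integral vector with sum of squares 1 is
        -- a signed unit vector.
        ∑v²≡1 : ∑ w (λ i → v i * v i) ≡ 1ℤ
        ∑v²≡1 = ℤ.*-cancelˡ-≡ N _ _ (ℤ.*-cancelˡ-≡ N _ _ (begin
          N * (N * ∑ w (λ i → v i * v i))
            ≡⟨ cong (N *_) (*-distribˡ-∑ w N (λ i → v i * v i)) ⟩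
          N * ∑ w (λ i → N * (v i * v i))
            ≡⟨ cong (N *_) (∑-cong w (λ i → trans (cong (v i *_) (proj₂ (proj₂ multiple) i)) (lemma N (v i)))) ⟨
          N * ∑ w (λ i → v i * at (Z X) i)
            ≡⟨ Nv* (at (Z X)) ⟨
          ∑ w (λ i → at (Z X) i * at (Z X) i)
            ≡⟨ ∑-cong w (λ i → cong (λ x → at (Z X) i * at (Z X) x) (ℤ.+-identityʳ i)) ⟨
          ∑ w (λ i → at (Z X) i * at (Z X) (i - 0ℤ))
            ≡⟨ at-⊛-star (Z X) (Z X) 0ℤ ⟨
          at (Z X ⊛ star (Z X)) 0ℤ
            ≡⟨ at-≈ (Z⊛starZ X perf) 0ℤ ⟩
          at (scalar N ⊛ scalar N) 0ℤ
            ≡⟨ scalar-actsAs N (scalar N) 0ℤ ⟩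
          N * (N * δ w 0ℤ)
            ≡⟨ cong (λ x → N * (N * x)) (δ-yes w {0ℤ} (divides 0ℤ refl)) ⟩
          N * (N * 1ℤ) ∎))
          where
          lemma : ∀ N a → a * (N * a) ≡ N * (a * a)
          lemma = solve-∀
        point = ∑-squares≡1 w {v} ∑v²≡1
        ε = proj₁ point
        g = proj₁ (proj₂ point)
        mass = proj₂ (proj₂ (proj₂ point))

    -- X^(t) X* = N V with V V* = 1 forces V = ±g, so t fixes X up to a translation; the sign
    -- is + because X has nonzero sum, and the translation is removed by recentring.
    multiplier : ∀ {u} → (t - 1ℤ) * u ≡ 1ℤ mod w → ∀ {f} → Periodic w f → Perfect w N f →
                 (∀ k → N ∣ correlation t f k) → ∃ λ c → ∀ k → f (c + k) ≡ f (c + t * k)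
    multiplier {u} [t-1]u≡1 {f} per perf N∣corr = c , λ k → begin
      f (c + k)                         ≡⟨ periodic⇒cong {f = f} per (unit k) ⟨
      f (s * (t * (c + k)))             ≡⟨ f[sk]≡ (t * (c + k)) ⟩
      ε * f (t * (c + k) - g)           ≡⟨ cong (_* f (t * (c + k) - g)) ε≡1 ⟩
      1ℤ * f (t * (c + k) - g)          ≡⟨ ℤ.*-identityˡ _ ⟩
      f (t * (c + k) - g)               ≡⟨ periodic⇒cong {f = f} per (centre k) ⟩
      f (c + t * k)                     ∎
      where
      shifted = dilate≈±shift (sequence f per) perf N∣corr
      ε = proj₁ shifted
      g = proj₁ (proj₂ shifted)
      -- The solution of (t - 1) c ≡ g: about this point the translated dilation k ↦ t k - g becomes
      -- a pure dilation.
      c = u * g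
      f[sk]≡ : ∀ k → f (s * k) ≡ ε * f (k - g)
      f[sk]≡ = proj₂ (proj₂ shifted)
      ∑f≢0 : ∑ w f ≢ 0ℤ
      ∑f≢0 ∑f≡0 = ℕ.≢-nonZero⁻¹ ∣ N ∣ (cong ∣_∣ (trans (sym (perfect-sum per perf)) (cong (_* ∑ w f) ∑f≡0)))
      ε≡1 : ε ≡ 1ℤ
      ε≡1 = ℤ.*-cancelʳ-≡ ε 1ℤ (∑ w f) {{ℤ.≢-nonZero ∑f≢0}} (begin
        ε * ∑ w f                       ≡⟨ cong (ε *_) (∑-shift {f = f} (- g) per) ⟨
        ε * ∑ w (λ k → f (k - g))       ≡⟨ *-distribˡ-∑ w ε (λ k → f (k - g)) ⟩
        ∑ w (λ k → ε * f (k - g))       ≡⟨ ∑-cong w (λ k → sym (f[sk]≡ k)) ⟩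
        ∑ w (λ k → f (s * k))           ≡⟨ ∑-scale {f = f} s t st≡1 per ⟩
        ∑ w f                           ≡⟨ ℤ.*-identityˡ (∑ w f) ⟨
        1ℤ * ∑ w f                      ∎)
      unit : ∀ k → s * (t * (c + k)) ≡ c + k mod w
      unit k = [ subst (+ w ∣_) (lemma s t (c + k)) (∣n⇒∣m*n (c + k) (difference ts≡1)) ]
        where
        lemma : ∀ s t a → a * (t * s - 1ℤ) ≡ s * (t * a) - a
        lemma = solve-∀
      centre : ∀ k → t * (c + k) - g ≡ c + t * k mod w
      centre k = [ subst (+ w ∣_) (lemma t u g k) (∣n⇒∣m*n g (difference [t-1]u≡1)) ]
        where
        lemma : ∀ t u g k → g * ((t - 1ℤ) * u - 1ℤ) ≡ t * (u * g + k) - g - (u * g + t * k)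
        lemma = solve-∀

  -- If M ∣ X and X X* = M², then X = ± M g; a multiplier without other fixed points pins g
  -- to the centre.
  concentrated : ∀ M {t u f c} → .{{_ : ℤ.NonZero M}} → (t - 1ℤ) * u ≡ 1ℤ mod w →
                 Periodic w f → Perfect w (M * M) f → (∀ k → M ∣ f k) →
                 (∀ k → f (c + k) ≡ f (c + t * k)) → f c ≡ ∑ w f
  concentrated M {t} {u} {f} {c} [t-1]u≡1 per perf M∣f centred = begin
    f c                               ≡⟨ periodic⇒cong {f = f} per c≡g ⟩
    f g                           ≡⟨ f≡ g ⟩
    M * (ε * δ w (g - g))         ≡⟨ cong (λ x → M * (ε * x)) (δ-yes w {g - g} (divides 0ℤ (ℤ.+-inverseʳ g))) ⟩
    M * (ε * 1ℤ)                      ≡⟨ cong (M *_) (mass (λ _ → 1ℤ)) ⟨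
    M * ∑ w (λ i → v i * 1ℤ)          ≡⟨ cong (M *_) (∑-cong w (λ i → ℤ.*-identityʳ (v i))) ⟩
    M * ∑ w v                         ≡⟨ *-distribˡ-∑ w M v ⟩
    ∑ w (λ i → M * v i)               ≡⟨ ∑-cong w f≡Mv ⟨
    ∑ w f                             ∎
    where
    multiple = divisible⇒multiple M per M∣f
    v = proj₁ multiple
    f≡Mv : ∀ k → f k ≡ M * v k
    f≡Mv = proj₂ (proj₂ multiple)
    ∑v²≡1 : ∑ w (λ i → v i * v i) ≡ 1ℤ
    ∑v²≡1 = ℤ.*-cancelˡ-≡ M _ _ (ℤ.*-cancelˡ-≡ M _ _ (begin
      M * (M * ∑ w (λ i → v i * v i))
        ≡⟨ ℤ.*-assoc M M _ ⟨
      M * M * ∑ w (λ i → v i * v i)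
        ≡⟨ *-distribˡ-∑ w (M * M) (λ i → v i * v i) ⟩
      ∑ w (λ i → M * M * (v i * v i))
        ≡⟨ ∑-cong w (λ i → trans (cong₂ _*_ (f≡Mv i) (trans (cong f (ℤ.+-identityʳ i)) (f≡Mv i))) (lemma M (v i))) ⟨
      ∑ w (λ i → f i * f (i + 0ℤ))
        ≡⟨ autocorrelation perf 0ℤ ⟩
      M * M * δ w 0ℤ
        ≡⟨ cong (M * M *_) (δ-yes w {0ℤ} (divides 0ℤ refl)) ⟩
      M * M * 1ℤ
        ≡⟨ ℤ.*-assoc M M 1ℤ ⟩
      M * (M * 1ℤ) ∎))
      where
      lemma : ∀ M a → M * a * (M * a) ≡ M * M * (a * a)
      lemma = solve-∀
    point = ∑-squares≡1 w {v} ∑v²≡1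
    ε = proj₁ point
    g = proj₁ (proj₂ point)
    ε²≡1 = proj₁ (proj₂ (proj₂ point))
    mass = proj₂ (proj₂ (proj₂ point))
    f≡ : ∀ k → f k ≡ M * (ε * δ w (g - k))
    f≡ k = begin
      f k                                     ≡⟨ ∑-δ {f = f} k per ⟨
      ∑ w (λ i → δ w (i - k) * f i)           ≡⟨ ∑-cong w (λ i → trans (cong (δ w (i - k) *_) (f≡Mv i))
                                                   (lemma (δ w (i - k)) M (v i))) ⟩
      ∑ w (λ i → M * (v i * δ w (i - k)))     ≡⟨ *-distribˡ-∑ w M (λ i → v i * δ w (i - k)) ⟨
      M * ∑ w (λ i → v i * δ w (i - k))       ≡⟨ cong (M *_) (mass (λ i → δ w (i - k))) ⟩
      M * (ε * δ w (g - k))                 ∎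
      where
      lemma : ∀ d M a → d * (M * a) ≡ M * (a * d)
      lemma = solve-∀
    support : ∀ k → f k ≢ 0ℤ → + w ∣ g - k
    support k fk≢0 = decidable-stable (+ w ∣? (g - k)) λ w∤g-k →
      fk≢0 (begin
        f k                        ≡⟨ f≡ k ⟩
        M * (ε * δ w (g - k))    ≡⟨ cong (λ x → M * (ε * x)) (δ-no w w∤g-k) ⟩
        M * (ε * 0ℤ)               ≡⟨ cong (M *_) (ℤ.*-zeroʳ ε) ⟩
        M * 0ℤ                     ≡⟨ ℤ.*-zeroʳ M ⟩
        0ℤ                         ∎)
    fg≢0 : f g ≢ 0ℤ
    fg≢0 fg≡0 = ℕ.≢-nonZero⁻¹ ∣ M ∣ (cong ∣_∣ (begin
      M                 ≡⟨ ℤ.*-identityʳ M ⟨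
      M * 1ℤ            ≡⟨ cong (M *_) ε²≡1 ⟨
      M * (ε * ε)       ≡⟨ lemma M ε ⟩
      M * (ε * 1ℤ) * ε  ≡⟨ cong (λ x → M * (ε * x) * ε) (δ-yes w {g - g} (divides 0ℤ (ℤ.+-inverseʳ g))) ⟨
      M * (ε * δ w (g - g)) * ε ≡⟨ cong (_* ε) (f≡ g) ⟨
      f g * ε       ≡⟨ cong (_* ε) fg≡0 ⟩
      0ℤ                ∎))
      where
      lemma : ∀ M ε → M * (ε * ε) ≡ M * (ε * 1ℤ) * ε
      lemma = solve-∀
    c≡g : c ≡ g mod w
    c≡g = [ subst (+ w ∣_) (lemma₂ c g t u) (∣m∣n⇒∣m+n (∣n⇒∣m*n u fixed)
              (∣n⇒∣m*n (g - c) (difference [t-1]u≡1))) ]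
      where
      lemma₁ : ∀ c g → c + (g - c) ≡ g
      lemma₁ = solve-∀
      lemma₂ : ∀ c g t u → u * (g - (c + t * (g - c))) + (g - c) * ((t - 1ℤ) * u - 1ℤ) ≡ c - g
      lemma₂ = solve-∀
      -- Since g = c + (g - c), the multiplier carries the nonzero value at g to the point c + t (g
      -- - c), which must be g again.
      fixed : + w ∣ g - (c + t * (g - c))
      fixed = support (c + t * (g - c)) (λ f≡0 → fg≢0 (trans (cong f (sym (lemma₁ c g)))
        (trans (centred (g - c)) f≡0)))

-- Images in smaller groups

sumTo-* : ∀ c w g → sumTo (c ℕ.* w) g ≡ sumTo c (λ l → sumTo w (λ i → g (l ℕ.* w ℕ.+ i)))
sumTo-* zero    w g = refl
sumTo-* (suc c) w g = begin
  sumTo (w ℕ.+ c ℕ.* w) g                                      ≡⟨ cong (λ n → sumTo n g) (ℕ.+-comm w (c ℕ.* w)) ⟩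
  sumTo (c ℕ.* w ℕ.+ w) g                                      ≡⟨ sumTo-+ (c ℕ.* w) w g ⟩
  sumTo (c ℕ.* w) g + sumTo w (λ i → g (c ℕ.* w ℕ.+ i))        ≡⟨ cong (_+ sumTo w (λ i → g (c ℕ.* w ℕ.+ i))) (sumTo-* c w g) ⟩
  sumTo c (λ l → sumTo w (λ i → g (l ℕ.* w ℕ.+ i)))
    + sumTo w (λ i → g (c ℕ.* w ℕ.+ i))                        ∎

-- The image of X ∈ ℤ[ℤ/cw] in ℤ[ℤ/w].
fold : ℕ → ℕ → (ℤ → ℤ) → ℤ → ℤ
fold w c f k = ∑ c (λ l → f (k + l * + w))

module _ {w c : ℕ} .{{_ : NonZero w}} .{{_ : NonZero c}} {f : ℤ → ℤ} (per : Periodic (c ℕ.* w) f) where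

  fibre-periodic : ∀ k → Periodic c (λ l → f (k + l * + w))
  fibre-periodic k l = trans (cong f (trans (lemma k l (+ c) (+ w)) (cong (λ x → k + l * + w + x) (sym (ℤ.pos-* c w)))))
    (per (k + l * + w))
    where
    lemma : ∀ k l c w → k + (l + c) * w ≡ k + l * w + c * w
    lemma = solve-∀

  fold-periodic : Periodic w (fold w c f)
  fold-periodic k = trans (∑-cong c (λ l → cong f (lemma k l (+ w))))
    (∑-shift {f = λ l → f (k + l * + w)} 1ℤ (fibre-periodic k))
    where
    lemma : ∀ k l w → k + w + l * w ≡ k + (l + 1ℤ) * w
    lemma = solve-∀

  opaque
    unfolding ∑

    ∑-fold : ∀ g → ∑ (c ℕ.* w) g ≡ ∑ w (λ i → ∑ c (λ l → g (i + l * + w)))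
    ∑-fold g = begin
      ∑ (c ℕ.* w) g
        ≡⟨ sumTo-* c w (λ i → g (+ i)) ⟩
      sumTo c (λ l → sumTo w (λ i → g (+ (l ℕ.* w ℕ.+ i))))
        ≡⟨ sumTo-cong c (λ l _ → sumTo-cong w (λ i _ → cong g (lemma l i))) ⟩
      ∑ c (λ l → ∑ w (λ i → g (i + l * + w)))
        ≡⟨ ∑-comm c w (λ l i → g (i + l * + w)) ⟩
      ∑ w (λ i → ∑ c (λ l → g (i + l * + w))) ∎
      where
      lemma : ∀ l i → + (l ℕ.* w ℕ.+ i) ≡ + i + + l * + w
      lemma l i = trans (ℤ.+-comm (+ (l ℕ.* w)) (+ i)) (cong (λ x → + i + x) (ℤ.pos-* l w))

  private
    instance
      c*w≢0 : NonZero (c ℕ.* w)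
      c*w≢0 = ℕ.m*n≢0 c w

    -- The identity maps to the identity: if k = q w, only l ≡ - q modulo c meets the multiples of c
    -- w.
    ∑-δ-fibre : ∀ k → ∑ c (λ l → δ (c ℕ.* w) (k + l * + w)) ≡ δ w k
    ∑-δ-fibre k with + w ∣? k
    ... | no w∤k = trans (∑-zero c (λ l → δ-no (c ℕ.* w) (λ cw∣ → w∤k
                    (∣m+n∣n⇒∣m (∣-trans (divides (+ c) (ℤ.pos-* c w)) cw∣) (divides l refl)))))
                    (sym (δ-no w w∤k))
    ... | yes (divides q k≡qw) = begin
      ∑ c (λ l → δ (c ℕ.* w) (k + l * + w))       ≡⟨ ∑-cong c (λ l → δ≡ l) ⟩
      ∑ c (λ l → δ c (l - - q) * 1ℤ)              ≡⟨ ∑-δ {f = λ _ → 1ℤ} (- q) (λ _ → refl) ⟩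
      1ℤ                                          ≡⟨ δ-yes w (divides q k≡qw) ⟨
      δ w k                                       ∎
      where
      lemma : ∀ l q w → (l - - q) * w ≡ q * w + l * w
      lemma = solve-∀
      k+lw≡ : ∀ l → k + l * + w ≡ (l - - q) * + w
      k+lw≡ l = trans (cong (_+ l * + w) k≡qw) (sym (lemma l q (+ w)))
      indicator : ∀ l → δ (c ℕ.* w) (k + l * + w) ≡ δ c (l - - q)
      indicator l with + c ∣? (l - - q)
      ... | yes c∣ = trans (δ-yes (c ℕ.* w) (subst₂ _∣_ (sym (ℤ.pos-* c w)) (sym (k+lw≡ l)) (*-monoˡ-∣ (+ w) c∣)))
                           (sym (δ-yes c c∣))
      ... | no c∤  = trans (δ-no (c ℕ.* w) (λ cw∣ → c∤ (*-cancelʳ-∣ (+ w) (subst₂ _∣_ (ℤ.pos-* c w) (k+lw≡ l) cw∣))))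
                           (sym (δ-no c c∤))
      δ≡ : ∀ l → δ (c ℕ.* w) (k + l * + w) ≡ δ c (l - - q) * 1ℤ
      δ≡ l = trans (indicator l) (sym (ℤ.*-identityʳ _))

  -- The projection is a ring homomorphism compatible with *, and it sends G to c G, because each
  -- fibre has c elements.
  fold-twoLevel : ∀ {N κ} → TwoLevel (c ℕ.* w) N κ f → TwoLevel w N (+ c * κ) (fold w c f)
  fold-twoLevel {N} {κ} tl = twoLevel λ k → begin
    ∑ w (λ i → ∑ c (λ l → f (i + l * + w)) * fold w c f (i + k))
      ≡⟨ ∑-cong w (λ i → trans (*-distribʳ-∑ c (fold w c f (i + k)) (λ l → f (i + l * + w)))
           (∑-cong c (λ l → cong (f (i + l * + w) *_) (refold i k l)))) ⟩
    ∑ w (λ i → ∑ c (λ l → f (i + l * + w) * fold w c f (i + l * + w + k)))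
      ≡⟨ ∑-fold (λ j → f j * fold w c f (j + k)) ⟨
    ∑ (c ℕ.* w) (λ j → f j * fold w c f (j + k))
      ≡⟨ ∑-cong (c ℕ.* w) (λ j → *-distribˡ-∑ c (f j) (λ l → f (j + k + l * + w))) ⟩
    ∑ (c ℕ.* w) (λ j → ∑ c (λ l → f j * f (j + k + l * + w)))
      ≡⟨ ∑-comm (c ℕ.* w) c (λ j l → f j * f (j + k + l * + w)) ⟩
    ∑ c (λ l → ∑ (c ℕ.* w) (λ j → f j * f (j + k + l * + w)))
      ≡⟨ ∑-cong c (λ l → trans (∑-cong (c ℕ.* w) (λ j → cong (λ x → f j * f x) (ℤ.+-assoc j k (l * + w))))
           (levels tl (k + l * + w))) ⟩
    ∑ c (λ l → N * δ (c ℕ.* w) (k + l * + w) + κ)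
      ≡⟨ ∑-distrib-+ c (λ l → N * δ (c ℕ.* w) (k + l * + w)) (λ _ → κ) ⟩
    ∑ c (λ l → N * δ (c ℕ.* w) (k + l * + w)) + ∑ c (λ _ → κ)
      ≡⟨ cong₂ _+_ (sym (*-distribˡ-∑ c N (λ l → δ (c ℕ.* w) (k + l * + w)))) (∑-const c κ) ⟩
    N * ∑ c (λ l → δ (c ℕ.* w) (k + l * + w)) + + c * κ
      ≡⟨ cong (λ x → N * x + + c * κ) (∑-δ-fibre k) ⟩
    N * δ w k + + c * κ ∎
    where
    refold : ∀ i k l → fold w c f (i + k) ≡ fold w c f (i + l * + w + k)
    refold i k l = sym (trans (cong (fold w c f) (lemma i k (l * + w)))
      (periodic⇒cong {f = fold w c f} fold-periodic {i + k + l * + w} {i + k} [ divides l (lemma′ (i + k) (l * + w)) ]))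
      where
      lemma : ∀ i k x → i + x + k ≡ i + k + x
      lemma = solve-∀
      lemma′ : ∀ a x → a + x - a ≡ x
      lemma′ = solve-∀

  -- Multiplication by t carries one fibre onto another and permutes the fibre index by l ↦ t l;
  -- this is a permutation because t is a unit modulo c.
  fold-centred : ∀ {t s x} → t * s ≡ 1ℤ mod c → (∀ k → f (x + k) ≡ f (x + t * k)) →
                 ∀ k → fold w c f (x + k) ≡ fold w c f (x + t * k)
  fold-centred {t} {s} {x} ts≡1 centred k = begin
    ∑ c (λ l → f (x + k + l * + w))              ≡⟨ ∑-cong c (λ l → trans (cong f (ℤ.+-assoc x k (l * + w)))
                                                      (trans (centred (k + l * + w)) (cong f (lemma x k t l (+ w))))) ⟩
    ∑ c (λ l → f (x + t * k + t * l * + w))      ≡⟨ ∑-scale {f = λ l → f (x + t * k + l * + w)} t s ts≡1 (fibre-periodic (x + t * k)) ⟩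
    ∑ c (λ l → f (x + t * k + l * + w))          ∎
    where
    lemma : ∀ x k t l w → x + t * (k + l * w) ≡ x + t * k + t * l * w
    lemma = solve-∀

-- Affine combinations with the sum of all group elements

∑-affine-* : ∀ {w} α β f g → ∑ w g ≡ ∑ w f →
  ∑ w (λ i → (α * f i - β) * (α * g i - β)) ≡
  α * α * ∑ w (λ i → f i * g i) - α * β * (+ 2 * ∑ w f) + + w * (β * β)
∑-affine-* {w} α β f g ∑g≡∑f = begin
  ∑ w (λ i → (α * f i - β) * (α * g i - β))
    ≡⟨ ∑-cong w (λ i → expand α β (f i) (g i)) ⟩
  ∑ w (λ i → α * α * (f i * g i) + (- (α * β) * (f i + g i) + β * β))
    ≡⟨ ∑-distrib-+ w (λ i → α * α * (f i * g i)) (λ i → - (α * β) * (f i + g i) + β * β) ⟩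
  ∑ w (λ i → α * α * (f i * g i)) + ∑ w (λ i → - (α * β) * (f i + g i) + β * β)
    ≡⟨ cong₂ _+_ (sym (*-distribˡ-∑ w (α * α) (λ i → f i * g i)))
         (∑-distrib-+ w (λ i → - (α * β) * (f i + g i)) (λ _ → β * β)) ⟩
  α * α * ∑ w (λ i → f i * g i) + (∑ w (λ i → - (α * β) * (f i + g i)) + ∑ w (λ _ → β * β))
    ≡⟨ cong (λ b → α * α * ∑ w (λ i → f i * g i) + b) (cong₂ _+_
         (trans (sym (*-distribˡ-∑ w (- (α * β)) (λ i → f i + g i)))
           (cong (- (α * β) *_) (trans (∑-distrib-+ w f g) (cong (λ x → ∑ w f + x) ∑g≡∑f))))
         (∑-const w (β * β))) ⟩
  α * α * ∑ w (λ i → f i * g i) + (- (α * β) * (∑ w f + ∑ w f) + + w * (β * β))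
    ≡⟨ collect α β (∑ w (λ i → f i * g i)) (∑ w f) (+ w) ⟩
  α * α * ∑ w (λ i → f i * g i) - α * β * (+ 2 * ∑ w f) + + w * (β * β) ∎
  where
  expand : ∀ α β x y → (α * x - β) * (α * y - β) ≡ α * α * (x * y) + (- (α * β) * (x + y) + β * β)
  expand = solve-∀
  collect : ∀ α β c S w → α * α * c + (- (α * β) * (S + S) + w * (β * β)) ≡
                          α * α * c - α * β * (+ 2 * S) + w * (β * β)
  collect = solve-∀

-- Expansion of (α X - β G)(α X* - β G) by X G = (∑ f) G and G² = w G. Only the G-part depends on β,
-- which is what allows it to be cancelled.
affine-twoLevel : ∀ {w} .{{_ : NonZero w}} {N κ f} α β → Periodic w f → TwoLevel w N κ f →
  TwoLevel w (α * α * N) (α * α * κ - α * β * (+ 2 * ∑ w f) + + w * (β * β)) (λ k → α * f k - β)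
affine-twoLevel {w} {N} {κ} {f} α β per tl = twoLevel λ k → begin
  ∑ w (λ i → (α * f i - β) * (α * f (i + k) - β))
    ≡⟨ ∑-affine-* {w} α β f (λ i → f (i + k)) (∑-shift {f = f} k per) ⟩
  α * α * ∑ w (λ i → f i * f (i + k)) - α * β * (+ 2 * ∑ w f) + + w * (β * β)
    ≡⟨ cong (λ a → α * α * a - α * β * (+ 2 * ∑ w f) + + w * (β * β)) (levels tl k) ⟩
  α * α * (N * δ w k + κ) - α * β * (+ 2 * ∑ w f) + + w * (β * β)
    ≡⟨ collect α N κ (δ w k) (α * β * (+ 2 * ∑ w f)) (+ w * (β * β)) ⟩
  α * α * N * δ w k + (α * α * κ - α * β * (+ 2 * ∑ w f) + + w * (β * β)) ∎
  where
  collect : ∀ α N κ d x y → α * α * (N * d + κ) - x + y ≡ α * α * N * d + (α * α * κ - x + y)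
  collect = solve-∀

-- Sums over orbits

-- Boolean valued, so that closed instances are proved by evaluation.
allBelow : ℕ → (ℕ → Bool) → Bool
allBelow zero    P = true
allBelow (suc n) P = P n ∧ allBelow n P

allBelow⇒ : ∀ n {P} → allBelow n P ≡ true → ∀ i → i ℕ.< n → P i ≡ true
allBelow⇒ (suc n) {P} all i i<1+n with P n in Pn | ℕ.m≤n⇒m<n∨m≡n (ℕ.s≤s⁻¹ i<1+n)
... | true | inj₁ i<n  = allBelow⇒ n all i i<n
... | true | inj₂ refl = Pn

listSum : (ℤ → ℤ) → List ℕ → ℤ
listSum f []       = 0ℤ
listSum f (x ∷ xs) = f (+ x) + listSum f xs

listSum-++ : ∀ f xs ys → listSum f (xs ++ ys) ≡ listSum f xs + listSum f ys
listSum-++ f []       ys = sym (ℤ.+-identityˡ _)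
listSum-++ f (x ∷ xs) ys =
  trans (cong (λ z → f (+ x) + z) (listSum-++ f xs ys)) (sym (ℤ.+-assoc (f (+ x)) (listSum f xs) (listSum f ys)))

pick : ∀ n x (f : ℕ → ℤ) → x ℕ.< n → sumTo n (λ i → + (if does (i ℕ.≟ x) then 1 else 0) * f i) ≡ f x
pick (suc n) x f x<1+n with ℕ.m≤n⇒m<n∨m≡n (ℕ.s≤s⁻¹ x<1+n)
... | inj₁ x<n  = trans
  (cong₂ _+_ (pick n x f x<n)
    (cong (λ b → + (if b then 1 else 0) * f n) (dec-false (n ℕ.≟ x) (λ n≡x → ℕ.<-irrefl (sym n≡x) x<n))))
  (ℤ.+-identityʳ (f x))
... | inj₂ refl = trans
  (cong₂ _+_
    (trans (sumTo-cong x (λ i i<x →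
       cong (λ b → + (if b then 1 else 0) * f i) (dec-false (i ℕ.≟ x) (λ i≡x → ℕ.<-irrefl i≡x i<x))))
     (sumTo-zero x {λ _ → 0ℤ} (λ _ → refl)))
    (trans (cong (λ b → + (if b then 1 else 0) * f x) (dec-true (x ℕ.≟ x) refl)) (ℤ.*-identityˡ (f x))))
  (ℤ.+-identityˡ (f x))

module _ (q : ℕ) .{{_ : NonZero q}} where

  count : ℕ → List ℕ → ℕ
  count i []       = 0
  count i (x ∷ xs) = (if does (i ℕ.≟ x % q) then 1 else 0) ℕ.+ count i xs

  %-cong : ∀ {f} → Periodic q f → ∀ x → f (+ (x % q)) ≡ f (+ x)
  %-cong {f} per x = periodic⇒cong {f = f} per (mod-sym (≡%ℕ (+ x) q))

  opaque
    unfolding ∑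

    -- A list is compared with ℤ/q by multiplicities: when all of them are 1, its sum is the sum
    -- over ℤ/q.
    listSum-count : ∀ {f} → Periodic q f → ∀ xs → listSum f xs ≡ ∑ q (λ i → + count ∣ i ∣ xs * f i)
    listSum-count {f} per []       = sym (∑-zero q (λ _ → refl))
    listSum-count {f} per (x ∷ xs) = begin
      f (+ x) + listSum f xs
        ≡⟨ cong₂ _+_ (sym (trans (pick q (x % q) (λ i → f (+ i)) (m%n<n x q)) (%-cong {f} per x))) (listSum-count {f} per xs) ⟩
      ∑ q (λ i → [ ∣ i ∣ ≟x] * f i) + ∑ q (λ i → + count ∣ i ∣ xs * f i)
        ≡⟨ ∑-distrib-+ q (λ i → [ ∣ i ∣ ≟x] * f i) (λ i → + count ∣ i ∣ xs * f i) ⟨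
      ∑ q (λ i → [ ∣ i ∣ ≟x] * f i + + count ∣ i ∣ xs * f i)
        ≡⟨ ∑-cong q (λ i → sym (ℤ.*-distribʳ-+ (f i) [ ∣ i ∣ ≟x] (+ count ∣ i ∣ xs))) ⟩
      ∑ q (λ i → + count ∣ i ∣ (x ∷ xs) * f i) ∎
      where
      [_≟x] : ℕ → ℤ
      [ i ≟x] = + (if does (i ℕ.≟ x % q) then 1 else 0)

  module _ (t : ℕ) where

    orbit : ℕ → ℕ → List ℕ
    orbit zero    r = []
    orbit (suc d) r = r ∷ orbit d ((t ℕ.* r) % q)

    -- The orbits of multiplication by t through rs, of length d, partition the nonzero residues.
    IsTransversal : ℕ → List ℕ → Set
    IsTransversal d rs = allBelow q (λ i → does (count i (0 ∷ concatMap (orbit d) rs) ℕ.≟ 1)) ≡ true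

    module _ {f : ℤ → ℤ} (per : Periodic q f) (invariant : ∀ k → f (+ t * k) ≡ f k) where

      listSum-orbit : ∀ d r → listSum f (orbit d r) ≡ + d * f (+ r)
      listSum-orbit zero    r = refl
      listSum-orbit (suc d) r = begin
        f (+ r) + listSum f (orbit d ((t ℕ.* r) % q))     ≡⟨ cong (λ z → f (+ r) + z) (listSum-orbit d ((t ℕ.* r) % q)) ⟩
        f (+ r) + + d * f (+ ((t ℕ.* r) % q))             ≡⟨ cong (λ z → f (+ r) + + d * z) next ⟩
        f (+ r) + + d * f (+ r)                           ≡⟨ lemma (+ d) (f (+ r)) ⟩
        (1ℤ + + d) * f (+ r)                              ∎
        where
        next : f (+ ((t ℕ.* r) % q)) ≡ f (+ r)
        next = trans (%-cong {f} per (t ℕ.* r)) (trans (cong f (ℤ.pos-* t r)) (invariant (+ r)))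
        lemma : ∀ d x → x + d * x ≡ (1ℤ + d) * x
        lemma = solve-∀

      listSum-orbits : ∀ d rs → listSum f (concatMap (orbit d) rs) ≡ + d * listSum f rs
      listSum-orbits d []       = sym (ℤ.*-zeroʳ (+ d))
      listSum-orbits d (r ∷ rs) = begin
        listSum f (orbit d r ++ concatMap (orbit d) rs)            ≡⟨ listSum-++ f (orbit d r) (concatMap (orbit d) rs) ⟩
        listSum f (orbit d r) + listSum f (concatMap (orbit d) rs) ≡⟨ cong₂ _+_ (listSum-orbit d r) (listSum-orbits d rs) ⟩
        + d * f (+ r) + + d * listSum f rs                         ≡⟨ ℤ.*-distribˡ-+ (+ d) (f (+ r)) (listSum f rs) ⟨
        + d * (f (+ r) + listSum f rs)                             ∎

      -- f is constant along each orbit, so an orbit contributes d times the value at its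
      -- representative; the fixed point 0 stands alone.
      ∑-orbits : ∀ d rs → IsTransversal d rs → ∑ q f ≡ f 0ℤ + + d * listSum f rs
      ∑-orbits d rs transversal = begin
        ∑ q f                                         ≡⟨ ∑-cong-< q (λ i i<q → sym (trans
                                                           (cong (λ n → + n * f (+ i)) (counted-once i i<q)) (ℤ.*-identityˡ (f (+ i))))) ⟩
        ∑ q (λ i → + count ∣ i ∣ xs * f i)            ≡⟨ listSum-count {f} per xs ⟨
        f 0ℤ + listSum f (concatMap (orbit d) rs)     ≡⟨ cong (λ z → f 0ℤ + z) (listSum-orbits d rs) ⟩
        f 0ℤ + + d * listSum f rs                     ∎
        where
        xs = 0 ∷ concatMap (orbit d) rs
        counted-once : ∀ i → i ℕ.< q → count i xs ≡ 1
        counted-once i i<q = ℕ.≡ᵇ⇒≡ (count i xs) 1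
          (subst T (sym (allBelow⇒ q transversal i i<q)) _)

-- Passage to ℤ[ℤ/m]

residue-unique : ∀ {n r r′} → r ℕ.< n → r′ ℕ.< n → + r ≡ + r′ mod n → r ≡ r′
residue-unique {n} {r} {r′} r<n r′<n [ n∣r-r′ ] = ℤ.+-injective (ℤ.i-j≡0⇒i≡j (+ r) (+ r′) r-r′≡0)
  where
  ∣r-r′∣<n : ∣ + r - + r′ ∣ ℕ.< n
  ∣r-r′∣<n = ℕ.≤-<-trans
    (subst (λ x → ∣ x ∣ ℕ.≤ r ℕ.⊔ r′) (sym (ℤ.m-n≡m⊖n r r′)) (ℤ.∣m⊝n∣≤m⊔n r r′))
    (ℕ.⊔-pres-<m r<n r′<n)
  r-r′≡0 : + r - + r′ ≡ 0ℤ
  r-r′≡0 with ∣ + r - + r′ ∣ in eq | ∣r-r′∣<n | ∣⇒∣ᵤ n∣r-r′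
  ... | zero  | _   | _   = ℤ.∣i∣≡0⇒i≡0 eq
  ... | suc _ | d<n | n∣d = contradiction n∣d (ℕ.>⇒∤ d<n)

IsSign : ℤ → Set
IsSign x = x ≡ 1ℤ ⊎ x ≡ - 1ℤ

sign² : ∀ {x} → IsSign x → x * x ≡ 1ℤ
sign² (inj₁ refl) = refl
sign² (inj₂ refl) = refl

∑-signs-parity : ∀ n {f} → (∀ i → IsSign (f i)) → + 2 ∣ sumTo n f - + n
∑-signs-parity zero        _     = divides 0ℤ refl
∑-signs-parity (suc n) {f} signs =
  subst (+ 2 ∣_) (lemma (sumTo n f) (f n) (+ n)) (∣m∣n⇒∣m+n (∑-signs-parity n signs) (parity (signs n)))
  where
  parity : ∀ {x} → IsSign x → + 2 ∣ x - 1ℤ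
  parity (inj₁ refl) = divides 0ℤ refl
  parity (inj₂ refl) = divides (- 1ℤ) refl
  lemma : ∀ s x n → s - n + (x - 1ℤ) ≡ s + x - (1ℤ + n)
  lemma = solve-∀

-- Squares are 0 or 1 modulo 4. This is the obstruction to n being divisible by 4.
square+2-∤4 : ∀ s → ¬ (+ 4 ∣ s * s + + 2)
square+2-∤4 s 4∣s²+2 = residue (s %ℕ 4) (n%ℕd<d s 4) (subst (+ 4 ∣_)
  (trans (cong (λ x → x * x + + 2 + - (+ 2 * + r * q + + 4 * (q * q)) * + 4) (a≡a%ℕn+[a/ℕn]*n s 4)) (lemma (+ r) q))
  (∣m∣n⇒∣m+n 4∣s²+2 (divides (- (+ 2 * + r * q + + 4 * (q * q))) refl)))
  where
  r = s %ℕ 4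
  q = s /ℕ 4
  lemma : ∀ r q → (r + q * + 4) * (r + q * + 4) + + 2 + - (+ 2 * r * q + + 4 * (q * q)) * + 4 ≡ r * r + + 2
  lemma = solve-∀
  residue : ∀ r → r ℕ.< 4 → ¬ (+ 4 ∣ + r * + r + + 2)
  residue 0 _ = from-no (+ 4 ∣? + 2)
  residue 1 _ = from-no (+ 4 ∣? + 3)
  residue 2 _ = from-no (+ 4 ∣? + 6)
  residue 3 _ = from-no (+ 4 ∣? + 11)
  residue (suc (suc (suc (suc r)))) (ℕ.s≤s (ℕ.s≤s (ℕ.s≤s (ℕ.s≤s ()))))

-- For signs x and y these are (x + y)/2 and (x - y)/2.
halfSum halfDiff : ℤ → ℤ → ℤ
halfSum  x y = if does (x ≟ y) then x else 0ℤ
halfDiff x y = if does (x ≟ y) then 0ℤ else x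

halfSum+halfDiff : ∀ {x y} → IsSign x → IsSign y → halfSum x y + halfDiff x y ≡ x
halfSum+halfDiff (inj₁ refl) (inj₁ refl) = refl
halfSum+halfDiff (inj₁ refl) (inj₂ refl) = refl
halfSum+halfDiff (inj₂ refl) (inj₁ refl) = refl
halfSum+halfDiff (inj₂ refl) (inj₂ refl) = refl

halfSum-halfDiff : ∀ {x y} → IsSign x → IsSign y → halfSum x y - halfDiff x y ≡ y
halfSum-halfDiff (inj₁ refl) (inj₁ refl) = refl
halfSum-halfDiff (inj₁ refl) (inj₂ refl) = refl
halfSum-halfDiff (inj₂ refl) (inj₁ refl) = refl
halfSum-halfDiff (inj₂ refl) (inj₂ refl) = refl

halfDiff-* : ∀ {x y x′ y′} → IsSign x → IsSign y → IsSign x′ → IsSign y′ →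
             + 4 * (halfDiff x y * halfDiff x′ y′) ≡ x * x′ + y * y′ - (x * y′ + y * x′)
halfDiff-* {x} {y} {x′} {y′} sx sy sx′ sy′ = trans
  (lemma (halfSum x y) (halfDiff x y) (halfSum x′ y′) (halfDiff x′ y′))
  (cong₂ _-_ (cong₂ _+_ (cong₂ _*_ X X′) (cong₂ _*_ Y Y′)) (cong₂ _+_ (cong₂ _*_ X Y′) (cong₂ _*_ Y X′)))
  where
  X = halfSum+halfDiff sx sy
  Y = halfSum-halfDiff sx sy
  X′ = halfSum+halfDiff sx′ sy′
  Y′ = halfSum-halfDiff sx′ sy′
  lemma : ∀ s d s′ d′ → + 4 * (d * d′) ≡
    (s + d) * (s′ + d′) + (s - d) * (s′ - d′) - ((s + d) * (s′ - d′) + (s - d) * (s′ + d′))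
  lemma = solve-∀

halfSum-* : ∀ {x y x′ y′} → IsSign x → IsSign y → IsSign x′ → IsSign y′ →
            + 4 * (halfSum x y * halfSum x′ y′) ≡ x * x′ + y * y′ + (x * y′ + y * x′)
halfSum-* {x} {y} {x′} {y′} sx sy sx′ sy′ = trans
  (lemma (halfSum x y) (halfDiff x y) (halfSum x′ y′) (halfDiff x′ y′))
  (cong₂ _+_ (cong₂ _+_ (cong₂ _*_ X X′) (cong₂ _*_ Y Y′)) (cong₂ _+_ (cong₂ _*_ X Y′) (cong₂ _*_ Y X′)))
  where
  X = halfSum+halfDiff sx sy
  Y = halfSum-halfDiff sx sy
  X′ = halfSum+halfDiff sx′ sy′
  Y′ = halfSum-halfDiff sx′ sy′
  lemma : ∀ s d s′ d′ → + 4 * (s * s′) ≡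
    (s + d) * (s′ + d′) + (s - d) * (s′ - d′) + ((s + d) * (s′ - d′) + (s - d) * (s′ + d′))
  lemma = solve-∀

-- The source of all size and parity constraints: summed over a fibre of c elements it bounds |D| +
-- |S| by c and fixes D + S modulo 2.
Complementary : ℤ → ℤ → Set
Complementary d s = (d ≡ 0ℤ × ∣ s ∣ ≡ 1) ⊎ (∣ d ∣ ≡ 1 × s ≡ 0ℤ)

half-complementary : ∀ {x y} → IsSign x → IsSign y → Complementary (halfDiff x y) (halfSum x y)
half-complementary (inj₁ refl) (inj₁ refl) = inj₁ (refl , refl)
half-complementary (inj₁ refl) (inj₂ refl) = inj₂ (refl , refl)
half-complementary (inj₂ refl) (inj₁ refl) = inj₂ (refl , refl)
half-complementary (inj₂ refl) (inj₂ refl) = inj₁ (refl , refl)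

-- In terms of ℤ/n = ℤ/2 × ℤ/m with m odd, a sequence is X₀ + ω X₁ with X₀, X₁ ∈ ℤ[ℤ/m]; here
-- sum = (X₀ + X₁)/2 and diff = (X₀ - X₁)/2.
record HalfSequences (m N : ℕ) : Set where
  field
    diff sum      : ℤ → ℤ
    diff-periodic : Periodic m diff
    sum-periodic  : Periodic m sum
    diff-levels   : TwoLevel m (+ N) 0ℤ diff
    sum-levels    : TwoLevel m (+ N) 1ℤ sum
    complementary : ∀ k → Complementary (diff k) (sum k)

module _ {m N : ℕ} .{{_ : NonZero m}} (m≡1+2N : m ≡ suc (N ℕ.* 2)) {e : ℤ → ℤ}
  (per : Periodic (m ℕ.* 2) e) (signs : ∀ z → IsSign (e z))
  (tl : TwoLevel (m ℕ.* 2) (+ (m ℕ.* 2) - + 2) (+ 2) e) where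

  private
    n : ℕ
    n = m ℕ.* 2

    +n≡ : + n ≡ + m * + 2
    +n≡ = ℤ.pos-* m 2

    +m≡ : + m ≡ 1ℤ + + N * + 2
    +m≡ = trans (cong +_ m≡1+2N) (cong (λ x → 1ℤ + x) (ℤ.pos-* N 2))

    -- The even lift of k: congruent to k modulo m and to 0 modulo 2.
    lift : ℤ → ℤ
    lift k = (+ m + 1ℤ) * k

    -- The terms of the autocorrelation at lag L at the positions j and j + m. Together they have
    -- period m in j, so any m representatives modulo m, in particular the even lifts, account for
    -- all of ℤ/n.
    pair : ℤ → ℤ → ℤ
    pair L j = e j * e (j + L) + e (j + + m) * e (j + + m + L)

    e[j+m+m] : ∀ j → e (j + + m + + m) ≡ e j
    e[j+m+m] j = trans (cong e (trans (lemma j (+ m)) (cong (λ z → j + z) (sym +n≡)))) (per j)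
      where
      lemma : ∀ j m → j + m + m ≡ j + m * + 2
      lemma = solve-∀

    pair-periodic : ∀ L → Periodic m (pair L)
    pair-periodic L j = trans
      (cong (λ z → e (j + + m) * e (j + + m + L) + z) (cong₂ _*_ (e[j+m+m] j)
        (trans (cong e (lemma j (+ m) L)) (e[j+m+m] (j + L)))))
      (ℤ.+-comm (e (j + + m) * e (j + + m + L)) (e j * e (j + L)))
      where
      lemma : ∀ j m L → j + m + m + L ≡ j + L + m + m
      lemma = solve-∀

    ∑-pair : ∀ L → ∑ m (λ i → pair L (lift i)) ≡ (+ n - + 2) * δ n L + + 2
    ∑-pair L = begin
      ∑ m (λ i → pair L (lift i))
        ≡⟨ ∑-cong m (λ i → periodic⇒cong {f = pair L} (pair-periodic L) {lift i} {i} [ divides i (lemma₁ i (+ m)) ]) ⟩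
      ∑ m (pair L)
        ≡⟨ ∑-distrib-+ m (λ j → e j * e (j + L)) (λ j → e (j + + m) * e (j + + m + L)) ⟩
      ∑ m (λ j → e j * e (j + L)) + ∑ m (λ j → e (j + + m) * e (j + + m + L))
        ≡⟨ cong (λ z → ∑ m (λ j → e j * e (j + L)) + z) (∑-cong m (λ i →
             cong (λ j → e j * e (j + L)) (ℤ.+-comm i (+ m)))) ⟩
      ∑ m (λ j → e j * e (j + L)) + ∑ m (λ i → e (+ m + i) * e (+ m + i + L))
        ≡⟨ ∑-+ m m (λ j → e j * e (j + L)) ⟨
      ∑ (m ℕ.+ m) (λ j → e j * e (j + L))
        ≡⟨ cong (λ k → ∑ k (λ j → e j * e (j + L))) (trans (cong (m ℕ.+_) (sym (ℕ.+-identityʳ m))) (ℕ.*-comm 2 m)) ⟩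
      ∑ n (λ j → e j * e (j + L))
        ≡⟨ levels tl L ⟩
      (+ n - + 2) * δ n L + + 2 ∎
      where
      lemma₁ : ∀ i m → (m + 1ℤ) * i - i ≡ i * m
      lemma₁ = solve-∀

    -- The coefficients of X₀ and X₁. As m is odd, adding m changes the component in ℤ/2 and fixes
    -- the one in ℤ/m.
    x y : ℤ → ℤ
    x k = e (lift k)
    y k = e (lift k + + m)

    lift-mod : ∀ k → lift (k + + m) ≡ lift k mod n
    lift-mod k = [ divides (+ N + 1ℤ) (trans (lemma (+ m) k)
      (trans (cong (λ z → (z + 1ℤ) * + m) +m≡) (trans (lemma′ (+ N) (+ m)) (cong ((+ N + 1ℤ) *_) (sym +n≡))))) ]
      where
      lemma : ∀ m k → (m + 1ℤ) * (k + m) - (m + 1ℤ) * k ≡ (m + 1ℤ) * m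
      lemma = solve-∀
      lemma′ : ∀ N m → (1ℤ + N * + 2 + 1ℤ) * m ≡ (N + 1ℤ) * (m * + 2)
      lemma′ = solve-∀

    x-periodic : Periodic m x
    x-periodic k = periodic⇒cong {f = e} per (lift-mod k)

    y-periodic : Periodic m y
    y-periodic k = periodic⇒cong {f = λ j → e (j + + m)} (periodic-shift {f = e} (+ m) per) (lift-mod k)

    lift-+ : ∀ i k → lift (i + k) ≡ lift i + lift k
    lift-+ i k = ℤ.*-distribˡ-+ (+ m + 1ℤ) i k

    parallel : ∀ i k → x i * x (i + k) + y i * y (i + k) ≡ pair (lift k) (lift i)
    parallel i k = cong₂ (λ a b → x i * e a + y i * e b) (lift-+ i k)
      (trans (cong (_+ + m) (lift-+ i k)) (lemma (lift i) (lift k) (+ m)))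
      where
      lemma : ∀ i k m → i + k + m ≡ i + m + k
      lemma = solve-∀

    crossed : ∀ i k → x i * y (i + k) + y i * x (i + k) ≡ pair (lift k + + m) (lift i)
    crossed i k = cong₂ (λ a b → x i * a + y i * b)
      (cong e (trans (cong (_+ + m) (lift-+ i k)) (ℤ.+-assoc (lift i) (lift k) (+ m))))
      (trans (cong e (lift-+ i k)) (trans (sym (e[j+m+m] (lift i + lift k))) (cong e (lemma (lift i) (lift k) (+ m)))))
      where
      lemma : ∀ i k m → i + k + m + m ≡ i + m + (k + m)
      lemma = solve-∀

    m∣n : + m ∣ + n
    m∣n = divides (+ 2) (trans +n≡ (ℤ.*-comm (+ m) (+ 2)))

    δ-lift : ∀ k → δ n (lift k) ≡ δ m k
    δ-lift k = δ-mod-cong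
      where
      lemma₁ : ∀ m k → (m + 1ℤ) * k + - k * m ≡ k
      lemma₁ = solve-∀
      lemma₂ : ∀ N q m → (1ℤ + N * + 2 + 1ℤ) * (q * m) ≡ (N + 1ℤ) * q * (m * + 2)
      lemma₂ = solve-∀
      to : + n ∣ lift k → + m ∣ k
      to n∣ = subst (+ m ∣_) (lemma₁ (+ m) k) (∣m∣n⇒∣m+n (∣-trans m∣n n∣) (divides (- k) refl))
      from : + m ∣ k → + n ∣ lift k
      from (divides q k≡qm) = divides ((+ N + 1ℤ) * q) (trans (cong₂ (λ a b → (a + 1ℤ) * b) +m≡ k≡qm)
        (trans (lemma₂ (+ N) q (+ m)) (cong ((+ N + 1ℤ) * q *_) (sym +n≡))))
      δ-mod-cong : δ n (lift k) ≡ δ m k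
      δ-mod-cong with + m ∣? k
      ... | yes m∣k = trans (δ-yes n (from m∣k)) (sym (δ-yes m m∣k))
      ... | no m∤k  = trans (δ-no n (m∤k ∘ to)) (sym (δ-no m m∤k))

    δ-lift-odd : ∀ k → δ n (lift k + + m) ≡ 0ℤ
    δ-lift-odd k = δ-no n {lift k + + m} λ n∣ → from-no (+ 2 ∣? 1ℤ) (subst (+ 2 ∣_)
      (trans (cong (λ a → (a + 1ℤ) * k + a + - (k + + N * k + + N) * + 2) +m≡) (lemma (+ N) k))
      (∣m∣n⇒∣m+n (∣-trans (divides (+ m) +n≡) n∣) (divides (- (k + + N * k + + N)) refl)))
      where
      lemma : ∀ N k → (1ℤ + N * + 2 + 1ℤ) * k + (1ℤ + N * + 2) + - (k + N * k + N) * + 2 ≡ 1ℤ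
      lemma = solve-∀

    n-2≡4N : + n - + 2 ≡ + 4 * + N
    n-2≡4N = trans (cong (_- + 2) (trans +n≡ (cong (_* + 2) +m≡))) (lemma (+ N))
      where
      lemma : ∀ N → (1ℤ + N * + 2) * + 2 - + 2 ≡ + 4 * N
      lemma = solve-∀

    -- These are the coefficients of X₀ X₀* + X₁ X₁* = 4 N + 2 G. The lag is the even lift of k,
    -- which vanishes modulo n exactly when k vanishes modulo m.
    ∑-parallel : ∀ k → ∑ m (λ i → x i * x (i + k) + y i * y (i + k)) ≡ + 4 * + N * δ m k + + 2
    ∑-parallel k = trans (∑-cong m (λ i → parallel i k)) (trans (∑-pair (lift k))
      (cong₂ (λ a b → a * b + + 2) n-2≡4N (δ-lift k)))

    -- The mixed terms X₀ X₁* + X₁ X₀* collect the lags with nonzero component in ℤ/2. Such a lag is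
    -- never 0, so every value is 2.
    ∑-crossed : ∀ k → ∑ m (λ i → x i * y (i + k) + y i * x (i + k)) ≡ + 2
    ∑-crossed k = trans (∑-cong m (λ i → crossed i k)) (trans (∑-pair (lift k + + m))
      (trans (cong (λ b → (+ n - + 2) * b + + 2) (δ-lift-odd k)) (cong (_+ + 2) (ℤ.*-zeroʳ (+ n - + 2)))))

  -- 4 D D* is the parallel part minus the crossed part, (4 N + 2 G) - 2 G, and 4 S S* is their sum,
  -- 4 N + 4 G.
  halves : HalfSequences m N
  halves = record
    { diff = λ k → halfDiff (x k) (y k)
    ; sum  = λ k → halfSum (x k) (y k)
    ; diff-periodic = λ k → cong₂ halfDiff (x-periodic k) (y-periodic k)
    ; sum-periodic  = λ k → cong₂ halfSum (x-periodic k) (y-periodic k)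
    ; diff-levels = twoLevel λ k → ℤ.*-cancelˡ-≡ (+ 4) _ _ (begin
        + 4 * ∑ m (λ i → halfDiff (x i) (y i) * halfDiff (x (i + k)) (y (i + k)))
          ≡⟨ *-distribˡ-∑ m (+ 4) (λ i → halfDiff (x i) (y i) * halfDiff (x (i + k)) (y (i + k))) ⟩
        ∑ m (λ i → + 4 * (halfDiff (x i) (y i) * halfDiff (x (i + k)) (y (i + k))))
          ≡⟨ ∑-cong m (λ i → trans (halfDiff-* (sx i) (sy i) (sx (i + k)) (sy (i + k)))
               (cong (λ z → P i k + z) (sym (ℤ.-1*i≡-i (C i k))))) ⟩
        ∑ m (λ i → P i k + - 1ℤ * C i k)
          ≡⟨ ∑-distrib-+ m (λ i → P i k) (λ i → - 1ℤ * C i k) ⟩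
        ∑ m (λ i → P i k) + ∑ m (λ i → - 1ℤ * C i k)
          ≡⟨ cong₂ _+_ (∑-parallel k) (trans (sym (*-distribˡ-∑ m (- 1ℤ) (λ i → C i k))) (cong (- 1ℤ *_) (∑-crossed k))) ⟩
        + 4 * + N * δ m k + + 2 + - 1ℤ * + 2
          ≡⟨ lemma₁ (+ N) (δ m k) ⟩
        + 4 * (+ N * δ m k + 0ℤ) ∎)
    ; sum-levels = twoLevel λ k → ℤ.*-cancelˡ-≡ (+ 4) _ _ (begin
        + 4 * ∑ m (λ i → halfSum (x i) (y i) * halfSum (x (i + k)) (y (i + k)))
          ≡⟨ *-distribˡ-∑ m (+ 4) (λ i → halfSum (x i) (y i) * halfSum (x (i + k)) (y (i + k))) ⟩
        ∑ m (λ i → + 4 * (halfSum (x i) (y i) * halfSum (x (i + k)) (y (i + k))))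
          ≡⟨ ∑-cong m (λ i → halfSum-* (sx i) (sy i) (sx (i + k)) (sy (i + k))) ⟩
        ∑ m (λ i → P i k + C i k)
          ≡⟨ ∑-distrib-+ m (λ i → P i k) (λ i → C i k) ⟩
        ∑ m (λ i → P i k) + ∑ m (λ i → C i k)
          ≡⟨ cong₂ _+_ (∑-parallel k) (∑-crossed k) ⟩
        + 4 * + N * δ m k + + 2 + + 2
          ≡⟨ lemma₂ (+ N) (δ m k) ⟩
        + 4 * (+ N * δ m k + 1ℤ) ∎)
    ; complementary = λ k → half-complementary (sx k) (sy k)
    }
    where
    P C : ℤ → ℤ → ℤ
    P i k = x i * x (i + k) + y i * y (i + k)
    C i k = x i * y (i + k) + y i * x (i + k)
    sx : ∀ k → IsSign (x k)
    sx k = signs (lift k)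
    sy : ∀ k → IsSign (y k)
    sy k = signs (lift k + + m)
    lemma₁ : ∀ N d → + 4 * N * d + + 2 + - 1ℤ * + 2 ≡ + 4 * (N * d + 0ℤ)
    lemma₁ = solve-∀
    lemma₂ : ∀ N d → + 4 * N * d + + 2 + + 2 ≡ + 4 * (N * d + 1ℤ)
    lemma₂ = solve-∀

module Extension {n : ℕ} .{{_ : NonZero n}} {a : ℕ → ℤ} (seq : IsBinarySeqOfPeriod n a) where

  extend : ℤ → ℤ
  extend z = a (z %ℕ n)

  extend-periodic : Periodic n extend
  extend-periodic z = cong a (residue-unique (n%ℕd<d (z + + n) n) (n%ℕd<d z n)
    (mod-trans (mod-sym (≡%ℕ (z + + n) n)) (mod-trans [ divides 1ℤ (lemma z (+ n)) ] (≡%ℕ z n))))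
    where
    lemma : ∀ z n → z + n - z ≡ 1ℤ * n
    lemma = solve-∀

  extend-sign : ∀ z → IsSign (extend z)
  extend-sign z = proj₁ seq (z %ℕ n)

  extend-+ : ∀ j → extend (+ j) ≡ a j
  extend-+ j = sym (trans (cong a (m≡m%n+[m/n]*n j n)) (go (j ℕ./ n) (j ℕ.% n)))
    where
    go : ∀ q r → a (r ℕ.+ q ℕ.* n) ≡ a r
    go zero    r = cong a (ℕ.+-identityʳ r)
    go (suc q) r = trans (cong a (lemma r n (q ℕ.* n))) (trans (proj₂ seq (r ℕ.+ q ℕ.* n)) (go q r))
      where
      lemma : ∀ r n x → r ℕ.+ (n ℕ.+ x) ≡ r ℕ.+ x ℕ.+ n
      lemma r n x = trans (cong (r ℕ.+_) (ℕ.+-comm n x)) (sym (ℕ.+-assoc r x n))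

  opaque
    unfolding ∑

    autocorr-extend : ∀ r → ∑ n (λ i → extend i * extend (i + + r)) ≡ autocorr n a r
    autocorr-extend r = sumTo-cong n (λ i _ → cong₂ _*_ (extend-+ i) (extend-+ (i ℕ.+ r)))

  -- The trivial value n at lag 0 is split as (n - 2) + 2, so that all lags fit A A* = (n - 2) + 2
  -- G.
  extend-levels : (∀ t → 1 ℕ.≤ t → t ℕ.< n → autocorr n a t ≡ + 2) → TwoLevel n (+ n - + 2) (+ 2) extend
  extend-levels ac = twoLevel λ k → trans
    (∑-cong n (λ i → cong (extend i *_) (periodic⇒cong {f = extend} extend-periodic (k≡ i k))))
    (trans (by-residue (k %ℕ n) (n%ℕd<d k n)) (cong (λ x → (+ n - + 2) * x + + 2) (δ-mod n (mod-sym (≡%ℕ k n)))))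
    where
    k≡ : ∀ i k → i + k ≡ i + + (k %ℕ n) mod n
    k≡ i k = [ subst (+ n ∣_) (lemma i k (+ (k %ℕ n))) (difference (≡%ℕ k n)) ]
      where
      lemma : ∀ i k r → k - r ≡ i + k - (i + r)
      lemma = solve-∀
    by-residue : ∀ r → r ℕ.< n → ∑ n (λ i → extend i * extend (i + + r)) ≡ (+ n - + 2) * δ n (+ r) + + 2
    by-residue zero    _   = begin
      ∑ n (λ i → extend i * extend (i + 0ℤ))   ≡⟨ ∑-cong n (λ i → trans (cong (λ j → extend i * extend j) (ℤ.+-identityʳ i))
                                                    (sign² (extend-sign i))) ⟩
      ∑ n (λ _ → 1ℤ)                           ≡⟨ ∑-const n 1ℤ ⟩
      + n * 1ℤ                                 ≡⟨ lemma (+ n) ⟩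
      (+ n - + 2) * 1ℤ + + 2                   ≡⟨ cong (λ x → (+ n - + 2) * x + + 2) (δ-yes n {0ℤ} (divides 0ℤ refl)) ⟨
      (+ n - + 2) * δ n 0ℤ + + 2               ∎
      where
      lemma : ∀ n → n * 1ℤ ≡ (n - + 2) * 1ℤ + + 2
      lemma = solve-∀
    by-residue (suc r) r<n = begin
      ∑ n (λ i → extend i * extend (i + + suc r))  ≡⟨ autocorr-extend (suc r) ⟩
      autocorr n a (suc r)                         ≡⟨ ac (suc r) (ℕ.s≤s ℕ.z≤n) r<n ⟩
      + 2                                          ≡⟨ lemma (+ n) ⟩
      (+ n - + 2) * 0ℤ + + 2
        ≡⟨ cong (λ x → (+ n - + 2) * x + + 2) (δ-no n {+ suc r} (λ n∣r → ℕ.>⇒∤ r<n (∣⇒∣ᵤ n∣r))) ⟨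
      (+ n - + 2) * δ n (+ suc r) + + 2            ∎
      where
      lemma : ∀ n → + 2 ≡ (n - + 2) * 0ℤ + + 2
      lemma = solve-∀

perfect-sequence⇒halves : ∀ {n a} → 1 ℕ.< n → IsBinarySeqOfPeriod n a →
  (∀ t → 1 ℕ.≤ t → t ℕ.< n → autocorr n a t ≡ + 2) →
  ∃₂ λ m N → n ≡ m ℕ.* 2 × m ≡ suc (N ℕ.* 2) × HalfSequences m N
perfect-sequence⇒halves {n} {a} 1<n seq ac = go (∣⇒∣ᵤ 2∣n) n≢0 seq ac
  where
  n≢0 : NonZero n
  n≢0 = ℕ.>-nonZero (ℕ.<-trans ℕ.z<s 1<n)
  sign-* : ∀ {x y} → IsSign x → IsSign y → IsSign (x * y)
  sign-* (inj₁ refl) (inj₁ refl) = inj₁ refl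
  sign-* (inj₁ refl) (inj₂ refl) = inj₂ refl
  sign-* (inj₂ refl) (inj₁ refl) = inj₂ refl
  sign-* (inj₂ refl) (inj₂ refl) = inj₁ refl
  -- The autocorrelation at lag 1 is a sum of n signs, hence congruent to n modulo 2, and it equals
  -- 2.
  2∣n : + 2 ∣ + n
  2∣n = subst (+ 2 ∣_) (lemma (+ n)) (∣m∣n⇒∣m+n (divides 1ℤ refl) (∣m⇒∣-m (subst (λ x → + 2 ∣ x - + n)
    (ac 1 ℕ.≤-refl 1<n) (∑-signs-parity n (λ i → sign-* (proj₁ seq i) (proj₁ seq (i ℕ.+ 1)))))))
    where
    lemma : ∀ n → + 2 + - (+ 2 - n) ≡ n
    lemma = solve-∀
  go : ∀ {n} → 2 ℕ.∣ n → NonZero n → IsBinarySeqOfPeriod n a →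
       (∀ t → 1 ℕ.≤ t → t ℕ.< n → autocorr n a t ≡ + 2) →
       ∃₂ λ m N → n ≡ m ℕ.* 2 × m ≡ suc (N ℕ.* 2) × HalfSequences m N
  go (ℕ.divides m refl) n≢0 seq ac = m , m ℕ./ 2 , refl , m≡1+2N ,
    halves {{ℕ.m*n≢0⇒m≢0 m}} m≡1+2N extend-periodic extend-sign (extend-levels ac)
    where
    instance _ = n≢0
    open Extension {m ℕ.* 2} {a = a} seq
    S = ∑ (m ℕ.* 2) extend
    -- The augmentation gives S² = (n - 2) + 2 n = 6 m - 2; for even m this would make S² + 2 a
    -- multiple of 4.
    S²+2≡ : S * S + + 2 ≡ + m * + 6
    S²+2≡ = trans (cong (_+ + 2) (trans (twoLevel-sum extend-periodic (extend-levels ac))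
      (cong (λ z → z - + 2 + z * + 2) (ℤ.pos-* m 2)))) (lemma (+ m))
      where
      lemma : ∀ m → m * + 2 - + 2 + m * + 2 * + 2 + + 2 ≡ m * + 6
      lemma = solve-∀
    m≡1+2N : m ≡ suc (m ℕ./ 2 ℕ.* 2)
    m≡1+2N with m ℕ.% 2 in eq | m%n<n m 2 | m≡m%n+[m/n]*n m 2
    ... | 0 | _ | m≡ = contradiction (divides (+ (m ℕ./ 2) * + 3) (trans S²+2≡ (trans (cong (λ z → + z * + 6) m≡)
            (trans (cong (_* + 6) (ℤ.pos-* (m ℕ./ 2) 2)) (lemma (+ (m ℕ./ 2))))))) (square+2-∤4 S)
      where
      lemma : ∀ h → h * + 2 * + 6 ≡ h * + 3 * + 4
      lemma = solve-∀
    ... | 1 | _ | m≡ = m≡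
    ... | suc (suc _) | ℕ.s≤s (ℕ.s≤s ()) | _

-- Numerical criteria

power-mod : ∀ p j w .{{_ : NonZero w}} {r} → (p ℕ.^ j) % w ≡ r → (+ p) ^ j ≡ + r mod w
power-mod p j w refl = subst (λ z → z ≡ + ((p ℕ.^ j) % w) mod w) (pos-^ j) (≡%ℕ (+ (p ℕ.^ j)) w)
  where
  pos-^ : ∀ j → + (p ℕ.^ j) ≡ (+ p) ^ j
  pos-^ zero    = refl
  pos-^ (suc j) = trans (ℤ.pos-* p (p ℕ.^ j)) (cong (+ p *_) (pos-^ j))

module _ {w : ℕ} .{{_ : NonZero w}} {p : ℕ} (p-prime : Prime p) where

  -- The hypothesis `suc ((p ℕ.^ suc j) % w) ≡ w` is p^(j+1) ≡ -1 in a form that evaluation on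
  -- natural numbers decides.
  selfConjugate-twoLevel : ∀ j a n {f} → suc ((p ℕ.^ suc j) % w) ≡ w → Periodic w f →
    TwoLevel w (+ (p ℕ.^ (a ℕ.+ a)) * n) 0ℤ f → ∀ k → + (p ℕ.^ a) ∣ f k
  selfConjugate-twoLevel j a n p^j≡-1 per tl =
    selfConjugate-∣ p-prime j (mod-trans (power-mod p (suc j) w refl) -1≡) a {n} per tl
    where
    -1≡ : + ((p ℕ.^ suc j) % w) ≡ - 1ℤ mod w
    -1≡ = [ divides 1ℤ (trans (ℤ.+-comm (+ ((p ℕ.^ suc j) % w)) 1ℤ) (trans (cong +_ p^j≡-1) (sym (ℤ.*-identityˡ (+ w))))) ]

  correlation-twoLevel : ∀ e j m n {t f} → (p ℕ.^ suc e) % w ≡ 1 → (p ℕ.^ j) % w ≡ t → Periodic w f →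
    TwoLevel w (+ (p ℕ.^ m) * n) 0ℤ f → ∀ k → + (p ℕ.^ m) ∣ correlation (+ t) f k
  correlation-twoLevel e j m n p^e≡1 p^j≡t per tl =
    correlation-∣ p-prime e (power-mod p (suc e) w p^e≡1) j (power-mod p j w p^j≡t) m {n} per tl

coprime-∣ : ∀ {a b x} → ℕ.Coprime a b → + a ∣ x → + b ∣ x → + (a ℕ.* b) ∣ x
coprime-∣ {a} {b} {x} coprime a∣x (divides q x≡qb) = subst₂ _∣_ (sym (ℤ.pos-* a b)) (sym x≡qb)
  (*-monoˡ-∣ (+ b) {+ a} {q} (∣ᵤ⇒∣ (ℕ.coprime-divisor coprime
    (subst (a ℕ.∣_) (trans (cong ∣_∣ (trans x≡qb (ℤ.*-comm q (+ b)))) (ℤ.abs-* (+ b) q)) (∣⇒∣ᵤ a∣x)))))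

opaque
  unfolding ∑

  ∣∑∣+∣∑∣≤ : ∀ c {d s : ℤ → ℤ} → (∀ l → Complementary (d l) (s l)) → ∣ ∑ c d ∣ ℕ.+ ∣ ∑ c s ∣ ℕ.≤ c
  ∣∑∣+∣∑∣≤ zero    _ = ℕ.≤-refl
  ∣∑∣+∣∑∣≤ (suc c) {d} {s} comp = ℕ.≤-trans
    (ℕ.+-mono-≤ (ℤ.∣i+j∣≤∣i∣+∣j∣ (∑ c d) (d (+ c))) (ℤ.∣i+j∣≤∣i∣+∣j∣ (∑ c s) (s (+ c))))
    (subst₂ ℕ._≤_ (interchange (∣ ∑ c d ∣) (∣ ∑ c s ∣) (∣ d (+ c) ∣) (∣ s (+ c) ∣)) (ℕ.+-comm c 1)
      (ℕ.+-mono-≤ (∣∑∣+∣∑∣≤ c comp) (ℕ.≤-reflexive (weight (comp (+ c))))))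
    where
    open import Algebra.Properties.CommutativeSemigroup ℕ.+-commutativeSemigroup using (interchange)
    weight : ∀ {d s} → Complementary d s → ∣ d ∣ ℕ.+ ∣ s ∣ ≡ 1
    weight (inj₁ (refl , s≡)) = s≡
    weight (inj₂ (d≡ , refl)) = trans (ℕ.+-identityʳ _) d≡

  ∑-parity : ∀ c {d s : ℤ → ℤ} → (∀ l → Complementary (d l) (s l)) → + 2 ∣ ∑ c d + ∑ c s - + c
  ∑-parity zero    _ = divides 0ℤ refl
  ∑-parity (suc c) {d} {s} comp = subst (+ 2 ∣_) (lemma (∑ c d) (∑ c s) (d (+ c)) (s (+ c)) (+ c))
    (∣m∣n⇒∣m+n (∑-parity c comp) (parity (comp (+ c))))
    where
    odd : ∀ x → ∣ x ∣ ≡ 1 → + 2 ∣ x - 1ℤ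
    odd (+ 1)      _ = divides 0ℤ refl
    odd -[1+ 0 ]   _ = divides (- 1ℤ) refl
    parity : ∀ {d s} → Complementary d s → + 2 ∣ d + s - 1ℤ
    parity {s = s} (inj₁ (refl , s≡)) = subst (λ z → + 2 ∣ z - 1ℤ) (sym (ℤ.+-identityˡ s)) (odd s s≡)
    parity {d = d} (inj₂ (d≡ , refl)) = subst (λ z → + 2 ∣ z - 1ℤ) (sym (ℤ.+-identityʳ d)) (odd d d≡)
    lemma : ∀ a b x y c → a + b - c + (x + y - 1ℤ) ≡ a + x + (b + y) - (1ℤ + c)
    lemma = solve-∀

bounded : ∀ b {P : ℤ → Set} (P? : ∀ x → Dec (P x)) →
          allBelow (suc b) (λ i → does (P? (+ i)) ∧ does (P? (- + i))) ≡ true → ∀ x → ∣ x ∣ ℕ.≤ b → P x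
bounded b {P} P? all x ∣x∣≤b = by-sign x (allBelow⇒ (suc b) all ∣ x ∣ (ℕ.s≤s ∣x∣≤b))
  where
  by-sign : ∀ x → does (P? (+ ∣ x ∣)) ∧ does (P? (- + ∣ x ∣)) ≡ true → P x
  by-sign (+ i)    _ with P? (+ i)
  by-sign (+ i)    _ | yes Px = Px
  by-sign -[1+ i ] eq with P? (+ suc i) | P? -[1+ i ]
  by-sign -[1+ i ] eq | yes _ | yes Px = Px

-- A multiple of M of absolute value below M is 0, so f vanishes identically; N is its
-- autocorrelation at 0.
vanishing : ∀ {w} .{{_ : NonZero w}} {N M c f} → TwoLevel w N 0ℤ f → (∀ k → + M ∣ f k) →
            (∀ k → ∣ f k ∣ ℕ.≤ c) → c ℕ.< M → N ≡ 0ℤ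
vanishing {w} {N} {M} {c} {f} tl M∣f f≤c c<M = begin
  N                                   ≡⟨ lemma N ⟩
  N * 1ℤ + 0ℤ                         ≡⟨ cong (λ z → N * z + 0ℤ) (δ-yes w {0ℤ} (divides 0ℤ refl)) ⟨
  N * δ w 0ℤ + 0ℤ                     ≡⟨ levels tl 0ℤ ⟨
  ∑ w (λ i → f i * f (i + 0ℤ))        ≡⟨ ∑-zero w (λ i → cong (_* f (i + 0ℤ)) (f≡0 i)) ⟩
  0ℤ                                  ∎
  where
  lemma : ∀ N → N ≡ N * 1ℤ + 0ℤ
  lemma = solve-∀
  f≡0 : ∀ k → f k ≡ 0ℤ
  f≡0 k with ∣ f k ∣ in eq | f≤c k | ∣⇒∣ᵤ (M∣f k)
  ... | zero  | _  | _  = ℤ.∣i∣≡0⇒i≡0 eq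
  ... | suc _ | ≤c | M∣ = contradiction M∣ (ℕ.>⇒∤ (ℕ.≤-<-trans ≤c c<M))

sign-elim : ∀ {σ} → IsSign σ → (P : ℤ → Set) → P 1ℤ → P (- 1ℤ) → P σ
sign-elim (inj₁ refl) P p₁ p₋₁ = p₁
sign-elim (inj₂ refl) P p₁ p₋₁ = p₋₁

square-root : ∀ x r → x * x ≡ + r * + r → x ≡ + r ⊎ x ≡ - + r
square-root x r x²≡r² with ℤ.i*j≡0⇒i≡0∨j≡0 (x - + r) (trans (lemma x (+ r)) (ℤ.i≡j⇒i-j≡0 x²≡r²))
  where
  lemma : ∀ x r → (x - r) * (x + r) ≡ x * x - r * r
  lemma = solve-∀
... | inj₁ x-r≡0 = inj₁ (ℤ.i-j≡0⇒i≡j x (+ r) x-r≡0)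
... | inj₂ x+r≡0 = inj₂ (ℤ.i-j≡0⇒i≡j x (- + r) (trans (cong (λ z → x + z) (ℤ.neg-involutive (+ r))) x+r≡0))

certify : ∀ {x y w} → True (+ w ∣? (x - y)) → x ≡ y mod w
certify t = [ toWitness t ]

-- The fibre through the centre x is stable under the multiplier, which acts on x + l w by l ↦ t l.
-- Its fixed index l = 0 is x itself, so the fold determines f x modulo d.
fold-orbits : ∀ {w c} .{{_ : NonZero w}} .{{_ : NonZero c}} {f x} t → Periodic (c ℕ.* w) f →
  (∀ k → f (x + k) ≡ f (x + + t * k)) → ∀ d rs → IsTransversal c t d rs →
  fold w c f x ≡ f x + + d * listSum (λ l → f (x + l * + w)) rs
fold-orbits {w} {c} {f} {x} t per centred d rs transversal = trans
  (∑-orbits c t {λ l → f (x + l * + w)} (fibre-periodic {w} {c} per x) (λ k → sym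
    (trans (centred (k * + w)) (cong (λ z → f (x + z)) (sym (ℤ.*-assoc (+ t) k (+ w)))))) d rs transversal)
  (cong (λ z → f z + + d * listSum (λ l → f (x + l * + w)) rs) (ℤ.+-identityʳ x))

module Fold {m N : ℕ} (H : HalfSequences m N) (w c : ℕ) .{{_ : NonZero w}} .{{_ : NonZero c}} (m≡cw : m ≡ c ℕ.* w) where

  open HalfSequences H

  D S : ℤ → ℤ
  D = fold w c diff
  S = fold w c sum

  private
    diff-per : Periodic (c ℕ.* w) diff
    diff-per = subst (λ n → Periodic n diff) m≡cw diff-periodic
    sum-per : Periodic (c ℕ.* w) sum
    sum-per = subst (λ n → Periodic n sum) m≡cw sum-periodic

  D-periodic : Periodic w D
  D-periodic = fold-periodic {w} {c} diff-per

  S-periodic : Periodic w S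
  S-periodic = fold-periodic {w} {c} sum-per

  D-levels : TwoLevel w (+ N) 0ℤ D
  D-levels = subst (λ κ → TwoLevel w (+ N) κ D) (ℤ.*-zeroʳ (+ c))
    (fold-twoLevel diff-per (subst (λ n → TwoLevel n (+ N) 0ℤ diff) m≡cw diff-levels))

  S-levels : TwoLevel w (+ N) (+ c) S
  S-levels = subst (λ κ → TwoLevel w (+ N) κ S) (ℤ.*-identityʳ (+ c))
    (fold-twoLevel sum-per (subst (λ n → TwoLevel n (+ N) 1ℤ sum) m≡cw sum-levels))

  ∣D∣+∣S∣≤c : ∀ k → ∣ D k ∣ ℕ.+ ∣ S k ∣ ℕ.≤ c
  ∣D∣+∣S∣≤c k = ∣∑∣+∣∑∣≤ c (λ l → complementary (k + l * + w))

  ∣D∣≤c : ∀ k → ∣ D k ∣ ℕ.≤ c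
  ∣D∣≤c k = ℕ.≤-trans (ℕ.m≤m+n (∣ D k ∣) (∣ S k ∣)) (∣D∣+∣S∣≤c k)

  D+S-parity : ∀ k → + 2 ∣ D k + S k - + c
  D+S-parity k = ∑-parity c (λ l → complementary (k + l * + w))

affine-∑ : ∀ {w} α β f → ∑ w (λ i → α * f i - β) ≡ α * ∑ w f - + w * β
affine-∑ {w} α β f = begin
  ∑ w (λ i → α * f i - β)                     ≡⟨ ∑-distrib-+ w (λ i → α * f i) (λ _ → - β) ⟩
  ∑ w (λ i → α * f i) + ∑ w (λ _ → - β)       ≡⟨ cong₂ _+_ (sym (*-distribˡ-∑ w α f)) (∑-const w (- β)) ⟩
  α * ∑ w f + + w * - β                       ≡⟨ cong (λ z → α * ∑ w f + z) (sym (ℤ.neg-distribʳ-* (+ w) β)) ⟩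
  α * ∑ w f - + w * β                         ∎

affine-periodic : ∀ {w f} α β → Periodic w f → Periodic w (λ k → α * f k - β)
affine-periodic α β per k = cong (λ z → α * z - β) (per k)

-- Since S² = N + w κ, the required equation in β/α has the roots (S ± √N)/w. With S = 97 and N =
-- 56² the ones used below are 1/17 = (97 - 56)/697, 9 = (97 + 56)/17 and 1 = (97 - 56)/41.
affine-perfect : ∀ {w} .{{_ : NonZero w}} {N κ f} α β σ → Periodic w f → TwoLevel w N κ f →
  ∀ S → ∑ w f ≡ σ * S → α * α * κ - α * (σ * β) * (+ 2 * (σ * S)) + + w * (σ * β * (σ * β)) ≡ 0ℤ →
  TwoLevel w (α * α * N) 0ℤ (λ k → α * f k - σ * β)
affine-perfect {w} {N} {κ} {f} α β σ per tl S ∑f≡ κ≡0 =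
  subst (λ z → TwoLevel w (α * α * N) z (λ k → α * f k - σ * β))
    (trans (cong (λ z → α * α * κ - α * (σ * β) * (+ 2 * z) + + w * (σ * β * (σ * β))) ∑f≡) κ≡0)
    (affine-twoLevel α (σ * β) per tl)

invertible : ∀ {q h} → Prime q → ¬ (+ q ∣ h) → ∃ λ n → + n * h ≡ 1ℤ mod q
invertible {q} {h} q-prime q∤h = by-Bézout (ℕ.coprime-Bézout (ℕ.prime⇒coprime q-prime {{r≢0}} (n%ℕd<d h q)))
  where
  instance _ = prime⇒nonZero q-prime
  r = h %ℕ q
  r≢0 : NonZero r
  r≢0 = ℕ.≢-nonZero λ r≡0 → q∤h (divides (h /ℕ q) (trans (a≡a%ℕn+[a/ℕn]*n h q)
    (trans (cong (λ z → + z + h /ℕ q * + q) r≡0) (ℤ.+-identityˡ _))))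
  lift-eq : ∀ a b c d → 1 ℕ.+ a ℕ.* b ≡ c ℕ.* d → 1ℤ + + a * + b ≡ + c * + d
  lift-eq a b c d eq = trans (cong (λ z → 1ℤ + z) (sym (ℤ.pos-* a b))) (trans (cong +_ eq) (ℤ.pos-* c d))
  by-Bézout : Bézout.Identity 1 q r → ∃ λ n → + n * h ≡ 1ℤ mod q
  by-Bézout (Bézout.-+ a b 1+aq≡br) = b , mod-trans (*-congˡ-mod (+ b) (≡%ℕ h q))
    [ divides (+ a) (trans (cong (_- 1ℤ) (sym (lift-eq a q b r 1+aq≡br))) (lemma (+ a * + q))) ]
    where
    lemma : ∀ z → 1ℤ + z - 1ℤ ≡ z
    lemma = solve-∀
  by-Bézout (Bézout.+- a b 1+br≡aq) = (- + b) %ℕ q , mod-trans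
    (*-congʳ-mod h (mod-sym (≡%ℕ (- + b) q)))
    (mod-trans (*-congˡ-mod (- + b) (≡%ℕ h q))
      [ divides (- + a) (trans (lemma (+ b) (+ r)) (trans (cong -_ (lift-eq b r a q 1+br≡aq)) (ℤ.neg-distribˡ-* (+ a) (+ q)))) ])
    where
    lemma : ∀ b r → - b * r - 1ℤ ≡ - (1ℤ + b * r)
    lemma = solve-∀

∑-mod : ∀ c n {g a} → (∀ l → g l ≡ a mod n) → ∑ c g ≡ + c * a mod n
∑-mod c n {g} {a} g≡a = [ divides (∑ c q) (begin
  ∑ c g - + c * a                ≡⟨ cong (λ z → ∑ c g - z) (∑-const c a) ⟨
  ∑ c g - ∑ c (λ _ → a)          ≡⟨ cong (_- ∑ c (λ _ → a)) (trans (∑-cong c (λ l → split (g≡a l))) (∑-distrib-+ c (λ _ → a) (λ l → q l * + n))) ⟩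
  ∑ c (λ _ → a) + ∑ c (λ l → q l * + n) - ∑ c (λ _ → a)   ≡⟨ lemma (∑ c (λ _ → a)) (∑ c (λ l → q l * + n)) ⟩
  ∑ c (λ l → q l * + n)          ≡⟨ *-distribʳ-∑ c (+ n) q ⟨
  ∑ c q * + n                    ∎) ]
  where
  q : ℤ → ℤ
  q l = _∣_.quotient (difference (g≡a l))
  split : ∀ {x} (x≡a : x ≡ a mod n) → x ≡ a + _∣_.quotient (difference x≡a) * + n
  split {x} [ divides q x-a≡ ] = trans (lemma′ x a) (cong (λ z → a + z) x-a≡)
    where
    lemma′ : ∀ x a → x ≡ a + (x - a)
    lemma′ = solve-∀
  lemma : ∀ a b → a + b - a ≡ b
  lemma = solve-∀

-- The coset z + wℤ consists of translates of z by multiples of h, so modulo 2 the (even) sum of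
-- f over it is c (f z).
invariant⇒even : ∀ w c .{{_ : NonZero w}} .{{_ : NonZero c}} {f h} → Prime c → Periodic (c ℕ.* w) f → ¬ (+ 2 ∣ + c) →
  ¬ (+ c ∣ h) → (∀ z → f (z + h) ≡ f z mod 2) → (∀ z → + 2 ∣ fold w c f z) → ∀ z → + 2 ∣ f z
invariant⇒even w c {f} {h} c-prime per 2∤c c∤h invariant even z = odd-cancel
  (∣m+n∣n⇒∣m (subst (+ 2 ∣_) (lemma (fold w c f z) (+ c * f z)) (∣m∣n⇒∣m-n (even z)
    (difference (∑-mod c 2 (λ l → coset l))))) (divides 0ℤ refl))
  where
  n = proj₁ (invertible c-prime c∤h)
  nh≡1 = proj₂ (invertible c-prime c∤h)
  iterate⁺ : ∀ j z → f (z + + j * h) ≡ f z mod 2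
  iterate⁺ zero    z = ≡⇒≡mod (cong f (ℤ.+-identityʳ z))
  iterate⁺ (suc j) z = mod-trans (≡⇒≡mod (cong f (step z (+ j) h))) (mod-trans (invariant (z + + j * h)) (iterate⁺ j z))
    where
    step : ∀ z j h → z + (1ℤ + j) * h ≡ z + j * h + h
    step = solve-∀
  coset⁺ : ∀ j → f (z + + j * + w) ≡ f z mod 2
  coset⁺ j = mod-trans (≡⇒≡mod (periodic⇒cong {f = f} per same)) (iterate⁺ (j ℕ.* n ℕ.* w) z)
    where
    -- From n h ≡ 1 modulo c follows n w h ≡ w modulo c w: one step by w amounts to n w steps by h.
    same : z + + j * + w ≡ z + + (j ℕ.* n ℕ.* w) * h mod (c ℕ.* w)
    same = [ subst₂ _∣_ (sym (ℤ.pos-* c w)) (trans (rearrange z (+ j) (+ w) (+ n) h)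
               (cong (λ x → z + + j * + w - (z + x * h)) (sym (trans (ℤ.pos-* (j ℕ.* n) w) (cong (_* + w) (ℤ.pos-* j n))))))
             (*-monoˡ-∣ (+ w) {+ c} { - + j * (+ n * h - 1ℤ)} (∣n⇒∣m*n (- + j) (difference nh≡1))) ]
      where
      rearrange : ∀ z j w n h → - j * (n * h - 1ℤ) * w ≡ z + j * w - (z + j * n * w * h)
      rearrange = solve-∀
  coset : ∀ l → f (z + l * + w) ≡ f z mod 2
  coset l = mod-trans (≡⇒≡mod (periodic⇒cong {f = λ l → f (z + l * + w)} (fibre-periodic {w} {c} per z) (≡%ℕ l c))) (coset⁺ (l %ℕ c))
  lemma : ∀ a b → a - (a - b) ≡ b + 0ℤ
  lemma = solve-∀
  odd-cancel : + 2 ∣ + c * f z → + 2 ∣ f z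
  odd-cancel 2∣cf with euclidsLemma c (∣ f z ∣) (from-yes (prime? 2)) (subst (2 ℕ.∣_) (ℤ.abs-* (+ c) (f z)) (∣⇒∣ᵤ 2∣cf))
  ... | inj₁ 2∣c = contradiction (∣ᵤ⇒∣ 2∣c) 2∤c
  ... | inj₂ 2∣f = ∣ᵤ⇒∣ 2∣f

listSum-∣ : ∀ {n f} → (∀ k → n ∣ f k) → ∀ xs → n ∣ listSum f xs
listSum-∣ n∣f []       = divides 0ℤ refl
listSum-∣ n∣f (x ∷ xs) = ∣m∣n⇒∣m+n (n∣f (+ x)) (listSum-∣ n∣f xs)

correlation-affine : ∀ {w} .{{_ : NonZero w}} {f} t {s} α β → t * s ≡ 1ℤ mod w → Periodic w f → ∀ k →
  correlation {w} t (λ k → α * f k - β) k ≡ α * α * correlation {w} t f k - α * β * (+ 2 * ∑ w f) + + w * (β * β)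
correlation-affine {w} {f} t {s} α β ts≡1 per k = ∑-affine-* {w} α β f (λ i → f (t * i + k))
  (trans (∑-scale {f = λ i → f (i + k)} t s ts≡1 (periodic-shift {f = f} k per)) (∑-shift {f = f} k per))

cancel-unit : ∀ {w u v x y} → u * v ≡ 1ℤ mod w → + w ∣ u * (y - x) → y ≡ x mod w
cancel-unit {w} {u} {v} {x} {y} [ w∣uv-1 ] w∣u[y-x] = [ subst (+ w ∣_) (lemma u v x y)
  (∣m∣n⇒∣m-n (∣n⇒∣m*n v w∣u[y-x]) (∣n⇒∣m*n (y - x) w∣uv-1)) ]
  where
  lemma : ∀ u v x y → v * (u * (y - x)) - (y - x) * (u * v - 1ℤ) ≡ y - x
  lemma = solve-∀

-- The inverse dilation about y followed by the dilation about x is the translation by (t - 1)(y -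
-- x). The first preserves g, hence f modulo 2, and the second preserves f.
two-centres⇒translation : ∀ {w} {f g : ℤ → ℤ} {t s x y} → t * s ≡ 1ℤ mod w → Periodic w f →
  (∀ k → f (x + k) ≡ f (x + t * k)) → (∀ k → g (y + k) ≡ g (y + t * k)) →
  (∀ a b → g a ≡ g b → f a ≡ f b mod 2) → ∀ z → f (z + (t - 1ℤ) * (y - x)) ≡ f z mod 2
two-centres⇒translation {w} {f} {g} {t} {s} {x} {y} [ w∣ts-1 ] per f-centred g-centred g⇒f z =
  mod-trans (≡⇒≡mod f[z+h]≡) (mod-trans (g⇒f (y + k) (y + t * k) (g-centred k)) (≡⇒≡mod (periodic⇒cong {f = f} per y+tk≡z)))
  where
  k : ℤ
  k = s * (z - y)
  y+tk≡z : y + t * k ≡ z mod w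
  y+tk≡z = [ subst (+ w ∣_) (lemma t s y z) (∣n⇒∣m*n (z - y) w∣ts-1) ]
    where
    lemma : ∀ t s y z → (z - y) * (t * s - 1ℤ) ≡ y + t * (s * (z - y)) - z
    lemma = solve-∀
  f[z+h]≡ : f (z + (t - 1ℤ) * (y - x)) ≡ f (y + k)
  f[z+h]≡ = begin
    f (z + (t - 1ℤ) * (y - x))     ≡⟨ periodic⇒cong {f = f} per [ subst (+ w ∣_) (lemma₁ t s x y z) (∣n⇒∣m*n (z - y) w∣ts-1) ] ⟨
    f (x + t * (y - x + k))        ≡⟨ f-centred (y - x + k) ⟨
    f (x + (y - x + k))            ≡⟨ cong f (lemma₂ x y k) ⟩
    f (y + k)                      ∎
    where
    lemma₁ : ∀ t s x y z → (z - y) * (t * s - 1ℤ) ≡ x + t * (y - x + s * (z - y)) - (z + (t - 1ℤ) * (y - x))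
    lemma₁ = solve-∀
    lemma₂ : ∀ x y k → x + (y - x + k) ≡ y + k
    lemma₂ = solve-∀

-- The five candidate periods

no-halves-33 : ¬ HalfSequences 33 16
no-halves-33 H = contradiction (vanishing D-levels 4∣D ∣D∣≤c (from-yes (1 ℕ.<? 4))) λ ()
  where
  open Fold H 33 1 refl
  4∣D : ∀ k → + 4 ∣ D k
  -- 2^5 = 32 ≡ -1 modulo 33, and N = 2^4.
  4∣D = selfConjugate-twoLevel (from-yes (prime? 2)) 4 2 (+ 1) refl D-periodic D-levels

no-halves-451 : ¬ HalfSequences 451 225
no-halves-451 H = contradiction (vanishing D-levels 15∣D ∣D∣≤c (from-yes (11 ℕ.<? 15))) λ ()
  where
  -- 451 = 11 · 41. Both 3 and 5 have the odd order 5 modulo 11, so -1 is a power of them only after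
  -- the factor 11 is removed: 3^4 ≡ 5^10 ≡ -1 modulo 41.
  open Fold H 41 11 refl
  15∣D : ∀ k → + 15 ∣ D k
  15∣D k = coprime-∣ (from-yes (ℕ.coprime? 3 5))
    (selfConjugate-twoLevel (from-yes (prime? 3)) 3 1 (+ 25) refl D-periodic D-levels k)
    (selfConjugate-twoLevel (from-yes (prime? 5)) 9 1 (+ 9) refl D-periodic D-levels k)

no-halves-1216801 : ¬ HalfSequences 1216801 608400
no-halves-1216801 H = contradiction (vanishing D-levels 3∣D ∣D∣≤c (from-yes (1 ℕ.<? 3))) λ ()
  where
  open Fold H 1216801 1 refl
  3∣D : ∀ k → + 3 ∣ D k
  -- 1216801 = 571 · 2131, and 3 is a non-square modulo both primes. The exponent 20235 = 71 · 285 =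
  -- 19 · 1065 is an odd multiple of 570/2 and of 2130/2, so the power is -1. The single factor 3 of
  -- 780 suffices, as the coefficients are at most 1.
  3∣D = selfConjugate-twoLevel (from-yes (prime? 3)) 20234 1 (+ 67600) refl D-periodic D-levels

no-halves-87363 : ¬ HalfSequences 87363 43681
no-halves-87363 H = excluded (square-root (D₁₇ x) 209 (trans (cong₂ _*_ D₁₇x≡ D₁₇x≡) (twoLevel-sum D₁₇-periodic D₁₇-levels)))
  where
  -- 87363 = 9 · 9707. The factor 9 has to go: 19 ≡ 1 modulo 3, so a power t of 19 has t - 1
  -- divisible by 3, while recentring inverts t - 1.
  open Fold H 9707 9 refl
  D₁₇ : ℤ → ℤ
  D₁₇ = fold 17 571 D
  D₁₇-periodic : Periodic 17 D₁₇
  D₁₇-periodic = fold-periodic {17} {571} D-periodic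
  D₁₇-levels : TwoLevel 17 (+ 43681) 0ℤ D₁₇
  D₁₇-levels = fold-twoLevel {17} {571} D-periodic D-levels
  209∣D₁₇ : ∀ k → + 209 ∣ D₁₇ k
  209∣D₁₇ k = coprime-∣ (from-yes (ℕ.coprime? 11 19))
    (selfConjugate-twoLevel (from-yes (prime? 11)) 7 1 (+ 361) refl D₁₇-periodic D₁₇-levels k)
    (selfConjugate-twoLevel (from-yes (prime? 19)) 3 1 (+ 121) refl D₁₇-periodic D₁₇-levels k)
  -- 1364 = 11^116 = 19^194 mod 9707
  43681∣correlation : ∀ k → + 43681 ∣ correlation {9707} (+ 1364) D k
  43681∣correlation k = coprime-∣ (from-yes (ℕ.coprime? 121 361))
    (correlation-twoLevel (from-yes (prime? 11)) 4559 116 2 (+ 361) refl refl D-periodic D-levels k)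
    (correlation-twoLevel (from-yes (prime? 19)) 2279 194 2 (+ 121) refl refl D-periodic D-levels k)
  centre : ∃ λ x → ∀ k → D (x + k) ≡ D (x + + 1364 * k)
  -- 8547 and 1111 are the inverses of 1364 and 1363 modulo 9707.
  centre = multiplier {w = 9707} {N = + 43681} {s = + 8547} {t = + 1364} (certify _) {+ 1111} (certify _)
    D-periodic D-levels 43681∣correlation
  x = proj₁ centre
  D₁₇x≡ : D₁₇ x ≡ ∑ 17 D₁₇
  D₁₇x≡ = concentrated (+ 209) {+ 1364} {+ 6} {D₁₇} {x} (certify _) D₁₇-periodic D₁₇-levels 209∣D₁₇
    (fold-centred {17} {571} D-periodic {+ 1364} {+ 553} {x} (certify _) (proj₂ centre))
  Q = listSum (λ l → D (x + l * + 17)) (1 ∷ 2 ∷ [])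
  D₁₇x≡Dx+285Q : D₁₇ x ≡ D x + + 285 * Q
  -- 1364 generates the squares modulo 571, a group of order 285, and 2 is a non-square.
  D₁₇x≡Dx+285Q = fold-orbits {17} {571} {D} {x} 1364 D-periodic (proj₂ centre) 285 (1 ∷ 2 ∷ []) refl
  -- The residues of ±209 modulo 285 closest to 0 are ∓76, far beyond 9.
  small : ∀ y → ∣ y ∣ ℕ.≤ 9 → ¬ ((+ 285 ∣ + 209 - y) ⊎ (+ 285 ∣ - + 209 - y))
  small = bounded 9 (λ y → ¬? ((+ 285 ∣? (+ 209 - y)) ⊎-dec (+ 285 ∣? (- + 209 - y)))) refl
  285∣D₁₇x-Dx : + 285 ∣ D₁₇ x - D x
  285∣D₁₇x-Dx = divides Q (trans (cong (_- D x) D₁₇x≡Dx+285Q) (lemma (D x) Q))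
    where
    lemma : ∀ y q → y + + 285 * q - y ≡ q * + 285
    lemma = solve-∀
  excluded : ¬ (D₁₇ x ≡ + 209 ⊎ D₁₇ x ≡ - + 209)
  excluded (inj₁ eq) = small (D x) (∣D∣≤c x) (inj₁ (subst (λ z → + 285 ∣ z - D x) eq 285∣D₁₇x-Dx))
  excluded (inj₂ eq) = small (D x) (∣D∣≤c x) (inj₂ (subst (λ z → + 285 ∣ z - D x) eq 285∣D₁₇x-Dx))

module Excluded-6273 (H : HalfSequences 6273 3136) where

  -- 6273 = 9 · 697, and again the factor 9 is incompatible with an invertible t - 1, because 7 ≡ 1
  -- modulo 3.
  open Fold H 697 9 refl

  ∑S² : ∑ 697 S * ∑ 697 S ≡ + 97 * + 97
  ∑S² = twoLevel-sum S-periodic S-levels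

  -- 310 = 2^26 = 7^4 mod 697
  3136∣correlation : ∀ {f} n₂ n₇ → Periodic 697 f → TwoLevel 697 (+ 64 * n₂) 0ℤ f → TwoLevel 697 (+ 49 * n₇) 0ℤ f →
                  ∀ k → + 3136 ∣ correlation {697} (+ 310) f k
  3136∣correlation n₂ n₇ per tl₂ tl₇ k = coprime-∣ (from-yes (ℕ.coprime? 64 49))
    (correlation-twoLevel (from-yes (prime? 2)) 39 26 6 n₂ refl refl per tl₂ k)
    (correlation-twoLevel (from-yes (prime? 7)) 79 4 2 n₇ refl refl per tl₇ k)

  56∣₁₇ : ∀ {f} → Periodic 17 f → TwoLevel 17 (+ 3136) 0ℤ f → ∀ k → + 56 ∣ f k
  56∣₁₇ per tl k = coprime-∣ (from-yes (ℕ.coprime? 8 7))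
    (selfConjugate-twoLevel (from-yes (prime? 2)) 3 3 (+ 49) refl per tl k)
    (selfConjugate-twoLevel (from-yes (prime? 7)) 7 1 (+ 64) refl per tl k)

  56∣₄₁ : ∀ {f} → Periodic 41 f → TwoLevel 41 (+ 3136) 0ℤ f → ∀ k → + 56 ∣ f k
  56∣₄₁ per tl k = coprime-∣ (from-yes (ℕ.coprime? 8 7))
    (selfConjugate-twoLevel (from-yes (prime? 2)) 9 3 (+ 49) refl per tl k)
    (selfConjugate-twoLevel (from-yes (prime? 7)) 19 1 (+ 64) refl per tl k)

  Centred : (ℤ → ℤ) → ℤ → Set
  Centred f x = ∀ k → f (x + k) ≡ f (x + + 310 * k)

  concentrated₁₇ : ∀ {f x} → Periodic 17 f → TwoLevel 17 (+ 3136) 0ℤ f → Centred f x → f x ≡ ∑ 17 f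
  concentrated₁₇ {f} {x} per tl = concentrated (+ 56) {+ 310} {+ 6} {f} {x} (certify _) per tl (56∣₁₇ per tl)

  concentrated₄₁ : ∀ {f x} → Periodic 41 f → TwoLevel 41 (+ 3136) 0ℤ f → Centred f x → f x ≡ ∑ 41 f
  concentrated₄₁ {f} {x} per tl = concentrated (+ 56) {+ 310} {+ 28} {f} {x} (certify _) per tl (56∣₄₁ per tl)

  -- 310 is 4 modulo 17, of order 4, and 23 modulo 41, of order 10. Either way there are four orbits
  -- of nonzero residues, and these numbers represent them for both moduli.
  reps : List ℕ
  reps = 1 ∷ 2 ∷ 3 ∷ 6 ∷ []

  Q R : (ℤ → ℤ) → ℤ → ℤ
  Q f x = listSum (λ l → f (x + l * + 17)) reps
  R f x = listSum (λ l → f (x + l * + 41)) reps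

  fold₁₇ : ∀ {f x} → Periodic 697 f → Centred f x → fold 17 41 f x ≡ f x + + 10 * Q f x
  fold₁₇ {f} {x} per centred = fold-orbits {17} {41} {f} {x} 310 per centred 10 reps refl

  fold₄₁ : ∀ {f x} → Periodic 697 f → Centred f x → fold 41 17 f x ≡ f x + + 4 * R f x
  fold₄₁ {f} {x} per centred = fold-orbits {41} {17} {f} {x} 310 per centred 4 reps refl

  fold₁₇-centred : ∀ {f x} → Periodic 697 f → Centred f x → Centred (fold 17 41 f) x
  fold₁₇-centred {f} {x} per = fold-centred {17} {41} {f} per {+ 310} {+ 25} {x} (certify _)

  fold₄₁-centred : ∀ {f x} → Periodic 697 f → Centred f x → Centred (fold 41 17 f) x
  fold₄₁-centred {f} {x} per = fold-centred {41} {17} {f} per {+ 310} {+ 13} {x} (certify _)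

  multiplier₆₉₇ : ∀ {f N} .{{_ : ℤ.NonZero N}} → Periodic 697 f → TwoLevel 697 N 0ℤ f →
                  (∀ k → N ∣ correlation {697} (+ 310) f k) → ∃ (Centred f)
  multiplier₆₉₇ {f} {N} per tl = multiplier {w = 697} {N = N} {s = + 353} {t = + 310} (certify _) {+ 397} (certify _) per tl

  module Diff where

    centre : ∃ (Centred D)
    centre = multiplier₆₉₇ D-periodic D-levels (3136∣correlation (+ 49) (+ 64) D-periodic D-levels D-levels)

    x : ℤ
    x = proj₁ centre

    D₁₇-periodic : Periodic 17 (fold 17 41 D)
    D₁₇-periodic = fold-periodic {17} {41} D-periodic

    D₄₁-periodic : Periodic 41 (fold 41 17 D)
    D₄₁-periodic = fold-periodic {41} {17} D-periodic

    D₁₇-levels : TwoLevel 17 (+ 3136) 0ℤ (fold 17 41 D)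
    D₁₇-levels = fold-twoLevel {17} {41} D-periodic D-levels

    D₄₁-levels : TwoLevel 41 (+ 3136) 0ℤ (fold 41 17 D)
    D₄₁-levels = fold-twoLevel {41} {17} D-periodic D-levels

    D₁₇x : fold 17 41 D x ≡ + 56 ⊎ fold 17 41 D x ≡ - + 56
    D₁₇x = square-root (fold 17 41 D x) 56 (trans (cong₂ _*_ eq eq) (twoLevel-sum D₁₇-periodic D₁₇-levels))
      where
      eq : fold 17 41 D x ≡ ∑ 17 (fold 17 41 D)
      eq = concentrated₁₇ {fold 17 41 D} {x} D₁₇-periodic D₁₇-levels (fold₁₇-centred {D} {x} D-periodic (proj₂ centre))

    D₄₁x : fold 41 17 D x ≡ + 56 ⊎ fold 41 17 D x ≡ - + 56
    D₄₁x = square-root (fold 41 17 D x) 56 (trans (cong₂ _*_ eq eq) (twoLevel-sum D₄₁-periodic D₄₁-levels))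
      where
      eq : fold 41 17 D x ≡ ∑ 41 (fold 41 17 D)
      eq = concentrated₄₁ {fold 41 17 D} {x} D₄₁-periodic D₄₁-levels (fold₄₁-centred {D} {x} D-periodic (proj₂ centre))

    -- The fold at x is ±56 and differs from D x by a multiple of the orbit length 10. As ±56 ≡ ∓4
    -- modulo 10, only ±4 and ±6 remain within the bound 9.
    ∣Dx∣≥4 : 4 ℕ.≤ ∣ D x ∣
    ∣Dx∣≥4 = bounded 9 {λ v → ((+ 10 ∣ + 56 - v) ⊎ (+ 10 ∣ - + 56 - v)) → 4 ℕ.≤ ∣ v ∣}
      (λ v → ((+ 10 ∣? (+ 56 - v)) ⊎-dec (+ 10 ∣? (- + 56 - v))) →-dec (4 ℕ.≤? ∣ v ∣)) refl (D x) (∣D∣≤c x)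
      (residue D₁₇x)
      where
      10∣ : + 10 ∣ fold 17 41 D x - D x
      10∣ = divides (Q D x) (trans (cong (_- D x) (fold₁₇ {D} {x} D-periodic (proj₂ centre))) (lemma (D x) (Q D x)))
        where
        lemma : ∀ v q → v + + 10 * q - v ≡ q * + 10
        lemma = solve-∀
      residue : fold 17 41 D x ≡ + 56 ⊎ fold 17 41 D x ≡ - + 56 → (+ 10 ∣ + 56 - D x) ⊎ (+ 10 ∣ - + 56 - D x)
      residue (inj₁ eq) = inj₁ (subst (λ z → + 10 ∣ z - D x) eq 10∣)
      residue (inj₂ eq) = inj₂ (subst (λ z → + 10 ∣ z - D x) eq 10∣)

    -- For even D the orbit sums are even, which doubles the moduli 10 and 4. Within the bound 9, D
    -- x ≡ ±56 modulo 20 leaves ±4, whereas D x ≡ ±56 modulo 8 leaves 0 and ±8.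
    not-all-even : ¬ (∀ k → + 2 ∣ D k)
    not-all-even 2∣D = bounded 9 {λ v → ¬ (((+ 20 ∣ + 56 - v) ⊎ (+ 20 ∣ - + 56 - v)) × ((+ 8 ∣ + 56 - v) ⊎ (+ 8 ∣ - + 56 - v)))}
      (λ v → ¬? (((+ 20 ∣? (+ 56 - v)) ⊎-dec (+ 20 ∣? (- + 56 - v))) ×-dec ((+ 8 ∣? (+ 56 - v)) ⊎-dec (+ 8 ∣? (- + 56 - v)))))
      refl (D x) (∣D∣≤c x) (residue D₁₇x 20∣ , residue D₄₁x 8∣)
      where
      lemma : ∀ v a q → v + a * q - v ≡ q * a
      lemma = solve-∀
      20∣ : + 20 ∣ fold 17 41 D x - D x
      20∣ = subst (+ 20 ∣_) (sym (trans (cong (_- D x) (fold₁₇ {D} {x} D-periodic (proj₂ centre))) (trans (lemma (D x) (+ 10) (Q D x)) (ℤ.*-comm (Q D x) (+ 10)))))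
        (*-monoʳ-∣ (+ 10) {+ 2} {Q D x} (listSum-∣ (λ l → 2∣D (x + l * + 17)) reps))
      8∣ : + 8 ∣ fold 41 17 D x - D x
      8∣ = subst (+ 8 ∣_) (sym (trans (cong (_- D x) (fold₄₁ {D} {x} D-periodic (proj₂ centre))) (trans (lemma (D x) (+ 4) (R D x)) (ℤ.*-comm (R D x) (+ 4)))))
        (*-monoʳ-∣ (+ 4) {+ 2} {R D x} (listSum-∣ (λ l → 2∣D (x + l * + 41)) reps))
      residue : ∀ {y n} → y ≡ + 56 ⊎ y ≡ - + 56 → n ∣ y - D x → (n ∣ + 56 - D x) ⊎ (n ∣ - + 56 - D x)
      residue (inj₁ refl) n∣ = inj₁ n∣
      residue (inj₂ refl) n∣ = inj₂ n∣

    fold-even₁₇ : ∀ z → + 2 ∣ fold 17 41 D z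
    fold-even₁₇ z = ∣-trans (divides (+ 28) refl) (56∣₁₇ {fold 17 41 D} D₁₇-periodic D₁₇-levels z)

    fold-even₄₁ : ∀ z → + 2 ∣ fold 41 17 D z
    fold-even₄₁ z = ∣-trans (divides (+ 28) refl) (56∣₄₁ {fold 41 17 D} D₄₁-periodic D₄₁-levels z)

  module Sum {σ : ℤ} (sign : IsSign σ) (∑S≡ : ∑ 697 S ≡ σ * + 97) where

    -- Numerical identities involving σ are checked by evaluation at σ = 1 and σ = -1.
    by-sign : (P : ℤ → Set) → P 1ℤ → P (- 1ℤ) → P σ
    by-sign = sign-elim sign

    -- 17 S - σ G has a one-valued autocorrelation, so the multiplier theorem applies to it.
    X : ℤ → ℤ
    X k = + 17 * S k - σ * 1ℤ

    X-periodic : Periodic 697 X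
    X-periodic = affine-periodic {697} {S} (+ 17) (σ * 1ℤ) S-periodic

    X-levels : TwoLevel 697 (+ 906304) 0ℤ X
    X-levels = affine-perfect (+ 17) 1ℤ σ S-periodic S-levels (+ 97) ∑S≡
      (by-sign (λ σ → + 17 * + 17 * + 9 - + 17 * (σ * 1ℤ) * (+ 2 * (σ * + 97)) + + 697 * (σ * 1ℤ * (σ * 1ℤ)) ≡ 0ℤ) refl refl)

    -- X X* = 289 · 3136, but 17 divides 697, so the Frobenius argument does not reach the factor
    -- 17². It is visible directly: the constant part is - 2 · 17 · 97 + 697 = - 2601 = - 9 · 289.
    289∣correlation : ∀ k → + 289 ∣ correlation {697} (+ 310) X k
    289∣correlation k = divides (C - + 9) (begin
      correlation {697} (+ 310) X k
        ≡⟨ correlation-affine {697} {S} (+ 310) {+ 353} (+ 17) (σ * 1ℤ) (certify _) S-periodic k ⟩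
      + 17 * + 17 * C - + 17 * (σ * 1ℤ) * (+ 2 * ∑ 697 S) + + 697 * (σ * 1ℤ * (σ * 1ℤ))
        ≡⟨ cong (λ z → + 17 * + 17 * C - + 17 * (σ * 1ℤ) * (+ 2 * z) + + 697 * (σ * 1ℤ * (σ * 1ℤ))) ∑S≡ ⟩
      + 289 * C - + 17 * (σ * 1ℤ) * (+ 2 * (σ * + 97)) + + 697 * (σ * 1ℤ * (σ * 1ℤ))
        ≡⟨ ℤ.+-assoc (+ 289 * C) _ _ ⟩
      + 289 * C + (- (+ 17 * (σ * 1ℤ) * (+ 2 * (σ * + 97))) + + 697 * (σ * 1ℤ * (σ * 1ℤ)))
        ≡⟨ cong (λ z → + 289 * C + z) (by-sign (λ σ → - (+ 17 * (σ * 1ℤ) * (+ 2 * (σ * + 97))) + + 697 * (σ * 1ℤ * (σ * 1ℤ)) ≡ - + 2601) refl refl) ⟩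
      + 289 * C + - + 2601
        ≡⟨ lemma C ⟩
      (C - + 9) * + 289 ∎)
      where
      C : ℤ
      C = correlation {697} (+ 310) S k
      lemma : ∀ c → + 289 * c + - + 2601 ≡ (c - + 9) * + 289
      lemma = solve-∀

    X-centre : ∃ (Centred X)
    X-centre = multiplier₆₉₇ {X} {+ 906304} X-periodic X-levels (λ k → coprime-∣ (from-yes (ℕ.coprime? 3136 289))
      (3136∣correlation {X} (+ 14161) (+ 18496) X-periodic X-levels X-levels k) (289∣correlation k))

    y : ℤ
    y = proj₁ X-centre

    S-centred : Centred S y
    S-centred k = ℤ.*-cancelˡ-≡ (+ 17) _ _ (∙-cancelʳ (- (σ * 1ℤ)) _ _ (proj₂ X-centre k))

    concentrated-sum : ∀ {w} β {f} → f y - σ * β ≡ ∑ w f - + w * (σ * β) → ∑ w f ≡ σ * + 97 →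
                       f y ≡ σ * (+ 97 - + w * β + β)
    concentrated-sum {w} β {f} eq ∑f≡ = begin
      f y                                                ≡⟨ lemma₁ (f y) (σ * β) ⟩
      f y - σ * β + σ * β                                ≡⟨ cong (_+ σ * β) eq ⟩
      ∑ w f - + w * (σ * β) + σ * β                      ≡⟨ cong (λ z → z - + w * (σ * β) + σ * β) ∑f≡ ⟩
      σ * + 97 - + w * (σ * β) + σ * β                   ≡⟨ lemma₂ σ (+ w) β ⟩
      σ * (+ 97 - + w * β + β)                           ∎
      where
      lemma₁ : ∀ a b → a ≡ a - b + b
      lemma₁ = solve-∀
      lemma₂ : ∀ σ w β → σ * + 97 - w * (σ * β) + σ * β ≡ σ * (+ 97 - w * β + β)
      lemma₂ = solve-∀

    shifted : ℤ → (ℤ → ℤ) → ℤ → ℤ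
    shifted β f k = 1ℤ * f k - σ * β

    shifted-sum : ∀ {w} β {f} → shifted β f y ≡ ∑ w (shifted β f) → f y - σ * β ≡ ∑ w f - + w * (σ * β)
    shifted-sum {w} β {f} eq = begin
      f y - σ * β                     ≡⟨ cong (_- σ * β) (ℤ.*-identityˡ (f y)) ⟨
      shifted β f y                   ≡⟨ eq ⟩
      ∑ w (shifted β f)               ≡⟨ affine-∑ {w} 1ℤ (σ * β) f ⟩
      1ℤ * ∑ w f - + w * (σ * β)      ≡⟨ cong (_- + w * (σ * β)) (ℤ.*-identityˡ (∑ w f)) ⟩
      ∑ w f - + w * (σ * β)           ∎

    -- S₁₇ - 9 σ G is concentrated at y with total σ (97 - 17 · 9) = - 56 σ; adding 9 σ back gives
    -- the value.
    S₁₇y : fold 17 41 S y ≡ σ * - + 47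
    S₁₇y = concentrated-sum {17} (+ 9) {S₁₇} (shifted-sum {17} (+ 9) {S₁₇}
      (concentrated₁₇ {shifted (+ 9) S₁₇} {y} (affine-periodic {17} {S₁₇} 1ℤ (σ * + 9) S₁₇-periodic)
        (affine-perfect 1ℤ (+ 9) σ S₁₇-periodic (fold-twoLevel {17} {41} S-periodic S-levels) (+ 97) ∑S₁₇≡
          (by-sign (λ σ → + 369 - 1ℤ * (σ * + 9) * (+ 2 * (σ * + 97)) + + 17 * (σ * + 9 * (σ * + 9)) ≡ 0ℤ) refl refl))
        (λ k → cong (λ z → 1ℤ * z - σ * + 9) (fold₁₇-centred {S} {y} S-periodic S-centred k)))) ∑S₁₇≡
      where
      S₁₇ = fold 17 41 S
      S₁₇-periodic : Periodic 17 S₁₇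
      S₁₇-periodic = fold-periodic {17} {41} S-periodic
      ∑S₁₇≡ : ∑ 17 S₁₇ ≡ σ * + 97
      ∑S₁₇≡ = trans (sym (∑-fold {17} {41} S-periodic S)) ∑S≡

    -- Here S₄₁ - σ G is concentrated at y with total σ (97 - 41) = 56 σ, to which σ is added back.
    S₄₁y : fold 41 17 S y ≡ σ * + 57
    S₄₁y = concentrated-sum {41} 1ℤ {S₄₁} (shifted-sum {41} 1ℤ {S₄₁}
      (concentrated₄₁ {shifted 1ℤ S₄₁} {y} (affine-periodic {41} {S₄₁} 1ℤ (σ * 1ℤ) S₄₁-periodic)
        (affine-perfect 1ℤ 1ℤ σ S₄₁-periodic (fold-twoLevel {41} {17} S-periodic S-levels) (+ 97) ∑S₄₁≡
          (by-sign (λ σ → + 153 - 1ℤ * (σ * 1ℤ) * (+ 2 * (σ * + 97)) + + 41 * (σ * 1ℤ * (σ * 1ℤ)) ≡ 0ℤ) refl refl))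
        (λ k → cong (λ z → 1ℤ * z - σ * 1ℤ) (fold₄₁-centred {S} {y} S-periodic S-centred k)))) ∑S₄₁≡
      where
      S₄₁ = fold 41 17 S
      S₄₁-periodic : Periodic 41 S₄₁
      S₄₁-periodic = fold-periodic {41} {17} S-periodic
      ∑S₄₁≡ : ∑ 41 S₄₁ ≡ σ * + 97
      ∑S₄₁≡ = trans (sym (∑-fold {41} {17} S-periodic S)) ∑S≡

    -- The orbit lengths 10 and 4 give S y ≡ - 47 σ modulo 10, which leaves 3 σ and - 7 σ within the
    -- bound 9, and S y ≡ 57 σ modulo 4, which excludes 3 σ. The bound 6 is what is needed for 4 + 6
    -- > 9.
    ∣Sy∣≥6 : 6 ℕ.≤ ∣ S y ∣
    ∣Sy∣≥6 = bounded 9 {Bound} (λ v → (conditions? 1ℤ v ⊎-dec conditions? (- 1ℤ) v) →-dec (6 ℕ.≤? ∣ v ∣)) refl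
      (S y) (ℕ.≤-trans (ℕ.m≤n+m (∣ S y ∣) (∣ D y ∣)) (∣D∣+∣S∣≤c y))
      (by-sign (λ σ → Conditions σ (S y) → Conditions 1ℤ (S y) ⊎ Conditions (- 1ℤ) (S y)) inj₁ inj₂
        (divides (Q S y) (trans (cong (_- S y) (trans (sym S₁₇y) (fold₁₇ {S} {y} S-periodic S-centred))) (lemma (S y) (+ 10) (Q S y))) ,
         divides (R S y) (trans (cong (_- S y) (trans (sym S₄₁y) (fold₄₁ {S} {y} S-periodic S-centred))) (lemma (S y) (+ 4) (R S y)))))
      where
      lemma : ∀ v a q → v + a * q - v ≡ q * a
      lemma = solve-∀
      Conditions : ℤ → ℤ → Set
      Conditions σ v = (+ 10 ∣ σ * - + 47 - v) × (+ 4 ∣ σ * + 57 - v)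
      conditions? : ∀ σ v → Dec (Conditions σ v)
      conditions? σ v = (+ 10 ∣? (σ * - + 47 - v)) ×-dec (+ 4 ∣? (σ * + 57 - v))
      Bound : ℤ → Set
      Bound v = (Conditions 1ℤ v ⊎ Conditions (- 1ℤ) v) → 6 ℕ.≤ ∣ v ∣

  module _ {x y : ℤ} (D-centred : Centred D x) (S-centred : Centred S y) where

    private
      h : ℤ
      h = (+ 310 - 1ℤ) * (y - x)

      distinct-centres : 4 ℕ.≤ ∣ D x ∣ → 6 ℕ.≤ ∣ S y ∣ → ¬ (y ≡ x mod 697)
      distinct-centres ∣Dx∣≥4 ∣Sy∣≥6 y≡x = contradiction (ℕ.≤-trans (ℕ.+-mono-≤ ∣Dx∣≥4 ∣Sy∣≥6)
        (subst (λ d → ∣ d ∣ ℕ.+ ∣ S y ∣ ℕ.≤ 9) (periodic⇒cong {f = D} D-periodic y≡x) (∣D∣+∣S∣≤c y))) (from-no (10 ℕ.≤? 9))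

      -- D + S is odd everywhere, since the fibres have 9 elements; so the value of S determines D
      -- modulo 2.
      S≡⇒D≡ : ∀ a b → S a ≡ S b → D a ≡ D b mod 2
      S≡⇒D≡ a b Sa≡Sb = [ subst (+ 2 ∣_)
        (trans (cong (λ s → D a + s - + 9 - (D b + S b - + 9)) Sa≡Sb) (lemma (D a) (D b) (S b)))
        (∣m∣n⇒∣m-n (D+S-parity a) (D+S-parity b)) ]
        where
        lemma : ∀ a b s → a + s - + 9 - (b + s - + 9) ≡ a - b
        lemma = solve-∀

      D-invariant : ∀ z → D (z + h) ≡ D z mod 2
      D-invariant = two-centres⇒translation {697} {D} {S} {+ 310} {+ 353} {x} {y} (certify _)
        D-periodic D-centred S-centred S≡⇒D≡

      not-both : + 41 ∣ h → + 17 ∣ h → y ≡ x mod 697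
      not-both 41∣h 17∣h = cancel-unit {697} {+ 310 - 1ℤ} {+ 397} (certify _)
        (coprime-∣ {41} {17} {h} (from-yes (ℕ.coprime? 41 17)) 41∣h 17∣h)

      -- If a prime factor c of 697 does not divide h, translation by h moves through whole cosets
      -- of order c, and the even fold of D over these cosets makes D even. If both 17 and 41 divide
      -- h, then h ≡ 0, and 309 is invertible modulo 697.
      by-divisibility : Dec (+ 41 ∣ h) → Dec (+ 17 ∣ h) → y ≡ x mod 697
      by-divisibility (no 41∤h)  _          = ⊥-elim (Diff.not-all-even (invariant⇒even 17 41 {D} {h} (from-yes (prime? 41))
        D-periodic (from-no (+ 2 ∣? + 41)) 41∤h D-invariant Diff.fold-even₁₇))
      by-divisibility (yes _)    (no 17∤h)  = ⊥-elim (Diff.not-all-even (invariant⇒even 41 17 {D} {h} (from-yes (prime? 17))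
        D-periodic (from-no (+ 2 ∣? + 17)) 17∤h D-invariant Diff.fold-even₄₁))
      by-divisibility (yes 41∣h) (yes 17∣h) = not-both 41∣h 17∣h

    impossible : 4 ℕ.≤ ∣ D x ∣ → 6 ℕ.≤ ∣ S y ∣ → ⊥
    impossible ∣Dx∣≥4 ∣Sy∣≥6 = distinct-centres ∣Dx∣≥4 ∣Sy∣≥6 (by-divisibility (+ 41 ∣? h) (+ 17 ∣? h))

  excluded : ∀ {σ} → IsSign σ → ∑ 697 S ≡ σ * + 97 → ⊥
  excluded sign ∑S≡ = impossible {Diff.x} {Sum.y sign ∑S≡} (proj₂ Diff.centre) (Sum.S-centred sign ∑S≡) Diff.∣Dx∣≥4 (Sum.∣Sy∣≥6 sign ∑S≡)

  absurd : ⊥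
  absurd = by-cases (square-root (∑ 697 S) 97 ∑S²)
    where
    by-cases : ∑ 697 S ≡ + 97 ⊎ ∑ 697 S ≡ - + 97 → ⊥
    by-cases (inj₁ eq) = excluded {1ℤ} (inj₁ refl) eq
    by-cases (inj₂ eq) = excluded { - 1ℤ} (inj₂ refl) eq

no-halves-6273 : ¬ HalfSequences 6273 3136
no-halves-6273 = Excluded-6273.absurd

-- Pell's equation and the conclusion

pellSolutions : List ℕ
pellSolutions = 0 ∷ 1 ∷ 4 ∷ 15 ∷ 56 ∷ 209 ∷ 780 ∷ []

-- 3691/2131 is close enough to √3 for r to be ⌊√(3u² + 1)⌋ for all u < 2911.
isPell? : ∀ u → Dec ((let r = (u ℕ.* 3691) / 2131 ; v = suc (3 ℕ.* (u ℕ.* u)) in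
                      (r ℕ.* r ℕ.< v) × (v ℕ.< suc r ℕ.* suc r)) ⊎ u ∈ pellSolutions)
isPell? u = ((r ℕ.* r ℕ.<? v) ×-dec (v ℕ.<? suc r ℕ.* suc r)) ⊎-dec any? (u ℕ.≟_) pellSolutions
  where
  r v : ℕ
  r = (u ℕ.* 3691) / 2131
  v = suc (3 ℕ.* (u ℕ.* u))

-- By evaluation, every u < 2911 either is listed or has 3 u² + 1 strictly between two consecutive
-- squares, and then s can be neither at most r nor above it.
pell : ∀ u s → u ℕ.< 2911 → s ℕ.* s ≡ suc (3 ℕ.* (u ℕ.* u)) → u ∈ pellSolutions
pell u s u<2911 s²≡ = decide (isPell? u) (allBelow⇒ 2911 {λ u → does (isPell? u)} refl u u<2911)
  where
  r = (u ℕ.* 3691) / 2131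
  decide : (d : Dec ((r ℕ.* r ℕ.< suc (3 ℕ.* (u ℕ.* u)) × suc (3 ℕ.* (u ℕ.* u)) ℕ.< suc r ℕ.* suc r) ⊎ u ∈ pellSolutions)) →
           does d ≡ true → u ∈ pellSolutions
  decide (yes (inj₂ u∈)) _ = u∈
  decide (yes (inj₁ (r²<v , v<[1+r]²))) _ with ℕ.<-≤-connex r s
  ... | inj₁ r<s = contradiction (ℕ.<-≤-trans v<[1+r]² (ℕ.≤-trans (ℕ.*-mono-≤ r<s r<s) (ℕ.≤-reflexive s²≡))) (ℕ.<-irrefl refl)
  ... | inj₂ s≤r = contradiction (ℕ.<-≤-trans r²<v (ℕ.≤-trans (ℕ.≤-reflexive (sym s²≡)) (ℕ.*-mono-≤ s≤r s≤r))) (ℕ.<-irrefl refl)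

no-halves : ∀ {u} → 1 ℕ.< u → u ∈ pellSolutions → ¬ HalfSequences (suc (u ℕ.* u ℕ.* 2)) (u ℕ.* u)
no-halves () (here refl)
no-halves (ℕ.s≤s ()) (there (here refl))
no-halves _ (there (there (here refl)))                                  = no-halves-33
no-halves _ (there (there (there (here refl))))                          = no-halves-451
no-halves _ (there (there (there (there (here refl)))))                  = no-halves-6273
no-halves _ (there (there (there (there (there (here refl))))))          = no-halves-87363
no-halves _ (there (there (there (there (there (there (here refl)))))))  = no-halves-1216801

halves-bounded : ∀ {N} → HalfSequences (suc (N ℕ.* 2)) N → 1 ℕ.< N → N ℕ.< 2911 ℕ.* 2911 → ⊥
halves-bounded {N} H 1<N N<2911² = no-halves 1<u (pell u ∣ ∑ m sum ∣ u<2911 s²≡)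
  (subst (λ N → HalfSequences (suc (N ℕ.* 2)) N) N≡u² H)
  where
  open HalfSequences H
  m u : ℕ
  m = suc (N ℕ.* 2)
  u = ∣ ∑ m diff ∣
  N≡u² : N ≡ u ℕ.* u
  N≡u² = trans (sym (ℕ.+-identityʳ N)) (sym (trans (sym (ℤ.abs-* (∑ m diff) (∑ m diff)))
    (cong ∣_∣ (trans (twoLevel-sum diff-periodic diff-levels) (cong (λ z → + N + z) (ℤ.*-zeroʳ (+ m)))))))
  s²≡ : ∣ ∑ m sum ∣ ℕ.* ∣ ∑ m sum ∣ ≡ suc (3 ℕ.* (u ℕ.* u))
  s²≡ = trans (sym (ℤ.abs-* (∑ m sum) (∑ m sum)))
    (trans (cong ∣_∣ (trans (twoLevel-sum sum-periodic sum-levels) (cong (λ z → + N + z) (ℤ.*-identityʳ (+ m)))))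
    (trans (ℕ.+-suc N (N ℕ.* 2)) (cong suc (trans (cong (N ℕ.+_) (ℕ.*-comm N 2)) (cong (3 ℕ.*_) N≡u²)))))
  1<u : 1 ℕ.< u
  1<u with ℕ.<-≤-connex 1 u
  ... | inj₁ 1<u = 1<u
  ... | inj₂ u≤1 = contradiction (ℕ.<-≤-trans 1<N (subst (ℕ._≤ 1) (sym N≡u²) (ℕ.*-mono-≤ u≤1 u≤1))) (ℕ.<-irrefl refl)
  u<2911 : u ℕ.< 2911
  u<2911 with ℕ.<-≤-connex u 2911
  ... | inj₁ u<2911 = u<2911
  ... | inj₂ 2911≤u = contradiction (ℕ.<-≤-trans N<2911² (subst (2911 ℕ.* 2911 ℕ.≤_) (sym N≡u²) (ℕ.*-mono-≤ 2911≤u 2911≤u))) (ℕ.<-irrefl refl)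

period-mono : ∀ M N → M ℕ.≤ N → suc (M ℕ.* 2) ℕ.* 2 ℕ.≤ suc (N ℕ.* 2) ℕ.* 2
period-mono M N M≤N = ℕ.*-monoˡ-≤ 2 (ℕ.s≤s (ℕ.*-monoˡ-≤ 2 M≤N))

period-bounds : ∀ L U {n N} → n ≡ suc (N ℕ.* 2) ℕ.* 2 → suc (L ℕ.* 2) ℕ.* 2 ℕ.< n → n ℕ.< suc (U ℕ.* 2) ℕ.* 2 →
                L ℕ.< N × N ℕ.< U
period-bounds L U {n} {N} refl L<n n<U =
  ℕ.≰⇒> (λ N≤L → ℕ.<⇒≱ L<n (period-mono N L N≤L)) , ℕ.≰⇒> (λ U≤N → ℕ.<⇒≱ n<U (period-mono U N U≤N))

theorem3p9 : (n : ℕ) → 6 < n → n ≤ 33895685 →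
    ¬ (∃[ a ] (IsBinarySeqOfPeriod n a ×
    (∀ t → 1 ≤ t → t < n → autocorr n a t ≡ + 2)))
theorem3p9 n 6<n n≤ (a , seq , ac) = derive (perfect-sequence⇒halves (ℕ.<-trans (from-yes (1 ℕ.<? 6)) 6<n) seq ac)
  where
  derive : ¬ (∃₂ λ m N → n ≡ m ℕ.* 2 × m ≡ suc (N ℕ.* 2) × HalfSequences m N)
  derive (m , N , n≡2m , refl , H) = halves-bounded H (proj₁ bounds) (proj₂ bounds)
    where
    -- n = 2 (2 N + 1) with N = u². The bounds of the theorem are the neighbouring Pell solutions: u
    -- = 1 gives n = 6, and u = 2911, the one after 780, gives n = 33895686.
    bounds : 1 ℕ.< N × N ℕ.< 2911 ℕ.* 2911
    bounds = period-bounds 1 (2911 ℕ.* 2911) n≡2m 6<n (ℕ.s≤s n≤)
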